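{- Let $n\ge2$ and $q$ a prime power. Let $G$ be the group of $(n+1)\times(n+1)$ matrices over $\mathbb{F}_q[t]$ generated by $\{e_{i,i+1}(a+bt):a,b\in\mathbb{F}_q,1\le i\le n\}$, for $0\le i\le n-1$ let $K_{\{i\}}=\langle e_{j,j+1}(a+bt):j\in\{1,\dots,n\}\setminus\{i+1\},a,b\in\mathbb{F}_q\rangle$, and let $R_i$ be the set of all relations $g_1g_2g_3=e$ with $g_1,g_2,g_3\in K_{\{i\}}\setminus\{e\}$. If $n\ge4$ or $q$ is odd, then $G=\langle\bigcup_iK_{\{i\}}\mid\bigcup_iR_i\rangle$, and the Dehn function of this presentation is bounded independently of $q$ (for fixed $n$ and each $m$, $\operatorname{Dehn}(m)$ is bounded by a constant depending only on $n,m$, uniformly over all prime powers $q$ satisfying the hypothesis).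
   Context: $e_{i,j}(r)$ is the $(n+1)\times(n+1)$ matrix with $1$'s on the diagonal, $r$ at $(i,j)$ and $0$ elsewhere. Equivalently, $A\in G$ iff $A$ is upper unitriangular and, for $i<j$, $A(i,j)$ is a polynomial in $t$ over $\mathbb{F}_q$ of degree $\le j-i$. Dehn function: for generating set $S=\bigcup_iK_{\{i\}}$ and relators $R=\bigcup_iR_i$, the area of a freely reduced word trivial in $G$ is the least number of conjugates of elements of $R\cup R^{ -1}$ whose product in $\operatorname{Free}(S)$ equals it; $\operatorname{Dehn}(m)$ is the maximal area of trivial words of length $\le m$.
   Formalization: Stated for n ≥ 3: for n = 2 the presented group is the infinite free product of K_{0} and K_{1}, while G is finite. The identity is not a letter, and in relations an element may also be written as the formal inverse of the letter of its inverse; otherwise [g][g⁻¹] would not follow. -}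

module Defs where

open import Algebra.Bundles using (CommutativeRing)
open import Algebra.Bundles.Raw using (RawSemiring)
import Algebra.Definitions as AlgebraDefinitions
import Algebra.Definitions.RawMonoid as RawMonoidDefinitions
open import Data.Bool.Base using (if_then_else_; _∧_)
open import Data.Fin.Base using (Fin; zero; suc; inject₁)
open import Data.Fin.Properties using () renaming (_≟_ to _≟ᶠ_)
open import Data.List.Base using (List; []; _∷_; _++_; length; reverse; map; concat; foldr)
open import Data.List.Relation.Unary.All using (All)
open import Data.List.Relation.Unary.Linked using (Linked; [])
open import Data.Nat.Base using (ℕ; zero; suc; _≤_; _^_; z≤n; s≤s)
open import Data.Nat.Primality using (Prime)
open import Data.Nat.Properties using (≤-trans; m≤n⇒m<n∨m≡n)
open import Data.Product.Base using (Σ-syntax; ∃; ∃₂; ∃-syntax; _×_; _,_)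
open import Data.Sign.Base as Sign using (Sign; opposite)
open import Data.Sum.Base using (inj₁; inj₂)
open import Data.Vec.Base as Vec using (Vec)
open import Function.Bundles using (Inverse; _⇔_)
open import Level using (_⊔_; 0ℓ) renaming (suc to lsuc)
open import Relation.Binary.Bundles using (Setoid)
import Relation.Binary.Construct.On as On
open import Relation.Binary.Construct.Closure.Equivalence using (EqClosure; reflexive)
open import Relation.Binary.PropositionalEquality.Core using (_≡_; _≢_; refl)
open import Relation.Binary.PropositionalEquality.Properties using () renaming (setoid to ≡-setoid)
open import Relation.Nullary.Decidable.Core using (does)
open import Relation.Nullary.Negation.Core using (¬_)
open import Relation.Unary using (Pred)

PrimePower : ℕ → Set
PrimePower q = ∃₂ λ p k → Prime p × 1 ≤ k × q ≡ p ^ k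

record FiniteField (q : ℕ) : Set (lsuc 0ℓ) where
  field
    commutativeRing : CommutativeRing 0ℓ 0ℓ

  open CommutativeRing commutativeRing public
  open AlgebraDefinitions _≈_ using (Invertible)

  field
    1≉0         : ¬ (1# ≈ 0#)
    invertible  : ∀ x → ¬ (x ≈ 0#) → Invertible 1# _*_ x
    enumeration : Inverse setoid (≡-setoid (Fin q))

------------------------------------------------------------------------
-- F[t]: coefficient lists, constant term first; lists that differ only by
-- trailing zeros are identified by _≈_.

module Polynomial (R : CommutativeRing 0ℓ 0ℓ) where
  private module R = CommutativeRing R

  Poly : Set
  Poly = List R.Carrier

  coeff : Poly → ℕ → R.Carrier
  coeff []      _       = R.0#
  coeff (a ∷ _) zero    = a
  coeff (_ ∷ p) (suc k) = coeff p k

  infix 4 _≈_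
  infixl 6 _+_
  infixl 7 _*_

  _≈_ : Poly → Poly → Set
  p ≈ q = ∀ k → coeff p k R.≈ coeff q k

  _+_ : Poly → Poly → Poly
  []      + q       = q
  (a ∷ p) + []      = a ∷ p
  (a ∷ p) + (b ∷ q) = (a R.+ b) ∷ (p + q)

  _*_ : Poly → Poly → Poly
  []      * q = []
  (a ∷ p) * q = map (a R.*_) q + (R.0# ∷ p * q)

  rawSemiring : RawSemiring 0ℓ 0ℓ
  rawSemiring = record
    { Carrier = Poly ; _≈_ = _≈_ ; _+_ = _+_ ; _*_ = _*_ ; 0# = [] ; 1# = R.1# ∷ [] }

------------------------------------------------------------------------

module Matrix {c ℓ} (R : RawSemiring c ℓ) (n : ℕ) where
  private module R = RawSemiring R
  open RawMonoidDefinitions R.+-rawMonoid using (sum)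

  Mat : Set c
  Mat = Fin n → Fin n → R.Carrier

  infix 4 _≈_
  infixl 7 _*_

  _≈_ : Mat → Mat → Set ℓ
  A ≈ B = ∀ i j → A i j R.≈ B i j

  _*_ : Mat → Mat → Mat
  (A * B) i j = sum λ k → A i k R.* B k j

  1ᴹ : Mat
  1ᴹ i j = if does (i ≟ᶠ j) then R.1# else R.0#

  e : Fin n → Fin n → R.Carrier → Mat
  e i j r k l = if does (k ≟ᶠ i) ∧ does (l ≟ᶠ j) then r else 1ᴹ k l

  -- The subgroup generated by a set of invertible matrices.
  data ⟨_⟩ {ℓ′} (X : Pred Mat ℓ′) : Pred Mat (c ⊔ ℓ ⊔ ℓ′) where
    gen  : ∀ {A} → X A → ⟨ X ⟩ A
    one  : ⟨ X ⟩ 1ᴹ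
    mul  : ∀ {A B} → ⟨ X ⟩ A → ⟨ X ⟩ B → ⟨ X ⟩ (A * B)
    inv  : ∀ {A B} → ⟨ X ⟩ A → A * B ≈ 1ᴹ → B * A ≈ 1ᴹ → ⟨ X ⟩ B
    resp : ∀ {A B} → A ≈ B → ⟨ X ⟩ A → ⟨ X ⟩ B

------------------------------------------------------------------------
-- Free(S): words in the letters s and s⁻¹, modulo cancellation.

module FreeGroup {c ℓ} (S : Setoid c ℓ) where
  private module S = Setoid S

  Letter : Set c
  Letter = Sign × S.Carrier

  Word : Set c
  Word = List Letter

  flip : Letter → Letter
  flip (ε , s) = opposite ε , s

  infix 8 _⁻¹
  _⁻¹ : Word → Word
  w ⁻¹ = reverse (map flip w)

  Cancels : Letter → Letter → Set ℓ
  Cancels (ε , s) (δ , t) = δ ≡ opposite ε × s S.≈ t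

  infix 4 _↝_ _≋_

  -- Cancellation up to S.≈ also identifies words with S.≈-equal letters:
  -- for s S.≈ t, the word s t⁻¹ t cancels both to s and to t.
  data _↝_ : Word → Word → Set (c ⊔ ℓ) where
    cancel : ∀ u {x y} v → Cancels x y → u ++ x ∷ y ∷ v ↝ u ++ v

  _≋_ : Word → Word → Set (c ⊔ ℓ)
  _≋_ = EqClosure _↝_

  FreelyReduced : Word → Set (c ⊔ ℓ)
  FreelyReduced = Linked λ x y → ¬ Cancels x y

------------------------------------------------------------------------
-- Area and Dehn function for relators R; Trivial w says that w represents
-- the identity of the presented group.

module Filling {c ℓ r t} (S : Setoid c ℓ)
               (R : Pred (FreeGroup.Word S) r) (Trivial : Pred (FreeGroup.Word S) t) where
  open FreeGroup S

  record Conjugate : Set (c ⊔ r) where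
    field
      conjugator : Word
      sign       : Sign
      relator    : Word
      relator∈R  : R relator

    signed : Sign → Word
    signed Sign.+ = relator
    signed Sign.- = relator ⁻¹

    word : Word
    word = conjugator ++ signed sign ++ conjugator ⁻¹

  ProductOfConjugates : ℕ → Word → Set (c ⊔ ℓ ⊔ r)
  ProductOfConjugates k w =
    Σ[ cs ∈ Vec Conjugate k ] w ≋ concat (Vec.toList (Vec.map Conjugate.word cs))

  NormalClosure : Pred Word (c ⊔ ℓ ⊔ r)
  NormalClosure w = ∃[ k ] ProductOfConjugates k w

  IsArea : Word → ℕ → Set (c ⊔ ℓ ⊔ r)
  IsArea w a = ProductOfConjugates a w × (∀ k → ProductOfConjugates k w → a ≤ k)

  AreaAttained : ℕ → ℕ → Set (c ⊔ ℓ ⊔ r ⊔ t)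
  AreaAttained m a =
    ∃[ w ] FreelyReduced w × length w ≤ m × Trivial w × IsArea w a

  IsDehn : ℕ → ℕ → Set (c ⊔ ℓ ⊔ r ⊔ t)
  IsDehn m d = AreaAttained m d × (∀ a → AreaAttained m a → a ≤ d)

  -- "The least k with P k is ≤ b" is read as "P k for some k ≤ b", and
  -- "the maximum is ≤ b" as "every value is ≤ b".  This does not require
  -- that least numbers can be computed; the lemmas below relate it to IsDehn.
  Area≤ : Word → ℕ → Set (c ⊔ ℓ ⊔ r)
  Area≤ w b = ∃[ k ] k ≤ b × ProductOfConjugates k w

  Dehn≤ : ℕ → ℕ → Set (c ⊔ ℓ ⊔ r ⊔ t)
  Dehn≤ m b = ∀ w → FreelyReduced w → length w ≤ m → Trivial w → Area≤ w b

  attained-≤ : ∀ {m b} → Dehn≤ m b → ∀ a → AreaAttained m a → a ≤ b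
  attained-≤ bound a (w , red , len , tr , _ , least) with bound w red len tr
  ... | k , k≤b , prod = ≤-trans (least k prod) k≤b

  Dehn≤⇒IsDehn-≤ : ∀ {m b} → Dehn≤ m b → ∀ d → IsDehn m d → d ≤ b
  Dehn≤⇒IsDehn-≤ bound d (att , _) = attained-≤ bound d att

  private
    ¬¬-greatest : ∀ {p} (P : ℕ → Set p) b → (∀ a → P a → a ≤ b) → P 0 →
                  ¬ ¬ (∃[ d ] P d × (∀ a → P a → a ≤ d))
    ¬¬-greatest P zero    bd p₀ k = k (0 , p₀ , bd)
    ¬¬-greatest P (suc b) bd p₀ k = ¬¬-greatest P b below p₀ k
      where
      below : ∀ a → P a → a ≤ b
      below a pa with m≤n⇒m<n∨m≡n (bd a pa)
      ... | inj₁ (s≤s a≤b) = a≤b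
      ... | inj₂ refl      with () ← k (suc b , pa , bd)

  Dehn≤⇒¬¬IsDehn : Trivial [] → ∀ {m b} → Dehn≤ m b → ¬ ¬ (∃[ d ] IsDehn m d)
  Dehn≤⇒¬¬IsDehn tr {m} {b} bound =
    ¬¬-greatest (AreaAttained m) b (attained-≤ bound)
      ([] , [] , z≤n , tr , (Vec.[] , reflexive _↝_) , λ _ _ → z≤n)

------------------------------------------------------------------------

module UnipotentGroup (n : ℕ) {q} (F : FiniteField q) where
  private module F = FiniteField F
  open Polynomial F.commutativeRing using (rawSemiring)
  open Matrix rawSemiring (suc n) public

  -- Indices are 0-based: superdiagonal j r is e_{j+1,j+2}(r).
  superdiagonal : Fin n → F.Carrier → F.Carrier → Mat
  superdiagonal j a b = e (inject₁ j) (suc j) (a ∷ b ∷ [])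

  G : Pred Mat 0ℓ
  G = ⟨ (λ A → ∃[ j ] ∃[ a ] ∃[ b ] A ≈ superdiagonal j a b) ⟩

  K : Fin n → Pred Mat 0ℓ
  K i = ⟨ (λ A → ∃[ j ] j ≢ i × ∃[ a ] ∃[ b ] A ≈ superdiagonal j a b) ⟩

  -- An element of S = ⋃ᵢ K i ∖ {1}.  The identity, which occurs in no
  -- relator, is the empty word rather than a letter.  The field `inverse`
  -- is determined by `matrix`.
  record Generator : Set where
    field
      matrix    : Mat
      inverse   : Mat
      inverseʳ  : matrix * inverse ≈ 1ᴹ
      inverseˡ  : inverse * matrix ≈ 1ᴹ
      matrix∈K  : ∃[ i ] K i matrix
      matrix≉1  : ¬ (matrix ≈ 1ᴹ)

  open Generator

  matrixSetoid : Setoid 0ℓ 0ℓ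
  matrixSetoid = record
    { Carrier = Mat
    ; _≈_ = _≈_
    ; isEquivalence = record
      { refl  = λ _ _ _ → F.refl
      ; sym   = λ p i j k → F.sym (p i j k)
      ; trans = λ p q i j k → F.trans (p i j k) (q i j k)
      }
    }

  S : Setoid 0ℓ 0ℓ
  S = On.setoid matrixSetoid matrix

  open FreeGroup S public

  ⟦_⟧ : Letter → Mat
  ⟦ Sign.+ , g ⟧ = matrix g
  ⟦ Sign.- , g ⟧ = inverse g

  eval : Word → Mat
  eval = foldr (λ x A → ⟦ x ⟧ * A) 1ᴹ

  Trivial : Pred Word 0ℓ
  Trivial w = eval w ≈ 1ᴹ

  -- The relations x₁ x₂ x₃ = 1 between elements of K i ∖ {1}.  As S is closed
  -- under inverses, such an element is written in Free(S) both as the letter g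
  -- and as the formal inverse of the letter g⁻¹; both spellings are admitted.
  -- With the first spelling only, sending every letter to 1 ∈ ℤ/3 would kill
  -- all relators but not the word g · (g⁻¹), which is trivial in G.
  Relator : Fin n → Pred Word 0ℓ
  Relator i w = ∃[ x₁ ] ∃[ x₂ ] ∃[ x₃ ]
    w ≡ x₁ ∷ x₂ ∷ x₃ ∷ [] × All (λ x → K i ⟦ x ⟧) w × Trivial w

  R : Pred Word 0ℓ
  R w = ∃[ i ] Relator i w

  open Filling S R Trivial public

  -- G = ⟨ S ∣ R ⟩: evaluation maps Free(S) onto G with kernel the normal
  -- closure of R.  (False for n = 2: there G is finite, while ⟨ S ∣ R ⟩ is the
  -- free product of the two nontrivial groups K 0 and K 1.)
  record IsPresentation : Set where
    field
      image  : ∀ A → G A ⇔ (∃[ w ] eval w ≈ A)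
      kernel : ∀ w → Trivial w ⇔ NormalClosure w

-- Write e_{ij}(p) for the elementary matrices, indexed by 0 ≤ i < j ≤ n.  All commutator relations
-- between them hold inside some K_a, except those involving a row-0 and a column-n factor that
-- together cover 0, …, n.  Two facts are missing.
--
-- (1) e_{0,n−1} and e_{1,n} commute.  For n ≥ 4 this follows by writing e_{1,n} as commutators of
-- e_{12} and e_{2,n}.  For n = 3 put x = e_{01}(a), y = e_{12}(b), w = e_{23}(c), X = [x,y],
-- Y = [y,w].  Conjugating xw = wx by y gives w X w⁻¹ = x Y⁻¹ x⁻¹ X Y; replacing (a,b) by (−a,−b),
-- and then (a,c) by (−a,−c), yields that X² and Y² commute, and 2 is invertible.
--
-- (2) [e_{0,n−1}(g) , e_{n−1,n}(u)] is central, biadditive and depends only on the product g u: by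
-- the same conjugation it equals [e_{1,n}(s u)⁻¹ , e_{01}(p)] when g = p s.  This defines the
-- missing corner elements e_{0,n}(f).
--
-- With them, the ordered product σ(A) of the entries of A ∈ G satisfies σ(A) h = σ(A h) for every
-- generator h, so a word that is trivial in G is trivial in the presented group.
--
-- The bound on the Dehn function comes for free by running this argument once, in the group of
-- families of words indexed by all (q, F_q, word), modulo families of uniformly bounded area.

module Submission where

open import Algebra.Bundles using (CommutativeRing; CommutativeSemiring; Group; Monoid; RawMonoid; RawRing; Semiring)
open import Algebra.Morphism.Structures using (IsRingMonomorphism)
open import Data.Bool.Base using (true; false; if_then_else_; _∧_)
open import Data.Empty using (⊥)
open import Data.Fin.Base using (Fin; zero; suc; fromℕ<; inject₁; toℕ)
open import Data.Fin.Permutation using (Permutation; permutation)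
open import Data.Fin.Properties using (all?; any?; toℕ-fromℕ<; toℕ-injective; toℕ-inject₁; toℕ<n)
  renaming (_≟_ to _≟ᶠ_)
open import Data.List.Base using (List; []; _∷_; _++_; length; map; concat; take; drop)
open import Data.List.Properties using (++-assoc; ++-identityʳ; length-++; length-map; take++drop≡id; unfold-reverse)
open import Data.List.Relation.Unary.All using (All; []; _∷_)
open import Data.List.Relation.Unary.All.Properties using () renaming (++⁺ to All-++⁺)
open import Data.Nat.Base using (ℕ; zero; suc; _≤_; _<_; z≤n; s≤s)
open import Data.Nat.Divisibility using (_∣_; divides)
import Data.Nat.Base as ℕ
import Data.Nat.Properties as ℕ
open import Data.Nat.Properties using
  ( <-irrefl; <-trans; <-≤-trans; <⇒≢; <⇒≤; >⇒≢; m≤n⇒m<n∨m≡n; m≤n⇒m≤1+n; n≤1+n; ≤-<-connex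
  ; ≤-<-trans; ≤-pred; ≤-refl; ≤-reflexive; ≤-trans; ≰⇒>; ≮⇒≥; ≤⇒≯; n≮0)
open import Data.Product.Base using (Σ-syntax; ∃-syntax; _×_; _,_; proj₁; proj₂)
open import Data.Sign.Base as Sign using (Sign; opposite)
import Data.Sign.Properties as Sign
open import Data.Sum.Base using (_⊎_; inj₁; inj₂; [_,_]′)
open import Data.Vec.Base as Vec using (Vec)
open import Data.Vec.Properties using (toList-map; toList∘fromList)
open import Function.Bundles using (Inverse; mk⇔)
open import Level using (_⊔_; 0ℓ) renaming (suc to lsuc)
open import Relation.Binary.Bundles using (Setoid)
import Relation.Binary.Construct.Closure.Equivalence as EqClosure
open import Relation.Binary.Definitions using (tri<; tri≈; tri>)
open import Relation.Binary.PropositionalEquality.Core as ≡ using (_≡_; _≢_)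
import Relation.Binary.Reasoning.Setoid as SetoidReasoning
open import Relation.Nullary.Decidable.Core using (Dec; yes; no; does; map′; _×-dec_; _⊎-dec_)
open import Relation.Nullary.Negation.Core using (¬_; contradiction)
open import Relation.Unary using (Pred)
open import Defs

-- The obstacle is uniformity in `q`. Areas are estimated by hand only for words over a single
-- `K_a`. All nontrivial elements of `K_a` are letters, so two such words with the same value differ
-- by an area linear in their lengths, whatever `q` is. Every further step is an equational
-- deduction from such relations, and its length depends only on `n` and on the number of letters. A
-- deduction that runs in all instances at once cannot branch on coefficients or on the degree of an
-- entry. Polynomials therefore enter through an abstract ring with degree bounds and the splitting
-- `p = hd p + t * tl p`, which survive products over instances, and additivity takes the place of
-- expansions into monomials. In (1) with `n = 3`, the commuting squares only treat pairs `a b`,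
-- `b c` with a common factor `b` of degree at most 1. The values `b = 1`, `t` and `1 + t`, combined
-- by cancelling known commutations, reach all pairs of polynomials of degree at most 2.

-- Word identities in groups, and commuting elements.

module GroupSolver {c ℓ} (𝔾 : Group c ℓ) where
  open Group 𝔾
  open import Algebra.Properties.Group 𝔾 using (⁻¹-anti-homo-∙; ⁻¹-involutive; ε⁻¹≈ε)
  open SetoidReasoning setoid

  infixl 7 _⊙_
  infix 8 _⁻

  data Term (m : ℕ) : Set where
    var  : Fin m → Term m
    one  : Term m
    _⊙_  : Term m → Term m → Term m
    _⁻   : Term m → Term m

  private
    NF : ℕ → Set
    NF m = List (Sign × Fin m)

    ⟦_⟧ : ∀ {m} → Term m → Vec Carrier m → Carrier
    ⟦ var i ⟧ ρ = Vec.lookup ρ i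
    ⟦ one ⟧   ρ = ε
    ⟦ a ⊙ b ⟧ ρ = ⟦ a ⟧ ρ ∙ ⟦ b ⟧ ρ
    ⟦ a ⁻ ⟧   ρ = ⟦ a ⟧ ρ ⁻¹

    _^ˢ_ : Carrier → Sign → Carrier
    x ^ˢ Sign.+ = x
    x ^ˢ Sign.- = x ⁻¹

    nf⟦_⟧ : ∀ {m} → NF m → Vec Carrier m → Carrier
    nf⟦ [] ⟧          ρ = ε
    nf⟦ (s , i) ∷ w ⟧ ρ = (Vec.lookup ρ i ^ˢ s) ∙ nf⟦ w ⟧ ρ

    push : ∀ {m} → Sign → Fin m → NF m → NF m
    push s i [] = (s , i) ∷ []
    push s i ((s′ , j) ∷ w) with i ≟ᶠ j | s′ Sign.≟ opposite s
    ... | yes _ | yes _ = w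
    ... | yes _ | no _  = (s , i) ∷ (s′ , j) ∷ w
    ... | no _  | _     = (s , i) ∷ (s′ , j) ∷ w

    -- The result spells the term to the power given by the sign, followed by `w`. Inverses are
    -- thereby driven down to the variables and cancellation occurs only at the head, in `push`, so
    -- starting from the empty list the outcome is freely reduced.
    norm : ∀ {m} → Sign → Term m → NF m → NF m
    norm s      (var i) w = push s i w
    norm s      one     w = w
    norm Sign.+ (a ⊙ b) w = norm Sign.+ a (norm Sign.+ b w)
    norm Sign.- (a ⊙ b) w = norm Sign.- b (norm Sign.- a w)
    norm s      (a ⁻)   w = norm (opposite s) a w

    ⟦_⇓⟧ : ∀ {m} → Term m → Vec Carrier m → Carrier
    ⟦ a ⇓⟧ ρ = nf⟦ norm Sign.+ a [] ⟧ ρ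

    ^ˢ-cancel : ∀ s x → (x ^ˢ s) ∙ (x ^ˢ opposite s) ≈ ε
    ^ˢ-cancel Sign.+ x = inverseʳ x
    ^ˢ-cancel Sign.- x = inverseˡ x

    push-correct : ∀ {m} s (i : Fin m) w ρ → nf⟦ push s i w ⟧ ρ ≈ (Vec.lookup ρ i ^ˢ s) ∙ nf⟦ w ⟧ ρ
    push-correct s i [] ρ = refl
    push-correct s i ((s′ , j) ∷ w) ρ with i ≟ᶠ j | s′ Sign.≟ opposite s
    ... | yes _      | no _       = refl
    ... | no _       | _          = refl
    ... | yes ≡.refl | yes ≡.refl = begin
      nf⟦ w ⟧ ρ
        ≈⟨ identityˡ _ ⟨
      ε ∙ nf⟦ w ⟧ ρ
        ≈⟨ ∙-congʳ (^ˢ-cancel s (Vec.lookup ρ i)) ⟨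
      (Vec.lookup ρ i ^ˢ s) ∙ (Vec.lookup ρ i ^ˢ opposite s) ∙ nf⟦ w ⟧ ρ
        ≈⟨ assoc _ _ _ ⟩
      (Vec.lookup ρ i ^ˢ s) ∙ ((Vec.lookup ρ i ^ˢ opposite s) ∙ nf⟦ w ⟧ ρ) ∎

    norm-correct : ∀ {m} s (a : Term m) w ρ → nf⟦ norm s a w ⟧ ρ ≈ (⟦ a ⟧ ρ ^ˢ s) ∙ nf⟦ w ⟧ ρ
    norm-correct Sign.+ (var i) w ρ = push-correct Sign.+ i w ρ
    norm-correct Sign.- (var i) w ρ = push-correct Sign.- i w ρ
    norm-correct Sign.+ one     w ρ = sym (identityˡ _)
    norm-correct Sign.- one     w ρ = sym (trans (∙-congʳ ε⁻¹≈ε) (identityˡ _))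
    norm-correct Sign.+ (a ⊙ b) w ρ = begin
      nf⟦ norm Sign.+ a (norm Sign.+ b w) ⟧ ρ   ≈⟨ norm-correct Sign.+ a _ ρ ⟩
      ⟦ a ⟧ ρ ∙ nf⟦ norm Sign.+ b w ⟧ ρ         ≈⟨ ∙-congˡ (norm-correct Sign.+ b w ρ) ⟩
      ⟦ a ⟧ ρ ∙ (⟦ b ⟧ ρ ∙ nf⟦ w ⟧ ρ)           ≈⟨ assoc _ _ _ ⟨
      ⟦ a ⟧ ρ ∙ ⟦ b ⟧ ρ ∙ nf⟦ w ⟧ ρ             ∎
    norm-correct Sign.- (a ⊙ b) w ρ = begin
      nf⟦ norm Sign.- b (norm Sign.- a w) ⟧ ρ     ≈⟨ norm-correct Sign.- b _ ρ ⟩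
      ⟦ b ⟧ ρ ⁻¹ ∙ nf⟦ norm Sign.- a w ⟧ ρ        ≈⟨ ∙-congˡ (norm-correct Sign.- a w ρ) ⟩
      ⟦ b ⟧ ρ ⁻¹ ∙ (⟦ a ⟧ ρ ⁻¹ ∙ nf⟦ w ⟧ ρ)       ≈⟨ assoc _ _ _ ⟨
      ⟦ b ⟧ ρ ⁻¹ ∙ ⟦ a ⟧ ρ ⁻¹ ∙ nf⟦ w ⟧ ρ         ≈⟨ ∙-congʳ (⁻¹-anti-homo-∙ _ _) ⟨
      (⟦ a ⟧ ρ ∙ ⟦ b ⟧ ρ) ⁻¹ ∙ nf⟦ w ⟧ ρ          ∎
    norm-correct Sign.+ (a ⁻)   w ρ = norm-correct Sign.- a w ρ
    norm-correct Sign.- (a ⁻)   w ρ =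
      trans (norm-correct Sign.+ a w ρ) (∙-congʳ (sym (⁻¹-involutive _)))

    correct : ∀ {m} (a : Term m) ρ → ⟦ a ⇓⟧ ρ ≈ ⟦ a ⟧ ρ
    correct a ρ = trans (norm-correct Sign.+ a [] ρ) (identityʳ _)

  open import Relation.Binary.Reflection setoid var ⟦_⟧ ⟦_⇓⟧ correct public using (solve; _⊜_)

module Commuting {c ℓ} (𝔾 : Group c ℓ) where
  open Group 𝔾
  open GroupSolver 𝔾

  infix 4 _⇄_

  _⇄_ : Carrier → Carrier → Set ℓ
  x ⇄ y = x ∙ y ≈ y ∙ x

  ⁅_,_⁆ : Carrier → Carrier → Carrier
  ⁅ x , y ⁆ = x ∙ y ∙ x ⁻¹ ∙ y ⁻¹

  ⇄-sym : ∀ {x y} → x ⇄ y → y ⇄ x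
  ⇄-sym = sym

  ⇄-cong : ∀ {x x′ y y′} → x ≈ x′ → y ≈ y′ → x ⇄ y → x′ ⇄ y′
  ⇄-cong p q c = trans (∙-cong (sym p) (sym q)) (trans c (∙-cong q p))

  ⇄-∙ : ∀ {x y z} → x ⇄ y → x ⇄ z → x ⇄ y ∙ z
  ⇄-∙ {x} {y} {z} p q =
    trans (sym (assoc _ _ _)) (trans (∙-congʳ p) (trans (assoc _ _ _)
      (trans (∙-congˡ q) (sym (assoc _ _ _)))))

  ⇄-⁻¹ : ∀ {x y} → x ⇄ y → x ⇄ y ⁻¹
  ⇄-⁻¹ {x} {y} p =
    trans (solve 2 (λ x y → x ⊙ y ⁻ ⊜ y ⁻ ⊙ (y ⊙ x) ⊙ y ⁻) refl x y)
      (trans (∙-congʳ (∙-congˡ (sym p)))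
        (solve 2 (λ x y → y ⁻ ⊙ (x ⊙ y) ⊙ y ⁻ ⊜ y ⁻ ⊙ x) refl x y))

  ⇄-⁅⁆ : ∀ {x y z} → x ⇄ y → x ⇄ z → x ⇄ ⁅ y , z ⁆
  ⇄-⁅⁆ p q = ⇄-∙ (⇄-∙ (⇄-∙ p q) (⇄-⁻¹ p)) (⇄-⁻¹ q)

  -- Centralisers are subgroups. In this form a known commutation is split off from the commutation
  -- with a product, which drives the polarisation for `n = 3`.
  ⇄-cancelˡ : ∀ {x y z} → x ⇄ y → x ⇄ y ∙ z → x ⇄ z
  ⇄-cancelˡ {x} {y} {z} p q =
    ⇄-cong refl (solve 2 (λ y z → y ⁻ ⊙ (y ⊙ z) ⊜ z) refl y z) (⇄-∙ (⇄-⁻¹ p) q)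

  ⁅⁆-cong : ∀ {x x′ y y′} → x ≈ x′ → y ≈ y′ → ⁅ x , y ⁆ ≈ ⁅ x′ , y′ ⁆
  ⁅⁆-cong p q = ∙-cong (∙-cong (∙-cong p q) (⁻¹-cong p)) (⁻¹-cong q)

-- Filtered rings and the relations inside the subgroups `K_a`.

-- D i j p stands for deg p ≤ j − i; it forces p = 0 when j < i.
record FilteredRing c ℓ d : Set (lsuc (c ⊔ ℓ ⊔ d)) where
  field
    commutativeRing : CommutativeRing c ℓ

  open CommutativeRing commutativeRing public

  field
    D         : ℕ → ℕ → Carrier → Set d
    D-resp    : ∀ {i j p r} → p ≈ r → D i j p → D i j r
    D-weaken  : ∀ {i i′ j j′ p} → i′ ≤ i → j ≤ j′ → D i j p → D i′ j′ p
    D-shift   : ∀ {i j p} → D i j p → D (suc i) (suc j) p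
    D-unshift : ∀ {i j p} → D (suc i) (suc j) p → D i j p
    D-0#      : ∀ {i j} → D i j 0#
    D⇒≈0#     : ∀ {i j p} → j < i → D i j p → p ≈ 0#
    D-1#      : ∀ {i} → D i i 1#
    D-+       : ∀ {i j p r} → D i j p → D i j r → D i j (p + r)
    D-neg     : ∀ {i j p} → D i j p → D i j (- p)
    D-*       : ∀ {i j k p r} → D i j p → D j k r → D i k (p * r)

    t         : Carrier
    D-t       : ∀ {i} → D i (suc i) t
    -- Constant term and quotient by `t`. They are functions compatible with equality and addition,
    -- rather than a mere existence statement, because the corner elements are defined through them.
    hd tl     : Carrier → Carrier
    hd-tl     : ∀ p → p ≈ hd p + t * tl p
    D-hd      : ∀ {i p} → D i i (hd p)
    D-tl      : ∀ {i j p} → D i (suc j) p → D i j (tl p)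
    hd-cong   : ∀ {p r} → p ≈ r → hd p ≈ hd r
    tl-cong   : ∀ {p r} → p ≈ r → tl p ≈ tl r
    hd-+      : ∀ p r → hd (p + r) ≈ hd p + hd r
    tl-+      : ∀ p r → tl (p + r) ≈ tl p + tl r
    hd-t*     : ∀ p → hd (t * p) ≈ 0#
    tl-t*     : ∀ p → tl (t * p) ≈ p

-- e_{i,j} lies in K_a, which is block diagonal with blocks 0, …, a and a + 1, …, n.
record Position (n a i j : ℕ) : Set where
  constructor position
  field
    a<n   : a < n
    i<j   : i < j
    j≤n   : j ≤ n
    avoid : a < i ⊎ j ≤ a

-- The shared index `j` puts both factors into the same block, because the two blocks of `K_a` are
-- disjoint.
combine : ∀ {n a i j k} → Position n a i j → Position n a j k → Position n a i k
combine (position a<n i<j j≤n (inj₁ a<i)) (position _ j<k k≤n _) =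
  position a<n (<-trans i<j j<k) k≤n (inj₁ a<i)
combine (position a<n i<j j≤n (inj₂ j≤a)) (position _ j<k k≤n (inj₁ a<j)) =
  contradiction (<-≤-trans a<j j≤a) (<-irrefl ≡.refl)
combine (position a<n i<j j≤n (inj₂ j≤a)) (position _ j<k k≤n (inj₂ k≤a)) =
  position a<n (<-trans i<j j<k) k≤n (inj₂ k≤a)

-- Both factors of each relation carry the same `a`: this is what the relators provide. `E` is
-- total, but nothing is assumed about it away from positions and degree bounds, in particular
-- nothing at the corner `(0 , n)`, which lies in no `K_a`.
record ElementaryRelations {c ℓ c′ ℓ′ d} (𝔾 : Group c ℓ) (P : FilteredRing c′ ℓ′ d) (n : ℕ)
       : Set (c ⊔ ℓ ⊔ c′ ⊔ ℓ′ ⊔ d) where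
  private
    module G = Group 𝔾
    module P = FilteredRing P
  open G using (_∙_)
  open P using (D)
  open Commuting 𝔾
  field
    E      : ℕ → ℕ → P.Carrier → G.Carrier
    E-cong : ∀ {a i j p r} → Position n a i j → D i j p → p P.≈ r → E i j p G.≈ E i j r
    E-add  : ∀ {a i j p r} → Position n a i j → D i j p → D i j r →
             E i j p ∙ E i j r G.≈ E i j (p P.+ r)
    E-comm : ∀ {a i j k l p r} → Position n a i j → Position n a k l → j ≢ k → i ≢ l →
             D i j p → D k l r → E i j p ⇄ E k l r
    E-mul  : ∀ {a i j k p r} → Position n a i j → Position n a j k → D i j p → D j k r →
             E i j p ∙ E j k r G.≈ E i k (p P.* r) ∙ (E j k r ∙ E i j p)

module ElementaryProperties {c ℓ c′ ℓ′ d} {𝔾 : Group c ℓ} {P : FilteredRing c′ ℓ′ d} {n : ℕ}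
                            (rels : ElementaryRelations 𝔾 P n) where
  open Group 𝔾
  open import Algebra.Properties.Group 𝔾 using (identityʳ-unique; inverseˡ-unique)
  open GroupSolver 𝔾
  open Commuting 𝔾
  open ElementaryRelations rels
  open SetoidReasoning setoid
  private module P = FilteredRing P
  open P using (D; hd; tl; t; 0#; 1#; D-0#; D-1#; D-t; D-hd; D-tl; D-shift; D-weaken; D-neg; D-*)

  D-hd′ : ∀ {i j p} → i ≤ j → D i j (hd p)
  D-hd′ i≤j = D-weaken ≤-refl i≤j D-hd

  E-0# : ∀ {a i j} → Position n a i j → E i j 0# ≈ ε
  E-0# pos = identityʳ-unique _ _
    (trans (E-add pos D-0# D-0#) (E-cong pos (P.D-+ D-0# D-0#) (P.+-identityˡ _)))

  E-neg : ∀ {a i j p} → Position n a i j → D i j p → E i j (P.- p) ≈ E i j p ⁻¹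
  E-neg pos dp = inverseˡ-unique _ _
    (trans (E-add pos (D-neg dp) dp)
      (trans (E-cong pos (P.D-+ (D-neg dp) dp) (P.-‿inverseˡ _)) (E-0# pos)))

  E-⁅⁆ : ∀ {a i j k p r} → Position n a i j → Position n a j k → D i j p → D j k r →
         ⁅ E i j p , E j k r ⁆ ≈ E i k (p P.* r)
  E-⁅⁆ {i = i} {j} {k} {p} {r} P Q dp dr = begin
    E i j p ∙ E j k r ∙ E i j p ⁻¹ ∙ E j k r ⁻¹
      ≈⟨ ∙-congʳ (∙-congʳ (E-mul P Q dp dr)) ⟩
    E i k (p P.* r) ∙ (E j k r ∙ E i j p) ∙ E i j p ⁻¹ ∙ E j k r ⁻¹
      ≈⟨ solve 3 (λ x y z → x ⊙ (y ⊙ z) ⊙ z ⁻ ⊙ y ⁻ ⊜ x) refl _ _ _ ⟩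
    E i k (p P.* r) ∎

  E-hd-tl : ∀ {a i j p} → Position n a i (suc j) → i ≤ j → D i (suc j) p →
            E i (suc j) p ≈ E i (suc j) (hd p) ∙ E i (suc j) (t P.* tl p)
  E-hd-tl {i = i} {j} {p} pos i≤j dp = begin
    E i (suc j) p
      ≈⟨ E-cong pos dp (P.hd-tl p) ⟩
    E i (suc j) (hd p P.+ t P.* tl p)
      ≈⟨ E-add pos (D-hd′ (m≤n⇒m≤1+n i≤j)) (D-* D-t (D-shift (D-tl dp))) ⟨
    E i (suc j) (hd p) ∙ E i (suc j) (t P.* tl p) ∎

  -- In `p = hd p + t * tl p` the cofactors of `1` and `t` have degree at most `j - i`, so
  -- commutators with the two fixed entries `1` and `t` at `(j , j + 1)` already produce every `p`.
  E-splitʳ : ∀ {a i j p} → Position n a i j → Position n a j (suc j) → D i (suc j) p →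
             E i (suc j) p ≈
               ⁅ E i j (hd p) , E j (suc j) 1# ⁆ ∙ ⁅ E i j (tl p) , E j (suc j) t ⁆
  E-splitʳ {i = i} {j} {p} P Q dp = begin
    E i (suc j) p
      ≈⟨ E-hd-tl PQ i≤j dp ⟩
    E i (suc j) (hd p) ∙ E i (suc j) (t P.* tl p)
      ≈⟨ ∙-cong (E-cong PQ (D-hd′ (m≤n⇒m≤1+n i≤j)) (P.sym (P.*-identityʳ _)))
                (E-cong PQ (D-* D-t (D-shift (D-tl dp))) (P.*-comm _ _)) ⟩
    E i (suc j) (hd p P.* 1#) ∙ E i (suc j) (tl p P.* t)
      ≈⟨ ∙-cong (E-⁅⁆ P Q (D-hd′ i≤j) (D-weaken ≤-refl (n≤1+n _) D-1#))
                (E-⁅⁆ P Q (D-tl dp) D-t) ⟨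
    ⁅ E i j (hd p) , E j (suc j) 1# ⁆ ∙ ⁅ E i j (tl p) , E j (suc j) t ⁆ ∎
    where
    PQ = combine P Q
    i≤j = <⇒≤ (Position.i<j P)

  E-splitˡ : ∀ {a i j p} → Position n a i (suc i) → Position n a (suc i) (suc j) → D i (suc j) p →
             E i (suc j) p ≈
               ⁅ E i (suc i) 1# , E (suc i) (suc j) (hd p) ⁆ ∙
               ⁅ E i (suc i) t , E (suc i) (suc j) (tl p) ⁆
  E-splitˡ {i = i} {j} {p} P Q dp = begin
    E i (suc j) p
      ≈⟨ E-hd-tl PQ i≤j dp ⟩
    E i (suc j) (hd p) ∙ E i (suc j) (t P.* tl p)
      ≈⟨ ∙-congʳ (E-cong PQ (D-hd′ (m≤n⇒m≤1+n i≤j)) (P.sym (P.*-identityˡ _))) ⟩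
    E i (suc j) (1# P.* hd p) ∙ E i (suc j) (t P.* tl p)
      ≈⟨ ∙-cong (E-⁅⁆ P Q (D-weaken ≤-refl (n≤1+n _) D-1#) (D-hd′ (<⇒≤ (Position.i<j Q))))
                (E-⁅⁆ P Q D-t (D-shift (D-tl dp))) ⟨
    ⁅ E i (suc i) 1# , E (suc i) (suc j) (hd p) ⁆ ∙
    ⁅ E i (suc i) t , E (suc i) (suc j) (tl p) ⁆ ∎
    where
    PQ = combine P Q
    i≤j = ≤-trans (n≤1+n _) (≤-pred (Position.i<j Q))

  ⇄-splitʳ : ∀ {a i j h} → Position n a i j → Position n a j (suc j) →
             (∀ {p} → D i j p → h ⇄ E i j p) → (∀ {p} → D j (suc j) p → h ⇄ E j (suc j) p) →
             ∀ {p} → D i (suc j) p → h ⇄ E i (suc j) p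
  ⇄-splitʳ P Q cP cQ dp = ⇄-cong refl (sym (E-splitʳ P Q dp))
    (⇄-∙ (⇄-⁅⁆ (cP (D-hd′ (<⇒≤ (Position.i<j P)))) (cQ (D-weaken ≤-refl (n≤1+n _) D-1#)))
         (⇄-⁅⁆ (cP (D-tl dp)) (cQ D-t)))

  ⇄-splitˡ : ∀ {a i j h} → Position n a i (suc i) → Position n a (suc i) (suc j) →
             (∀ {p} → D i (suc i) p → h ⇄ E i (suc i) p) →
             (∀ {p} → D (suc i) (suc j) p → h ⇄ E (suc i) (suc j) p) →
             ∀ {p} → D i (suc j) p → h ⇄ E i (suc j) p
  ⇄-splitˡ P Q cP cQ dp = ⇄-cong refl (sym (E-splitˡ P Q dp))
    (⇄-∙ (⇄-⁅⁆ (cP (D-weaken ≤-refl (n≤1+n _) D-1#)) (cQ (D-hd′ (<⇒≤ (Position.i<j Q)))))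
         (⇄-⁅⁆ (cP D-t) (cQ (D-shift (D-tl dp)))))

-- The Hall-Witt relation and the elements of the corner.

module HallWitt {c ℓ c′ ℓ′ d} {𝔾 : Group c ℓ} {P : FilteredRing c′ ℓ′ d} (L : ℕ)
  (rels : ElementaryRelations 𝔾 P (suc (suc (suc L)))) where

  open Group 𝔾
  open import Algebra.Properties.Group 𝔾 using (∙-cancelʳ)
  open GroupSolver 𝔾
  open ElementaryProperties rels
  open Commuting 𝔾
  open ElementaryRelations rels
  open SetoidReasoning setoid
  private module P = FilteredRing P
  open P using (D; hd; tl; t; 0#; 1#; D-0#; D-1#; D-t; D-hd; D-tl; D-shift; D-unshift; D-weaken; D-*; D-+;
                D-resp)

  private
    N n : ℕ
    N = suc (suc L)
    n = suc N

  -- The block `0, …, N` of `K_N` and the block `1, …, n` of `K_0` together contain every position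
  -- except the corner.
  upper : ∀ {i j} → i < j → j ≤ N → Position n N i j
  upper i<j j≤N = position ≤-refl i<j (m≤n⇒m≤1+n j≤N) (inj₂ j≤N)

  lower : ∀ {i j} → 0 < i → i < j → j ≤ n → Position n 0 i j
  lower 0<i i<j j≤n = position (s≤s z≤n) i<j j≤n (inj₁ 0<i)

  0N : Position n N 0 N
  0N = upper (s≤s z≤n) ≤-refl

  Nn : Position n 0 N n
  Nn = lower (s≤s z≤n) ≤-refl ≤-refl

  1n : Position n 0 1 n
  1n = lower (s≤s z≤n) (s≤s (s≤s z≤n)) ≤-refl

  D-1 : ∀ {i} → D i (suc i) 1#
  D-1 = D-weaken ≤-refl (n≤1+n _) D-1#

  -- Conjugation of xw = wx by y, where x = e₀₁(p), y = e_{1,N}(s), w = e_{N,n}(u).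
  hallWitt : ∀ {p s u} → D 0 1 p → D 1 N s → D N n u →
    E 0 N (p P.* s) ⁻¹ ∙ E 0 1 p ∙ (E 1 n (s P.* u) ∙ E N n u) ≈
    E 1 n (s P.* u) ∙ E N n u ∙ (E 0 N (p P.* s) ⁻¹ ∙ E 0 1 p)
  hallWitt {p} {s} {u} dp ds du = ∙-cancelʳ y _ _ (begin
    X ⁻¹ ∙ x ∙ (Y ∙ w) ∙ y
      ≈⟨ solve 5 (λ X x Y w y → X ⁻ ⊙ x ⊙ (Y ⊙ w) ⊙ y ⊜ X ⁻ ⊙ x ⊙ (Y ⊙ (w ⊙ y))) refl X x Y w y ⟩
    X ⁻¹ ∙ x ∙ (Y ∙ (w ∙ y))   ≈⟨ ∙-congˡ yw ⟨
    X ⁻¹ ∙ x ∙ (y ∙ w)         ≈⟨ assoc _ _ _ ⟨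
    X ⁻¹ ∙ x ∙ y ∙ w           ≈⟨ ∙-congʳ yx ⟨
    y ∙ x ∙ w                  ≈⟨ trans (assoc _ _ _) (∙-congˡ xw) ⟩
    y ∙ (w ∙ x)                ≈⟨ trans (sym (assoc _ _ _)) (∙-congʳ yw) ⟩
    Y ∙ (w ∙ y) ∙ x
      ≈⟨ solve 4 (λ x Y w y → Y ⊙ (w ⊙ y) ⊙ x ⊜ Y ⊙ w ⊙ (y ⊙ x)) refl x Y w y ⟩
    Y ∙ w ∙ (y ∙ x)            ≈⟨ ∙-congˡ yx ⟩
    Y ∙ w ∙ (X ⁻¹ ∙ x ∙ y)     ≈⟨ assoc _ _ _ ⟨
    Y ∙ w ∙ (X ⁻¹ ∙ x) ∙ y     ∎)
    where
    x = E 0 1 p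
    y = E 1 N s
    w = E N n u
    X = E 0 N (p P.* s)
    Y = E 1 n (s P.* u)
    xy : x ∙ y ≈ X ∙ (y ∙ x)
    xy = E-mul (upper (s≤s z≤n) (s≤s z≤n)) (upper (s≤s (s≤s z≤n)) ≤-refl) dp ds
    yx : y ∙ x ≈ X ⁻¹ ∙ x ∙ y
    yx = trans (solve 3 (λ X x y → y ⊙ x ⊜ X ⁻ ⊙ (X ⊙ (y ⊙ x))) refl X x y)
           (trans (∙-congˡ (sym xy)) (sym (assoc _ _ _)))
    yw : y ∙ w ≈ Y ∙ (w ∙ y)
    yw = E-mul (lower (s≤s z≤n) (s≤s (s≤s z≤n)) (n≤1+n _)) Nn ds du
    xw : x ∙ w ≈ w ∙ x
    xw = E-comm {a = 1} (position (s≤s (s≤s z≤n)) (s≤s z≤n) (s≤s z≤n) (inj₂ ≤-refl))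
                (position (s≤s (s≤s z≤n)) ≤-refl ≤-refl (inj₁ (s≤s (s≤s z≤n)))) (λ ()) (λ ()) dp du

  -- `e_{0,N}` lies only in `K_N` and `e_{1,n}` only in `K_0`, so no relator covers this
  -- commutation. It is a hypothesis of the next module because the case `n = 3` needs a different
  -- proof.
  Key : Set (c′ ⊔ d ⊔ ℓ)
  Key = ∀ {g r} → D 0 N g → D 1 n r → E 0 N g ⇄ E 1 n r

-- With N = n − 1, the corner e_{0,n}(f) is rebuilt from the commutators
-- c g u = [e_{0,N}(g) , e_{N,n}(u)]; everything rests on the commutation of
-- e_{0,N} with e_{1,n}, which are not contained in a common K_a.
module Corner {c ℓ c′ ℓ′ d} {𝔾 : Group c ℓ} {P : FilteredRing c′ ℓ′ d} (L : ℕ)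
  (rels : ElementaryRelations 𝔾 P (suc (suc (suc L))))
  (key : HallWitt.Key L rels) where

  open Group 𝔾
  open GroupSolver 𝔾
  open Commuting 𝔾
  open ElementaryRelations rels
  open ElementaryProperties rels
  open HallWitt L rels public
  open SetoidReasoning setoid
  private module P = FilteredRing P
  open P using (D; hd; tl; t; 0#; 1#; D-0#; D-1#; D-t; D-hd; D-tl; D-shift; D-unshift; D-weaken; D-*; D-+;
                D-resp)

  private
    N n : ℕ
    N = suc (suc L)
    n = suc N

  com : P.Carrier → P.Carrier → Carrier
  com g u = ⁅ E 0 N g , E N n u ⁆

  com-cong : ∀ {g g′ u u′} → D 0 N g → D N n u → g P.≈ g′ → u P.≈ u′ → com g u ≈ com g′ u′
  com-cong dg du p q = ⁅⁆-cong (E-cong 0N dg p) (E-cong Nn du q)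

  com-hallWitt : ∀ {p s u} → D 0 1 p → D 1 N s → D N n u →
                 com (p P.* s) u ≈ ⁅ E 1 n (s P.* u) ⁻¹ , E 0 1 p ⁆
  com-hallWitt {p} {s} {u} dp ds du = begin
    X ∙ w ∙ X ⁻¹ ∙ w ⁻¹
      ≈⟨ solve 4 (λ X x Y w → X ⊙ w ⊙ X ⁻ ⊙ w ⁻ ⊜
           Y ⁻ ⊙ (Y ⊙ X) ⊙ w ⊙ X ⁻ ⊙ (w ⁻ ⊙ (x ⊙ x ⁻))) refl X x Y w ⟩
    Y ⁻¹ ∙ (Y ∙ X) ∙ w ∙ X ⁻¹ ∙ (w ⁻¹ ∙ (x ∙ x ⁻¹))
      -- Exchanging `Y` and `X` by `key` exposes `Y w X⁻¹ x`, the right side of `hallWitt`.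
      ≈⟨ ∙-congʳ (∙-congʳ (∙-congʳ (∙-congˡ (⇄-sym XY)))) ⟩
    Y ⁻¹ ∙ (X ∙ Y) ∙ w ∙ X ⁻¹ ∙ (w ⁻¹ ∙ (x ∙ x ⁻¹))
      ≈⟨ solve 4 (λ X x Y w → Y ⁻ ⊙ (X ⊙ Y) ⊙ w ⊙ X ⁻ ⊙ (w ⁻ ⊙ (x ⊙ x ⁻)) ⊜
           Y ⁻ ⊙ X ⊙ (Y ⊙ w ⊙ (X ⁻ ⊙ x)) ⊙ (x ⁻ ⊙ w ⁻ ⊙ (x ⊙ x ⁻))) refl X x Y w ⟩
    Y ⁻¹ ∙ X ∙ (Y ∙ w ∙ (X ⁻¹ ∙ x)) ∙ (x ⁻¹ ∙ w ⁻¹ ∙ (x ∙ x ⁻¹))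
      ≈⟨ ∙-congʳ (∙-congˡ (hallWitt dp ds du)) ⟨
    Y ⁻¹ ∙ X ∙ (X ⁻¹ ∙ x ∙ (Y ∙ w)) ∙ (x ⁻¹ ∙ w ⁻¹ ∙ (x ∙ x ⁻¹))
      ≈⟨ solve 4 (λ X x Y w → Y ⁻ ⊙ X ⊙ (X ⁻ ⊙ x ⊙ (Y ⊙ w)) ⊙ (x ⁻ ⊙ w ⁻ ⊙ (x ⊙ x ⁻)) ⊜
           Y ⁻ ⊙ x ⊙ Y ⊙ w ⊙ (x ⁻ ⊙ w ⁻)) refl X x Y w ⟩
    Y ⁻¹ ∙ x ∙ Y ∙ w ∙ (x ⁻¹ ∙ w ⁻¹)
      ≈⟨ ∙-congˡ (⇄-⁻¹ (⇄-sym (⇄-⁻¹ (⇄-sym xw)))) ⟩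
    Y ⁻¹ ∙ x ∙ Y ∙ w ∙ (w ⁻¹ ∙ x ⁻¹)
      ≈⟨ solve 4 (λ X x Y w → Y ⁻ ⊙ x ⊙ Y ⊙ w ⊙ (w ⁻ ⊙ x ⁻) ⊜ Y ⁻ ⊙ x ⊙ Y ⁻ ⁻ ⊙ x ⁻) refl X x Y w ⟩
    ⁅ Y ⁻¹ , x ⁆ ∎
    where
    x = E 0 1 p
    w = E N n u
    X = E 0 N (p P.* s)
    Y = E 1 n (s P.* u)
    XY : X ⇄ Y
    XY = key (D-* dp ds) (D-* ds du)
    xw : x ∙ w ≈ w ∙ x
    -- `K_1` has the blocks `0, 1` and `2, …, n`; as `N` is at least 2, it contains both factors.
    xw = E-comm {a = 1} (position (s≤s (s≤s z≤n)) (s≤s z≤n) (s≤s z≤n) (inj₂ ≤-refl))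
                (position (s≤s (s≤s z≤n)) ≤-refl ≤-refl (inj₁ (s≤s (s≤s z≤n)))) (λ ()) (λ ()) dp du

  -- Weaker than centrality: only the factors in columns `N` and `n` are listed that a corner
  -- element has to cross, in the biadditivity of `com` and during collection.
  record Central (h : Carrier) : Set (c′ ⊔ d ⊔ ℓ) where
    field
      with-0N : ∀ {g} → D 0 N g → h ⇄ E 0 N g
      with-iN : ∀ {i p} → 0 < i → i < N → D i N p → h ⇄ E i N p
      with-in : ∀ {i p} → 0 < i → i < n → D i n p → h ⇄ E i n p

  open Central

  Central-∙ : ∀ {h k} → Central h → Central k → Central (h ∙ k)
  Central-∙ p q .with-0N d     = ⇄-sym (⇄-∙ (⇄-sym (p .with-0N d)) (⇄-sym (q .with-0N d)))
  Central-∙ p q .with-iN a b d = ⇄-sym (⇄-∙ (⇄-sym (p .with-iN a b d)) (⇄-sym (q .with-iN a b d)))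
  Central-∙ p q .with-in a b d = ⇄-sym (⇄-∙ (⇄-sym (p .with-in a b d)) (⇄-sym (q .with-in a b d)))

  Central-cong : ∀ {h k} → h ≈ k → Central h → Central k
  Central-cong e p .with-0N d     = ⇄-cong e refl (p .with-0N d)
  Central-cong e p .with-iN a b d = ⇄-cong e refl (p .with-iN a b d)
  Central-cong e p .with-in a b d = ⇄-cong e refl (p .with-in a b d)

  -- A factor that commutes with both arguments commutes with their commutator. This settles
  -- `e_{0,N}`, by `key`, and all rows from 2 on, by `K_0` and `K_1`. Row 1 does not commute with
  -- `e_{01}`; it is treated by `c1N` and, at column `n`, by splitting at `N`.
  Central-⁅⁆ : ∀ {p r} → D 0 1 p → D 1 n r → Central ⁅ E 1 n r ⁻¹ , E 0 1 p ⁆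
  Central-⁅⁆ {p} {r} dp dr = record { with-0N = c0N ; with-iN = ciN ; with-in = cin }
    where
    x = E 0 1 p
    Y = E 1 n r
    z = ⁅ Y ⁻¹ , x ⁆

    0n∋01 : Position n N 0 1
    0n∋01 = upper (s≤s z≤n) (s≤s z≤n)

    c0N : ∀ {g} → D 0 N g → z ⇄ E 0 N g
    c0N dg = ⇄-sym (⇄-⁅⁆ (⇄-⁻¹ (key dg dr)) (E-comm 0N 0n∋01 (λ ()) (λ ()) dg dp))

    c≥2 : ∀ {i j v} → 1 < i → i < j → j ≤ n → D i j v → z ⇄ E i j v
    c≥2 1<i i<j j≤n dv = ⇄-sym (⇄-⁅⁆
      (⇄-⁻¹ (E-comm (lower (<-trans (s≤s z≤n) 1<i) i<j j≤n) 1n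
                    (λ j≡1 → <-irrefl (≡.sym j≡1) (<-trans 1<i i<j))
                    (λ i≡n → <-irrefl i≡n (<-≤-trans i<j j≤n)) dv dr))
      (E-comm {a = 1} (position (s≤s (s≤s z≤n)) i<j j≤n (inj₁ 1<i))
              (position (s≤s (s≤s z≤n)) (s≤s z≤n) (s≤s z≤n) (inj₂ ≤-refl))
              (λ { ≡.refl → n≮0 i<j }) (λ i≡1 → <-irrefl (≡.sym i≡1) 1<i) dv dp))

    -- Here `z = Y⁻¹ (x Y x⁻¹)` and `x y x⁻¹ = X y`. Both factors of `z` commute with `X y`: the
    -- first because `Y` commutes with `X` and `y`, the second as a conjugate of `Y y = y Y`. Since
    -- `z` also commutes with `X`, it commutes with `y`.
    c1N : ∀ {v} → D 1 N v → z ⇄ E 1 N v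
    c1N {v} dv = ⇄-cancelˡ Xz (⇄-sym (begin
      X ∙ y ∙ z
        ≈⟨ solve 4 (λ X x Y y → X ⊙ y ⊙ (Y ⁻ ⊙ x ⊙ Y ⁻ ⁻ ⊙ x ⁻) ⊜ X ⊙ y ⊙ Y ⁻ ⊙ (x ⊙ Y ⊙ x ⁻)) refl X x Y y ⟩
      X ∙ y ∙ Y ⁻¹ ∙ (x ∙ Y ∙ x ⁻¹)
        ≈⟨ ∙-congʳ (⇄-⁻¹ (⇄-sym (⇄-∙ (⇄-sym XY) Yy))) ⟩
      Y ⁻¹ ∙ (X ∙ y) ∙ (x ∙ Y ∙ x ⁻¹)
        ≈⟨ solve 4 (λ X x Y y → Y ⁻ ⊙ (X ⊙ y) ⊙ (x ⊙ Y ⊙ x ⁻) ⊜ Y ⁻ ⊙ (X ⊙ (y ⊙ x)) ⊙ (Y ⊙ x ⁻)) refl X x Y y ⟩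
      Y ⁻¹ ∙ (X ∙ (y ∙ x)) ∙ (Y ∙ x ⁻¹)
        ≈⟨ ∙-congʳ (∙-congˡ xy) ⟨
      Y ⁻¹ ∙ (x ∙ y) ∙ (Y ∙ x ⁻¹)
        ≈⟨ solve 3 (λ x Y y → Y ⁻ ⊙ (x ⊙ y) ⊙ (Y ⊙ x ⁻) ⊜ Y ⁻ ⊙ x ⊙ (y ⊙ Y) ⊙ x ⁻) refl x Y y ⟩
      Y ⁻¹ ∙ x ∙ (y ∙ Y) ∙ x ⁻¹
        ≈⟨ ∙-congʳ (∙-congˡ Yy) ⟨
      Y ⁻¹ ∙ x ∙ (Y ∙ y) ∙ x ⁻¹
        ≈⟨ solve 3 (λ x Y y → Y ⁻ ⊙ x ⊙ (Y ⊙ y) ⊙ x ⁻ ⊜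
             Y ⁻ ⊙ x ⊙ Y ⁻ ⁻ ⊙ x ⁻ ⊙ (x ⊙ y ⊙ x ⁻)) refl x Y y ⟩
      z ∙ (x ∙ y ∙ x ⁻¹)
        ≈⟨ ∙-congˡ (trans (∙-congʳ xy)
             (solve 3 (λ X x y → X ⊙ (y ⊙ x) ⊙ x ⁻ ⊜ X ⊙ y) refl X x y)) ⟩
      z ∙ (X ∙ y) ∎))
      where
      y = E 1 N v
      X = E 0 N (p P.* v)
      XY : X ⇄ Y
      XY = key (D-* dp dv) dr
      Xz : z ⇄ X
      Xz = c0N (D-* dp dv)
      Yy : Y ⇄ y
      Yy = E-comm 1n (lower (s≤s z≤n) (s≤s (s≤s z≤n)) (n≤1+n _)) (λ ()) (λ ()) dr dv
      xy : x ∙ y ≈ X ∙ (y ∙ x)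
      xy = E-mul 0n∋01 (upper (s≤s (s≤s z≤n)) ≤-refl) dp dv

    ciN : ∀ {i p} → 0 < i → i < N → D i N p → z ⇄ E i N p
    ciN {suc zero}    _ i<N dv = c1N dv
    ciN {suc (suc i)} _ i<N dv = c≥2 (s≤s (s≤s z≤n)) i<N (n≤1+n _) dv

    cin : ∀ {i p} → 0 < i → i < n → D i n p → z ⇄ E i n p
    cin {suc zero} _ i<n =
      ⇄-splitʳ (lower (s≤s z≤n) (s≤s (s≤s z≤n)) (n≤1+n _)) Nn c1N (c≥2 (s≤s (s≤s z≤n)) ≤-refl ≤-refl)
    cin {suc (suc i)} _ i<n = c≥2 (s≤s (s≤s z≤n)) i<n ≤-refl

  ⁅⁆-∙ˡ : ∀ {x y w} → x ⇄ ⁅ y , w ⁆ → ⁅ x ∙ y , w ⁆ ≈ ⁅ y , w ⁆ ∙ ⁅ x , w ⁆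
  ⁅⁆-∙ˡ {x} {y} {w} q = begin
    ⁅ x ∙ y , w ⁆
      ≈⟨ solve 3 (λ x y w → (x ⊙ y) ⊙ w ⊙ (x ⊙ y) ⁻ ⊙ w ⁻ ⊜
           x ⊙ (y ⊙ w ⊙ y ⁻ ⊙ w ⁻) ⊙ (w ⊙ x ⁻ ⊙ w ⁻)) refl x y w ⟩
    x ∙ ⁅ y , w ⁆ ∙ (w ∙ x ⁻¹ ∙ w ⁻¹)
      ≈⟨ ∙-congʳ q ⟩
    ⁅ y , w ⁆ ∙ x ∙ (w ∙ x ⁻¹ ∙ w ⁻¹)
      ≈⟨ solve 3 (λ z x w → z ⊙ x ⊙ (w ⊙ x ⁻ ⊙ w ⁻) ⊜ z ⊙ (x ⊙ w ⊙ x ⁻ ⊙ w ⁻)) refl _ x w ⟩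
    ⁅ y , w ⁆ ∙ ⁅ x , w ⁆ ∎

  ⁅⁆-∙ʳ : ∀ {x w w′} → w ⇄ ⁅ x , w′ ⁆ → ⁅ x , w ∙ w′ ⁆ ≈ ⁅ x , w ⁆ ∙ ⁅ x , w′ ⁆
  ⁅⁆-∙ʳ {x} {w} {w′} q = begin
    ⁅ x , w ∙ w′ ⁆
      ≈⟨ solve 3 (λ x w v → x ⊙ (w ⊙ v) ⊙ x ⁻ ⊙ (w ⊙ v) ⁻ ⊜
           x ⊙ w ⊙ x ⁻ ⊙ (x ⊙ v ⊙ x ⁻ ⊙ v ⁻) ⊙ w ⁻) refl x w w′ ⟩
    x ∙ w ∙ x ⁻¹ ∙ ⁅ x , w′ ⁆ ∙ w ⁻¹
      ≈⟨ trans (assoc _ _ _) (∙-congˡ (⇄-sym (⇄-sym (⇄-⁻¹ (⇄-sym q))))) ⟩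
    x ∙ w ∙ x ⁻¹ ∙ (w ⁻¹ ∙ ⁅ x , w′ ⁆)
      ≈⟨ assoc _ _ _ ⟨
    ⁅ x , w ⁆ ∙ ⁅ x , w′ ⁆ ∎

  D-hd-0N : ∀ {g} → D 0 N (hd g)
  D-hd-0N = D-hd′ z≤n

  D-t*tl : ∀ {i j g} → D i (suc j) g → D i (suc j) (t P.* tl g)
  D-t*tl dg = D-* D-t (D-shift (D-tl dg))

  private
    -- `com-hallWitt` needs `g = p * s` with `p` of degree at most 1 and `s` of degree at most
    -- `N - 1`. A general `g` need not factor like this, but both summands of `hd g + t * tl g` do,
    -- with `p = 1` and `p = t`.
    Central-hd : ∀ {g u} → D N n u → Central (com (hd g) u)
    Central-hd du =
      Central-cong (trans (sym (com-hallWitt D-1 (D-hd′ (s≤s z≤n)) du))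
                     (com-cong (D-* D-1# D-hd-0N) du (P.*-identityˡ _) P.refl))
        (Central-⁅⁆ D-1 (D-* (D-hd′ (s≤s z≤n)) du))

    Central-tl : ∀ {g u} → D 0 N g → D N n u → Central (com (t P.* tl g) u)
    Central-tl dg du =
      Central-cong (sym (com-hallWitt D-t (D-shift (D-tl dg)) du))
        (Central-⁅⁆ D-t (D-* (D-shift (D-tl dg)) du))

    com-hd-tl′ : ∀ {g u} → D 0 N g → D N n u →
                 com g u ≈ com (t P.* tl g) u ∙ com (hd g) u
    com-hd-tl′ dg du =
      trans (⁅⁆-cong (E-hd-tl 0N z≤n dg) refl)
        (⁅⁆-∙ˡ (⇄-sym (Central-tl dg du .with-0N D-hd-0N)))

  Central-com : ∀ {g u} → D 0 N g → D N n u → Central (com g u)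
  Central-com dg du = Central-cong (sym (com-hd-tl′ dg du)) (Central-∙ (Central-tl dg du) (Central-hd du))

  com-⇄ : ∀ {h g u} → Central h → D 0 N g → D N n u → h ⇄ com g u
  com-⇄ ch dg du = ⇄-⁅⁆ (ch .with-0N dg) (ch .with-in (s≤s z≤n) ≤-refl du)

  com-+ˡ : ∀ {g g′ u} → D 0 N g → D 0 N g′ → D N n u → com (g P.+ g′) u ≈ com g u ∙ com g′ u
  com-+ˡ dg dg′ du =
    trans (⁅⁆-cong (sym (E-add 0N dg dg′)) refl)
      (trans (⁅⁆-∙ˡ (⇄-sym (Central-com dg′ du .with-0N dg)))
        (com-⇄ (Central-com dg′ du) dg du))

  com-+ʳ : ∀ {g u u′} → D 0 N g → D N n u → D N n u′ → com g (u P.+ u′) ≈ com g u ∙ com g u′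
  com-+ʳ dg du du′ =
    trans (⁅⁆-cong refl (sym (E-add Nn du du′)))
      (⁅⁆-∙ʳ (⇄-sym (Central-com dg du′ .with-in (s≤s z≤n) ≤-refl du)))

  com-hd-tl : ∀ {g u} → D 0 N g → D N n u → com g u ≈ com (hd g) u ∙ com (t P.* tl g) u
  com-hd-tl dg du =
    trans (com-cong dg du (P.hd-tl _) P.refl) (com-+ˡ D-hd-0N (D-t*tl dg) du)

  com-assoc : ∀ {p s u s′ u′} → D 0 1 p → D 1 N s → D N n u → D 1 N s′ → D N n u′ →
              s P.* u P.≈ s′ P.* u′ → com (p P.* s) u ≈ com (p P.* s′) u′
  com-assoc dp ds du ds′ du′ e = begin
    com _ _                        ≈⟨ com-hallWitt dp ds du ⟩
    ⁅ E 1 n _ ⁻¹ , E 0 1 _ ⁆       ≈⟨ ⁅⁆-cong (⁻¹-cong (E-cong 1n (D-* ds du) e)) refl ⟩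
    ⁅ E 1 n _ ⁻¹ , E 0 1 _ ⁆       ≈⟨ com-hallWitt dp ds′ du′ ⟨
    com _ _                        ∎

  com-assoc₁ : ∀ {s u s′ u′} → D 1 N s → D N n u → D 1 N s′ → D N n u′ →
               s P.* u P.≈ s′ P.* u′ → com s u ≈ com s′ u′
  com-assoc₁ ds du ds′ du′ e =
    trans (com-cong (D-weaken z≤n ≤-refl ds) du (P.sym (P.*-identityˡ _)) P.refl)
      (trans (com-assoc D-1 ds du ds′ du′ e)
        (com-cong (D-* D-1# (D-weaken z≤n ≤-refl ds′)) du′ (P.*-identityˡ _) P.refl))

  D-scalar : ∀ {a} i j → D i i a → D j j a
  D-scalar zero    zero    da = da
  D-scalar zero    (suc j) da = D-shift (D-scalar zero j da)
  D-scalar (suc i) j       da = D-scalar i j (D-unshift da)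

  com-scalar : ∀ {g a u} → D 0 N g → D N N a → D N n u → com g (a P.* u) ≈ com (g P.* a) u
  com-scalar {g} {a} {u} dg da du = begin
    com g (a P.* u)
      ≈⟨ com-hd-tl dg (D-* da du) ⟩
    com (hd g) (a P.* u) ∙ com (t P.* tl g) (a P.* u)
      ≈⟨ ∙-cong (com-assoc₁ dhd (D-* da du) (D-* dhd da) du (P.sym (P.*-assoc _ _ _)))
                (com-assoc D-t dtl (D-* da du) (D-* dtl da) du (P.sym (P.*-assoc _ _ _))) ⟩
    com (hd g P.* a) u ∙ com (t P.* (tl g P.* a)) u
      ≈⟨ com-+ˡ (D-* D-hd-0N da) (D-* D-t (D-* dtl da)) du ⟨
    com (hd g P.* a P.+ t P.* (tl g P.* a)) u
      ≈⟨ com-cong (D-+ (D-* D-hd-0N da) (D-* D-t (D-* dtl da))) du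
           (P.trans (P.+-congˡ (P.sym (P.*-assoc _ _ _)))
             (P.trans (P.sym (P.distribʳ _ _ _)) (P.*-congʳ (P.sym (P.hd-tl g))))) P.refl ⟩
    com (g P.* a) u ∎
    where
    dhd : D 1 N (hd g)
    dhd = D-hd′ (s≤s z≤n)
    dtl : D 1 N (tl g)
    dtl = D-shift (D-tl dg)

  -- After `g` is split, `com-assoc` applies with `p = 1` to `t * hd g` and with `p = t` to
  -- `t * (t * tl g)`; in both cases one factor `t` passes from `s` to `u`.
  com-t : ∀ {g} → D 0 (suc L) g → com (t P.* g) 1# ≈ com g t
  com-t {g} dg = begin
    com (t P.* g) 1#
      ≈⟨ com-cong (D-* D-t (D-shift dg)) D-1 (P.trans (P.*-congˡ (P.hd-tl g)) (P.distribˡ _ _ _)) P.refl ⟩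
    com (t P.* hd g P.+ t P.* (t P.* tl g)) 1#
      ≈⟨ com-+ˡ (D-* D-t (D-hd′ (s≤s z≤n))) (D-* D-t (D-shift (D-t*tl dg))) D-1 ⟩
    com (t P.* hd g) 1# ∙ com (t P.* (t P.* tl g)) 1#
      ≈⟨ ∙-cong
           (com-assoc₁ (D-* D-t (D-hd′ (s≤s (s≤s z≤n)))) D-1 (D-hd′ (s≤s z≤n)) D-t
              (P.trans (P.*-identityʳ _) (P.*-comm _ _)))
           (com-assoc D-t (D-shift (D-t*tl dg)) D-1 (D-shift (D-weaken ≤-refl (n≤1+n _) (D-tl dg))) D-t
              (P.trans (P.*-identityʳ _) (P.*-comm _ _))) ⟩
    com (hd g) t ∙ com (t P.* tl g) t
      ≈⟨ com-hd-tl (D-weaken ≤-refl (n≤1+n _) dg) D-t ⟨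
    com g t ∎

  -- Plays the role of `e_{0,n}(f)`. A polynomial of degree `n` need not be a product `g * u`, but
  -- `f = hd f * 1 + tl f * t` is a sum of two, and this choice makes `corner` additive because `hd`
  -- and `tl` are.
  corner : P.Carrier → Carrier
  corner f = com (hd f) 1# ∙ com (tl f) t

  corner-cong : ∀ {f f′} → D 0 n f → f P.≈ f′ → corner f ≈ corner f′
  corner-cong df e = ∙-cong (com-cong D-hd-0N D-1 (P.hd-cong e) P.refl)
                            (com-cong (D-tl df) D-t (P.tl-cong e) P.refl)

  Central-corner : ∀ {f} → D 0 n f → Central (corner f)
  Central-corner df = Central-∙ (Central-com D-hd-0N D-1) (Central-com (D-tl df) D-t)

  corner-+ : ∀ {f f′} → D 0 n f → D 0 n f′ → corner f ∙ corner f′ ≈ corner (f P.+ f′)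
  corner-+ {f} {f′} df df′ = begin
    com (hd f) 1# ∙ com (tl f) t ∙ (com (hd f′) 1# ∙ com (tl f′) t)
      ≈⟨ solve 4 (λ a b c d → a ⊙ b ⊙ (c ⊙ d) ⊜ a ⊙ (b ⊙ c) ⊙ d) refl _ _ _ _ ⟩
    com (hd f) 1# ∙ (com (tl f) t ∙ com (hd f′) 1#) ∙ com (tl f′) t
      ≈⟨ ∙-congʳ (∙-congˡ (com-⇄ (Central-com (D-tl df) D-t) D-hd-0N D-1)) ⟩
    com (hd f) 1# ∙ (com (hd f′) 1# ∙ com (tl f) t) ∙ com (tl f′) t
      ≈⟨ solve 4 (λ a b c d → a ⊙ (b ⊙ c) ⊙ d ⊜ a ⊙ b ⊙ (c ⊙ d)) refl _ _ _ _ ⟩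
    com (hd f) 1# ∙ com (hd f′) 1# ∙ (com (tl f) t ∙ com (tl f′) t)
      ≈⟨ ∙-cong (com-+ˡ D-hd-0N D-hd-0N D-1) (com-+ˡ (D-tl df) (D-tl df′) D-t) ⟨
    com (hd f P.+ hd f′) 1# ∙ com (tl f P.+ tl f′) t
      ≈⟨ ∙-cong (com-cong D-hd-0N D-1 (P.hd-+ f f′) P.refl)
                (com-cong (D-tl (D-+ df df′)) D-t (P.tl-+ f f′) P.refl) ⟨
    corner (f P.+ f′) ∎

  com-1 : ∀ {h} → D 0 N h → com h 1# ≈ corner h
  com-1 {h} dh = begin
    com h 1#                              ≈⟨ com-hd-tl dh D-1 ⟩
    com (hd h) 1# ∙ com (t P.* tl h) 1#   ≈⟨ ∙-congˡ (com-t (D-tl dh)) ⟩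
    corner h                              ∎

  com-0# : ∀ {u} → com 0# u ≈ ε
  com-0# = trans (⁅⁆-cong (E-0# 0N) refl)
    (solve 1 (λ w → one ⊙ w ⊙ one ⁻ ⊙ w ⁻ ⊜ one) refl _)

  com-t′ : ∀ {h} → D 0 N h → com h t ≈ corner (t P.* h)
  com-t′ {h} dh = begin
    com h t
      ≈⟨ identityˡ _ ⟨
    ε ∙ com h t
      ≈⟨ ∙-cong (trans (com-cong D-hd-0N D-1 (P.hd-t* h) P.refl) com-0#)
                (com-cong (D-resp (P.sym (P.tl-t* h)) dh) D-t (P.tl-t* h) P.refl) ⟨
    corner (t P.* h) ∎

  -- Since `u` has degree at most 1, `hd u` and `tl u` are constants, and `com-scalar` moves them
  -- into the first argument. What remains are the second arguments `1` and `t`, the two values that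
  -- `corner` uses.
  com-corner : ∀ {g u} → D 0 N g → D N n u → com g u ≈ corner (g P.* u)
  com-corner {g} {u} dg du = begin
    com g u
      ≈⟨ com-cong dg du P.refl (P.hd-tl u) ⟩
    com g (hd u P.+ t P.* tl u)
      ≈⟨ com-+ʳ dg (D-hd′ (n≤1+n _)) (D-* D-t (D-shift (D-tl du))) ⟩
    com g (hd u) ∙ com g (t P.* tl u)
      ≈⟨ ∙-cong (com-cong dg (D-hd′ (n≤1+n _)) P.refl (P.sym (P.*-identityʳ _)))
                (com-cong dg (D-* D-t (D-shift (D-tl du))) P.refl (P.*-comm _ _)) ⟩
    com g (hd u P.* 1#) ∙ com g (tl u P.* t)
      ≈⟨ ∙-cong (com-scalar dg D-hd D-1) (com-scalar dg (D-tl du) D-t) ⟩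
    com (g P.* hd u) 1# ∙ com (g P.* tl u) t
      ≈⟨ ∙-cong (com-1 (D-* dg D-hd)) (com-t′ (D-* dg (D-tl du))) ⟩
    corner (g P.* hd u) ∙ corner (t P.* (g P.* tl u))
      ≈⟨ corner-+ (D-weaken ≤-refl (n≤1+n _) (D-* dg D-hd)) (D-* D-t (D-shift (D-* dg (D-tl du)))) ⟩
    corner (g P.* hd u P.+ t P.* (g P.* tl u))
      ≈⟨ corner-cong (D-+ (D-weaken ≤-refl (n≤1+n _) (D-* dg D-hd))
                          (D-* D-t (D-shift (D-* dg (D-tl du)))))
           (P.trans (P.+-congˡ (P.trans (P.sym (P.*-assoc _ _ _))
             (P.trans (P.*-congʳ (P.*-comm _ _)) (P.*-assoc _ _ _))))
             (P.trans (P.sym (P.distribˡ _ _ _)) (P.*-congˡ (P.sym (P.hd-tl u))))) ⟩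
    corner (g P.* u) ∎

  E-mul-corner : ∀ {g u} → D 0 N g → D N n u →
                 E 0 N g ∙ E N n u ≈ corner (g P.* u) ∙ (E N n u ∙ E 0 N g)
  E-mul-corner {g} {u} dg du = begin
    E 0 N g ∙ E N n u
      ≈⟨ solve 2 (λ x w → x ⊙ w ⊜ x ⊙ w ⊙ x ⁻ ⊙ w ⁻ ⊙ (w ⊙ x)) refl _ _ ⟩
    com g u ∙ (E N n u ∙ E 0 N g)
      ≈⟨ ∙-congʳ (com-corner dg du) ⟩
    corner (g P.* u) ∙ (E N n u ∙ E 0 N g) ∎

  corner-0# : ∀ {f} → D 0 n f → f P.≈ 0# → corner f ≈ ε
  corner-0# df f≈0 = trans (corner-cong df f≈0) (trans (sym (com-1 D-0#)) com-0#)

-- Commutation of `e_{0,N}` with `e_{1,n}`.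

module KeyLarge {c ℓ c′ ℓ′ d} {𝔾 : Group c ℓ} {P : FilteredRing c′ ℓ′ d} (L : ℕ)
  (rels : ElementaryRelations 𝔾 P (suc (suc (suc (suc L))))) where
  open Commuting 𝔾
  open ElementaryRelations rels
  open ElementaryProperties rels
  open HallWitt (suc L) rels
  open FilteredRing P using (D)

  private
    N n : ℕ
    N = suc (suc (suc L))
    n = suc N

  key : Key
  key dg = ⇄-splitˡ (lower (s≤s z≤n) ≤-refl (s≤s (s≤s z≤n))) 2n
    (E-comm 0N (upper ≤-refl (s≤s (s≤s z≤n))) (λ ()) (λ ()) dg)
    -- Now `e_{0,N}` is split at index 1 and both parts are compared with `e_{2,n}`. The part
    -- `e_{1,N}` commutes with it because `2` and `N` differ, which is where `n ≥ 4` enters.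
    λ dr → ⇄-sym (⇄-splitˡ (upper (s≤s z≤n) (s≤s z≤n)) (upper (s≤s (s≤s z≤n)) ≤-refl)
      (E-comm {a = 1} (position (s≤s (s≤s z≤n)) (s≤s (s≤s (s≤s z≤n))) ≤-refl (inj₁ ≤-refl))
                      (position (s≤s (s≤s z≤n)) ≤-refl (s≤s z≤n) (inj₂ ≤-refl)) (λ ()) (λ ()) dr)
      (E-comm 2n (lower ≤-refl (s≤s (s≤s z≤n)) (n≤1+n _)) (λ ()) (λ ()) dr)
      dg)
    where
    2n : Position n 0 2 n
    2n = lower (s≤s z≤n) (s≤s (s≤s (s≤s z≤n))) ≤-refl

module KeyHalf {c ℓ c′ ℓ′ d} {𝔾 : Group c ℓ} {P : FilteredRing c′ ℓ′ d}
  (rels : ElementaryRelations 𝔾 P 3)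
  (½ : FilteredRing.Carrier P) (D-½ : FilteredRing.D P 0 0 ½)
  (½+½≈1 : FilteredRing._≈_ P (FilteredRing._+_ P ½ ½) (FilteredRing.1# P)) where
  open FilteredRing P using (Carrier; _≈_; _+_; 1#; D)
  open Group 𝔾 hiding (Carrier; _≈_)
  private
    module P = FilteredRing P
    module G = Group 𝔾
  open P using (hd; tl; t; D-hd; D-tl; D-t; D-*; D-+; D-neg; D-shift; D-weaken; -_; _*_)
  open import Algebra.Properties.Ring P.ring using (-‿distribˡ-*; -‿distribʳ-*; -‿involutive)
  open import Algebra.Solver.Ring.NaturalCoefficients.Default P.commutativeSemiring
    using (_:+_; _:*_; _:=_; con) renaming (solve to solveᴾ)
  open GroupSolver 𝔾
  open Commuting 𝔾
  open ElementaryRelations rels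
  open ElementaryProperties rels
  open HallWitt 0 rels
  open SetoidReasoning setoid

  private
    01-position : Position 3 2 0 1
    01-position = upper (s≤s z≤n) (s≤s z≤n)

  -- The Hall–Witt relation solved for the conjugate of e₀₂(ab) by e₂₃(c).
  conj : ∀ {a b c} → D 0 1 a → D 1 2 b → D 2 3 c →
         let x = E 0 1 a; X = E 0 2 (a * b); Y = E 1 3 (b * c); w = E 2 3 c in
         w ∙ X ∙ w ⁻¹ G.≈ x ∙ Y ⁻¹ ∙ x ⁻¹ ∙ X ∙ Y
  conj {a} {b} {c} da db dc = begin
    w ∙ X ∙ w ⁻¹
      ≈⟨ solve 4 (λ x X Y w → w ⊙ X ⊙ w ⁻ ⊜ (Y ⁻ ⊙ (Y ⊙ w ⊙ (X ⁻ ⊙ x)) ⊙ x ⁻ ⊙ w ⁻) ⁻) refl x X Y w ⟩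
    (Y ⁻¹ ∙ (Y ∙ w ∙ (X ⁻¹ ∙ x)) ∙ x ⁻¹ ∙ w ⁻¹) ⁻¹
      ≈⟨ ⁻¹-cong (∙-congʳ (∙-congʳ (∙-congˡ (hallWitt da db dc)))) ⟨
    (Y ⁻¹ ∙ (X ⁻¹ ∙ x ∙ (Y ∙ w)) ∙ x ⁻¹ ∙ w ⁻¹) ⁻¹
      ≈⟨ solve 4 (λ x X Y w → (Y ⁻ ⊙ (X ⁻ ⊙ x ⊙ (Y ⊙ w)) ⊙ x ⁻ ⊙ w ⁻) ⁻ ⊜
           w ⊙ x ⊙ w ⁻ ⊙ Y ⁻ ⊙ x ⁻ ⊙ X ⊙ Y) refl x X Y w ⟩
    w ∙ x ∙ w ⁻¹ ∙ Y ⁻¹ ∙ x ⁻¹ ∙ X ∙ Y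
      ≈⟨ ∙-congʳ (∙-congʳ (∙-congʳ (∙-congʳ (trans (∙-congʳ (sym xw))
           (solve 2 (λ x w → x ⊙ w ⊙ w ⁻ ⊜ x) refl x w))))) ⟩
    x ∙ Y ⁻¹ ∙ x ⁻¹ ∙ X ∙ Y ∎
    where
    x = E 0 1 a
    X = E 0 2 (a * b)
    Y = E 1 3 (b * c)
    w = E 2 3 c
    xw : x ∙ w G.≈ w ∙ x
    xw = E-comm {a = 1} (position (s≤s (s≤s z≤n)) (s≤s z≤n) (s≤s z≤n) (inj₂ ≤-refl))
                (position (s≤s (s≤s z≤n)) ≤-refl ≤-refl (inj₁ (s≤s (s≤s z≤n)))) (λ ()) (λ ()) da dc

  -- (−a)(−b) = ab, so conj also applies with x and Y inverted.
  conj-± : ∀ {a b c x X Y} → D 0 1 a → D 1 2 b → D 2 3 c →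
           E 0 1 a G.≈ x → E 0 2 (a * b) G.≈ X → E 1 3 (b * c) G.≈ Y →
           x ∙ Y ⁻¹ ∙ x ⁻¹ ∙ X ∙ Y G.≈ x ⁻¹ ∙ Y ∙ x ∙ X ∙ Y ⁻¹
  conj-± {a} {b} {c} {x} {X} {Y} da db dc ex eX eY = begin
    x ∙ Y ⁻¹ ∙ x ⁻¹ ∙ X ∙ Y
      ≈⟨ ∙-cong (∙-cong (∙-cong (∙-cong ex (⁻¹-cong eY)) (⁻¹-cong ex)) eX) eY ⟨
    _ ≈⟨ conj da db dc ⟨
    E 2 3 c ∙ E 0 2 (a * b) ∙ E 2 3 c ⁻¹
      ≈⟨ ∙-congʳ (∙-congˡ (trans eX (sym X≈))) ⟩
    E 2 3 c ∙ E 0 2 (- a * - b) ∙ E 2 3 c ⁻¹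
      ≈⟨ conj (D-neg da) (D-neg db) dc ⟩
    E 0 1 (- a) ∙ E 1 3 (- b * c) ⁻¹ ∙ E 0 1 (- a) ⁻¹ ∙ E 0 2 (- a * - b) ∙ E 1 3 (- b * c)
      ≈⟨ ∙-cong (∙-cong (∙-cong (∙-cong x≈ (⁻¹-cong Y≈)) (⁻¹-cong x≈)) X≈) Y≈ ⟩
    x ⁻¹ ∙ Y ⁻¹ ⁻¹ ∙ x ⁻¹ ⁻¹ ∙ X ∙ Y ⁻¹
      ≈⟨ solve 3 (λ x X Y → x ⁻ ⊙ Y ⁻ ⁻ ⊙ x ⁻ ⁻ ⊙ X ⊙ Y ⁻ ⊜ x ⁻ ⊙ Y ⊙ x ⊙ X ⊙ Y ⁻) refl x X Y ⟩
    x ⁻¹ ∙ Y ∙ x ∙ X ∙ Y ⁻¹ ∎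
    where
    x≈ : E 0 1 (- a) G.≈ x ⁻¹
    x≈ = trans (E-neg 01-position da) (⁻¹-cong ex)
    X≈ : E 0 2 (- a * - b) G.≈ X
    X≈ = trans (E-cong 0N (D-* (D-neg da) (D-neg db))
      (P.trans (P.sym (-‿distribˡ-* _ _)) (P.trans (P.-‿cong (P.sym (-‿distribʳ-* _ _))) (-‿involutive _)))) eX
    Y≈ : E 1 3 (- b * c) G.≈ Y ⁻¹
    Y≈ = trans (E-cong 1n (D-* (D-neg db) dc) (P.sym (-‿distribˡ-* _ _)))
      (trans (E-neg 1n (D-* db dc)) (⁻¹-cong eY))

  -- Put `u = x⁻¹ Y x` and `v = x Y⁻¹ x⁻¹`. Then `conj-±` reads `u⁻¹ v = X Y⁻² X⁻¹`, and with `a`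
  -- and `c` negated it reads `u⁻¹ v = X⁻¹ Y⁻² X`. Comparing the two, `X²` commutes with `Y⁻²`.
  squares-⇄ : ∀ {a b c} → D 0 1 a → D 1 2 b → D 2 3 c →
              let X = E 0 2 (a * b); Y = E 1 3 (b * c) in X ∙ X ⇄ Y ∙ Y
  squares-⇄ {a} {b} {c} da db dc = ⇄-cong refl (solve 1 (λ Y → (Y ⁻ ⊙ Y ⁻) ⁻ ⊜ Y ⊙ Y) refl Y) (⇄-⁻¹ (begin
    X ∙ X ∙ (Y ⁻¹ ∙ Y ⁻¹)
      ≈⟨ solve 3 (λ x X Y → X ⊙ X ⊙ (Y ⁻ ⊙ Y ⁻) ⊜
           X ⊙ ((x ⁻ ⊙ Y ⊙ x) ⁻ ⊙ (x ⁻ ⊙ Y ⊙ x ⊙ X ⊙ Y ⁻) ⊙ (Y ⁻ ⊙ X ⁻)) ⊙ X) refl x X Y ⟩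
    X ∙ ((x ⁻¹ ∙ Y ∙ x) ⁻¹ ∙ (x ⁻¹ ∙ Y ∙ x ∙ X ∙ Y ⁻¹) ∙ (Y ⁻¹ ∙ X ⁻¹)) ∙ X
      ≈⟨ ∙-congʳ (∙-congˡ (∙-congʳ (∙-congˡ (conj-± da db dc refl refl refl)))) ⟨
    X ∙ ((x ⁻¹ ∙ Y ∙ x) ⁻¹ ∙ (x ∙ Y ⁻¹ ∙ x ⁻¹ ∙ X ∙ Y) ∙ (Y ⁻¹ ∙ X ⁻¹)) ∙ X
      ≈⟨ solve 3 (λ x X Y → X ⊙ ((x ⁻ ⊙ Y ⊙ x) ⁻ ⊙ (x ⊙ Y ⁻ ⊙ x ⁻ ⊙ X ⊙ Y) ⊙ (Y ⁻ ⊙ X ⁻)) ⊙ X ⊜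
           X ⊙ ((x ⁻ ⊙ Y ⊙ x) ⁻ ⊙ (x ⁻ ⁻ ⊙ Y ⁻ ⊙ x ⁻ ⊙ X ⁻ ⊙ Y ⁻ ⁻) ⊙ (Y ⁻ ⊙ X)) ⊙ X) refl x X Y ⟩
    X ∙ ((x ⁻¹ ∙ Y ∙ x) ⁻¹ ∙ (x ⁻¹ ⁻¹ ∙ Y ⁻¹ ∙ x ⁻¹ ∙ X ⁻¹ ∙ Y ⁻¹ ⁻¹) ∙ (Y ⁻¹ ∙ X)) ∙ X
      ≈⟨ ∙-congʳ (∙-congˡ (∙-congʳ (∙-congˡ (conj-± (D-neg da) db (D-neg dc) x≈ X≈ Y≈)))) ⟨
    X ∙ ((x ⁻¹ ∙ Y ∙ x) ⁻¹ ∙ (x ⁻¹ ∙ Y ⁻¹ ⁻¹ ∙ x ⁻¹ ⁻¹ ∙ X ⁻¹ ∙ Y ⁻¹) ∙ (Y ⁻¹ ∙ X)) ∙ X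
      ≈⟨ solve 3 (λ x X Y → X ⊙ ((x ⁻ ⊙ Y ⊙ x) ⁻ ⊙ (x ⁻ ⊙ Y ⁻ ⁻ ⊙ x ⁻ ⁻ ⊙ X ⁻ ⊙ Y ⁻) ⊙ (Y ⁻ ⊙ X)) ⊙ X ⊜
           Y ⁻ ⊙ Y ⁻ ⊙ (X ⊙ X)) refl x X Y ⟩
    Y ⁻¹ ∙ Y ⁻¹ ∙ (X ∙ X) ∎))
    where
    x = E 0 1 a
    X = E 0 2 (a * b)
    Y = E 1 3 (b * c)
    x≈ : E 0 1 (- a) G.≈ x ⁻¹
    x≈ = E-neg 01-position da
    X≈ : E 0 2 (- a * b) G.≈ X ⁻¹
    X≈ = trans (E-cong 0N (D-* (D-neg da) db) (P.sym (-‿distribˡ-* _ _))) (E-neg 0N (D-* da db))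
    Y≈ : E 1 3 (b * - c) G.≈ Y ⁻¹
    Y≈ = trans (E-cong 1n (D-* db (D-neg dc)) (P.sym (-‿distribʳ-* _ _))) (E-neg 1n (D-* db dc))

  private
    double-½ : ∀ p → ½ * p + ½ * p ≈ p
    double-½ p = P.trans (P.sym (P.distribʳ _ _ _)) (P.trans (P.*-congʳ ½+½≈1) (P.*-identityˡ p))

  -- Halving `a` and `c` turns the squares into the elements themselves. The shared factor `b` is
  -- the restriction that the following lemmas remove.
  products-⇄ : ∀ {a b c p r} → D 0 1 a → D 1 2 b → D 2 3 c → a * b ≈ p → b * c ≈ r →
               E 0 2 p ⇄ E 1 3 r
  products-⇄ {a} {b} {c} {p} {r} da db dc ab≈p bc≈r =
    ⇄-cong (trans (E-add 0N dX dX) (E-cong 0N (D-+ dX dX) X≈))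
           (trans (E-add 1n dY dY) (E-cong 1n (D-+ dY dY) Y≈))
           (squares-⇄ da′ db dc′)
    where
    da′ : D 0 1 (½ * a)
    da′ = D-* D-½ da
    dc′ : D 2 3 (½ * c)
    dc′ = D-* (D-shift (D-shift D-½)) dc
    dX = D-* da′ db
    dY = D-* db dc′
    X≈ : ½ * a * b + ½ * a * b ≈ p
    X≈ = P.trans (P.sym (P.distribʳ _ _ _)) (P.trans (P.*-congʳ (double-½ a)) ab≈p)
    Y≈ : b * (½ * c) + b * (½ * c) ≈ r
    Y≈ = P.trans (P.sym (P.distribˡ _ _ _)) (P.trans (P.*-congˡ (double-½ c)) bc≈r)

  -- The choice `b = 1`. Together with `b = t` below it covers all pairs of monomials of degree at
  -- most 2 except a constant with a multiple of `t * t`.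
  linear-⇄ : ∀ {p r} → D 0 1 p → D 1 2 r → E 0 2 p ⇄ E 1 3 r
  linear-⇄ dp dr = products-⇄ dp D-1 (D-shift dr) (P.*-identityʳ _) (P.*-identityˡ _)

  t*-⇄ : ∀ {p r} → D 0 1 p → D 1 2 r → E 0 2 (t * p) ⇄ E 1 3 (t * r)
  t*-⇄ dp dr = products-⇄ dp D-t (D-shift dr) (P.*-comm _ _) P.refl

  private
    D-1+t : ∀ {i} → D i (suc i) (1# + t)
    D-1+t = D-+ D-1 D-t

    up : ∀ {i j p} → D i j p → D i (suc j) p
    up = D-weaken ≤-refl (n≤1+n _)

    -- (1 + t)² s, cut into pieces whose commutation with constants and linear terms is known.
    square : ∀ s → s + (t * (s + s) + t * (t * s)) ≈ (1# + t) * (s * (1# + t))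
    square s = solveᴾ 2 (λ t s → s :+ (t :* (s :+ s) :+ t :* (t :* s)) :=
                           (con 1 :+ t) :* (s :* (con 1 :+ t))) P.refl t s

    E-square : ∀ {a i s} → Position 3 a i (suc (suc i)) → D i i s →
               E i (suc (suc i)) s ∙ (E i (suc (suc i)) (t * (s + s)) ∙ E i (suc (suc i)) (t * (t * s)))
               G.≈ E i (suc (suc i)) ((1# + t) * (s * (1# + t)))
    E-square {s = s} pos ds = begin
      _ ≈⟨ ∙-congˡ (E-add pos d₁ d₂) ⟩
      _ ≈⟨ E-add pos (up (up ds)) (D-+ d₁ d₂) ⟩
      _ ≈⟨ E-cong pos (D-+ (up (up ds)) (D-+ d₁ d₂)) (square s) ⟩
      _ ∎
      where
      d₁ = up (D-* D-t (D-shift (D-+ ds ds)))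
      d₂ = D-* D-t (D-* D-t (D-shift (D-shift ds)))

    E-1+t : ∀ {a i s} → Position 3 a i (suc (suc i)) → D i i s →
            E i (suc (suc i)) (t * s) ∙ E i (suc (suc i)) s G.≈ E i (suc (suc i)) (s * (1# + t))
    E-1+t {s = s} pos ds =
      trans (E-add pos (up (D-* D-t (D-shift ds))) (up (up ds)))
        (E-cong pos (D-+ (up (D-* D-t (D-shift ds))) (up (up ds)))
          (solveᴾ 2 (λ t s → t :* s :+ s := s :* (con 1 :+ t)) P.refl t s))

  -- The choice `b = 1 + t`: `e_{02}(p (1 + t))` commutes with `e_{13}(r (1 + t)²)`. When both are
  -- expanded, all pairs of terms are known to commute except `p` with `t² r`, and `⇄-cancelˡ`
  -- removes the known ones.
  const-t²-⇄ : ∀ {p r} → D 0 0 p → D 1 1 r → E 0 2 p ⇄ E 1 3 (t * (t * r))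
  const-t²-⇄ {p} {r} dp dr =
    ⇄-cancelˡ (linear-⇄ (up dp) (D-* D-t (D-shift (D-+ dr dr)))) (⇄-cancelˡ (linear-⇄ (up dp) (up dr)) total)
    where
    h = E 1 3 r ∙ (E 1 3 (t * (r + r)) ∙ E 1 3 (t * (t * r)))
    h⇄tp : E 0 2 (t * p) ⇄ h
    h⇄tp = ⇄-∙ (linear-⇄ (D-* D-t (D-shift dp)) (up dr))
      (⇄-∙ (t*-⇄ (up dp) (up (D-+ dr dr))) (t*-⇄ (up dp) (D-* D-t (D-shift dr))))
    h⇄sum : h ⇄ E 0 2 (t * p) ∙ E 0 2 p
    h⇄sum = ⇄-sym (⇄-cong (sym (E-1+t 0N dp)) (sym (E-square 1n dr))
      (products-⇄ (up dp) D-1+t (D-* (D-shift dr) D-1+t) P.refl P.refl))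
    total : E 0 2 p ⇄ h
    total = ⇄-sym (⇄-cancelˡ (⇄-sym h⇄tp) h⇄sum)

  t²-const-⇄ : ∀ {p r} → D 0 0 p → D 1 1 r → E 0 2 (t * (t * p)) ⇄ E 1 3 r
  t²-const-⇄ {p} {r} dp dr = ⇄-sym
    (⇄-cancelˡ (⇄-sym (linear-⇄ (D-* D-t (D-shift (D-+ dp dp))) (up dr)))
      (⇄-cancelˡ (⇄-sym (linear-⇄ (up dp) (up dr))) total))
    where
    h = E 0 2 p ∙ (E 0 2 (t * (p + p)) ∙ E 0 2 (t * (t * p)))
    h⇄tr : E 1 3 (t * r) ⇄ h
    h⇄tr = ⇄-∙ (⇄-sym (linear-⇄ (up dp) (D-* D-t (D-shift dr))))
      (⇄-∙ (⇄-sym (t*-⇄ (up (D-+ dp dp)) (up dr))) (⇄-sym (t*-⇄ (D-* D-t (D-shift dp)) (up dr))))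
    h⇄sum : h ⇄ E 1 3 (t * r) ∙ E 1 3 r
    h⇄sum = ⇄-cong (sym (E-square 0N dp)) (sym (E-1+t 1n dr))
      (products-⇄ (D-* dp D-1+t) D-1+t (up (D-shift dr)) (P.*-comm _ _) (P.*-comm _ _))
    total : E 1 3 r ⇄ h
    total = ⇄-sym (⇄-cancelˡ (⇄-sym h⇄tr) h⇄sum)

  key : Key
  key {g} {r} dg dr =
    ⇄-cong (sym (E-hd-tl 0N z≤n dg)) (sym (E-hd-tl 1n (s≤s z≤n) dr))
      (⇄-∙ (⇄-sym (⇄-∙ (⇄-sym (linear-⇄ (up D-hd) (up D-hd))) t-const))
           (⇄-sym (⇄-∙ const-t (⇄-sym (t*-⇄ (D-tl dg) (D-tl dr))))))
    where
    dtg : D 0 1 (tl g)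
    dtg = D-tl dg
    dtr : D 1 2 (tl r)
    dtr = D-tl dr
    split : ∀ {p} → t * p ≈ t * hd p + t * (t * tl p)
    split = P.trans (P.*-congˡ (P.hd-tl _)) (P.distribˡ _ _ _)
    t-const : E 1 3 (hd r) ⇄ E 0 2 (t * tl g)
    t-const = ⇄-cong refl
      (trans (E-add 0N (up (D-* D-t (D-shift D-hd))) (D-* D-t (D-* D-t (D-shift (D-shift (D-tl dtg))))))
             (sym (E-cong 0N (D-* D-t (D-shift dtg)) split)))
      (⇄-∙ (⇄-sym (linear-⇄ (D-* D-t (D-shift D-hd)) (up D-hd))) (⇄-sym (t²-const-⇄ (D-tl dtg) D-hd)))
    const-t : E 1 3 (t * tl r) ⇄ E 0 2 (hd g)
    const-t = ⇄-sym (⇄-cong refl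
      (trans (E-add 1n (up (D-* D-t (D-shift D-hd))) (D-* D-t (D-* D-t (D-shift (D-shift (D-tl dtr))))))
             (sym (E-cong 1n (D-* D-t (D-shift dtr)) split)))
      (⇄-∙ (linear-⇄ (up D-hd) (D-* D-t (D-shift D-hd))) (const-t²-⇄ D-hd (D-tl dtr))))

-- Collection into ordered products.

module OrderedProduct {c ℓ} (M : RawMonoid c ℓ) where
  open RawMonoid M

  column : (ℕ → Carrier) → ℕ → Carrier
  column f zero    = ε
  column f (suc i) = f i ∙ column f i

  triangle : (ℕ → ℕ → Carrier) → ℕ → Carrier
  triangle f zero    = ε
  triangle f (suc j) = column (λ i → f i j) j ∙ triangle f j

module _ {c ℓ c′ ℓ′} (M : RawMonoid c ℓ) (M′ : RawMonoid c′ ℓ′) where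
  private
    module M = RawMonoid M
    module M′ = RawMonoid M′
    open OrderedProduct

  -- Stated for any relation compatible with the two products, since it later serves for equality,
  -- evaluation of words, lengths, membership in `K_a` and absorption.
  column-rel : ∀ {r} (_~_ : M.Carrier → M′.Carrier → Set r) → M.ε ~ M′.ε →
               (∀ {x x′ y y′} → x ~ x′ → y ~ y′ → (x M.∙ y) ~ (x′ M′.∙ y′)) →
               ∀ {f g} m → (∀ i → i < m → f i ~ g i) → column M f m ~ column M′ g m
  column-rel _~_ ~ε ~∙ zero    h = ~ε
  column-rel _~_ ~ε ~∙ (suc m) h =
    ~∙ (h m ≤-refl) (column-rel _~_ ~ε ~∙ m λ i i<m → h i (m≤n⇒m≤1+n i<m))

  triangle-rel : ∀ {r} (_~_ : M.Carrier → M′.Carrier → Set r) → M.ε ~ M′.ε →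
                 (∀ {x x′ y y′} → x ~ x′ → y ~ y′ → (x M.∙ y) ~ (x′ M′.∙ y′)) →
                 ∀ {f g} m → (∀ i j → i < j → j < m → f i j ~ g i j) → triangle M f m ~ triangle M′ g m
  triangle-rel _~_ ~ε ~∙ zero    h = ~ε
  triangle-rel _~_ ~ε ~∙ (suc m) h =
    ~∙ (column-rel _~_ ~ε ~∙ m λ i i<m → h i m i<m ≤-refl)
       (triangle-rel _~_ ~ε ~∙ m λ i j i<j j<m → h i j i<j (m≤n⇒m≤1+n j<m))

-- The relations that move a superdiagonal factor from the right into a product
-- of elementary factors ordered by decreasing columns, then by decreasing rows.
record CollectionRelations {c ℓ c′ ℓ′ d} (M : Monoid c ℓ) (P : FilteredRing c′ ℓ′ d) (n : ℕ)
       : Set (c ⊔ ℓ ⊔ c′ ⊔ ℓ′ ⊔ d) where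
  private
    module M = Monoid M
    module P = FilteredRing P
  open M using (_∙_)
  open P using (D)
  field
    Ê        : ℕ → ℕ → P.Carrier → M.Carrier
    Ê-cong   : ∀ {i j p r} → i < j → j ≤ n → D i j p → p P.≈ r → Ê i j p M.≈ Ê i j r
    Ê-0#     : ∀ {i j} → i < j → j ≤ n → Ê i j P.0# M.≈ M.ε
    Ê-add    : ∀ {i j p r} → i < j → j ≤ n → D i j p → D i j r →
               Ê i j p ∙ Ê i j r M.≈ Ê i j (p P.+ r)
    Ê-column : ∀ {i m j p r} → i < m → m < j → j ≤ n → D i j p → D m j r →
               Ê i j p ∙ Ê m j r M.≈ Ê m j r ∙ Ê i j p
    Ê-skip   : ∀ {i m k p r} → i < m → m < k → k < n → D m k p → D i (suc k) r →
               Ê m k p ∙ Ê i (suc k) r M.≈ Ê i (suc k) r ∙ Ê m k p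
    Ê-far    : ∀ {i j k p r} → i < j → j < k → k < n → D i j p → D k (suc k) r →
               Ê i j p ∙ Ê k (suc k) r M.≈ Ê k (suc k) r ∙ Ê i j p
    Ê-mul    : ∀ {i k p r} → i < k → k < n → D i k p → D k (suc k) r →
               Ê i k p ∙ Ê k (suc k) r M.≈ Ê k (suc k) r ∙ (Ê i (suc k) (p P.* r) ∙ Ê i k p)

module Collect {c ℓ c′ ℓ′ d} {M : Monoid c ℓ} {P : FilteredRing c′ ℓ′ d} {n : ℕ}
               (rels : CollectionRelations M P n) where
  open Monoid M
  open CollectionRelations rels
  open OrderedProduct rawMonoid
  open SetoidReasoning setoid
  private module P = FilteredRing P
  open P using (D; D-*; D-+; D-resp)

  -- In this order a factor `e_{k,k+1}(r)` arriving from the right crosses only the columns up to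
  -- `k`. What it creates belongs to column `k + 1`, which stands directly to the left of column
  -- `k`, and the columns beyond are not touched. This mirrors the column operation on matrices.
  σ : (ℕ → ℕ → P.Carrier) → Carrier
  σ A = triangle (λ i j → Ê i j (A i j)) (suc n)

  σ-cong : ∀ {A B} → (∀ i j → i < j → j ≤ n → D i j (A i j)) →
           (∀ i j → i < j → j ≤ n → A i j P.≈ B i j) → σ A ≈ σ B
  σ-cong dA A≈B = triangle-rel rawMonoid rawMonoid _≈_ refl ∙-cong (suc n)
    λ i j i<j j<n → Ê-cong i<j (≤-pred j<n) (dA i j i<j (≤-pred j<n)) (A≈B i j i<j (≤-pred j<n))

  private
    ε-product : ∀ {A} → (∀ i j → i < j → j ≤ n → A i j P.≈ P.0#) → σ A ≈ triangle (λ _ _ → ε) (suc n)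
    ε-product A≈0 = triangle-rel rawMonoid rawMonoid _≈_ refl ∙-cong (suc n)
      λ i j i<j j<n → trans (sym (Ê-cong i<j (≤-pred j<n) P.D-0# (P.sym (A≈0 i j i<j (≤-pred j<n)))))
                            (Ê-0# i<j (≤-pred j<n))

  σ-0# : ∀ {A} → (∀ i j → i < j → j ≤ n → A i j P.≈ P.0#) → σ A ≈ ε
  σ-0# A≈0 = trans (ε-product A≈0)
    (triangle-rel rawMonoid rawMonoid (λ x _ → x ≈ ε) refl (λ p q → trans (∙-cong p q) (identityˡ ε))
       {g = λ _ _ → ε} (suc n) λ _ _ _ _ → refl)

  module _ {k r} (k<n : k < n) (dr : D k (suc k) r) where

    private
      e = Ê k (suc k) r

      pass : ∀ {x y z} → x ∙ z ≈ z ∙ x → y ∙ z ≈ z ∙ y → x ∙ y ∙ z ≈ z ∙ (x ∙ y)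
      pass {x} {y} {z} p q = begin
        x ∙ y ∙ z     ≈⟨ assoc _ _ _ ⟩
        x ∙ (y ∙ z)   ≈⟨ ∙-congˡ q ⟩
        x ∙ (z ∙ y)   ≈⟨ assoc _ _ _ ⟨
        x ∙ z ∙ y     ≈⟨ ∙-congʳ p ⟩
        z ∙ x ∙ y     ≈⟨ assoc _ _ _ ⟩
        z ∙ (x ∙ y)   ∎

      pass-ε : ∀ {z} → ε ∙ z ≈ z ∙ ε
      pass-ε = trans (identityˡ _) (sym (identityʳ _))

    column-skip : ∀ {f : ℕ → P.Carrier} {p m} m′ → m′ ≤ m → m < k → D m k p → (∀ i → i < m′ → D i (suc k) (f i)) →
                  column (λ i → Ê i (suc k) (f i)) m′ ∙ Ê m k p ≈
                  Ê m k p ∙ column (λ i → Ê i (suc k) (f i)) m′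
    column-skip         zero     _    _   _  _  = pass-ε
    column-skip {f = f} (suc m′) m′<m m<k dp df =
      pass (sym (Ê-skip m′<m m<k k<n dp (df m′ ≤-refl)))
           (column-skip {f = f} m′ (<⇒≤ m′<m) m<k dp λ i i<m′ → df i (m≤n⇒m≤1+n i<m′))

    -- Each factor at `(m , k)` leaves behind a new one at `(m , k + 1)`. To gather the new ones in
    -- a single column, those from rows `i < m` must move left across the factor at `(m , k)`;
    -- decreasing row order is what makes these the only crossings, and they commute by `Ê-skip`.
    column-mul : ∀ {f : ℕ → P.Carrier} m → m ≤ k → (∀ i → i < m → D i k (f i)) →
                 column (λ i → Ê i k (f i)) m ∙ e ≈
                 e ∙ (column (λ i → Ê i (suc k) (f i P.* r)) m ∙ column (λ i → Ê i k (f i)) m)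
    column-mul         zero    _   _  = trans (identityˡ _)
      (sym (trans (∙-congˡ (identityˡ ε)) (identityʳ _)))
    column-mul {f = f} (suc m) m<k df = begin
      x ∙ C ∙ e               ≈⟨ assoc _ _ _ ⟩
      x ∙ (C ∙ e)             ≈⟨ ∙-congˡ (column-mul {f = f} m (<⇒≤ m<k) df′) ⟩
      x ∙ (e ∙ (C′ ∙ C))      ≈⟨ assoc _ _ _ ⟨
      x ∙ e ∙ (C′ ∙ C)        ≈⟨ ∙-congʳ (Ê-mul m<k k<n (df m ≤-refl) dr) ⟩
      e ∙ (x′ ∙ x) ∙ (C′ ∙ C) ≈⟨ assoc _ _ _ ⟩
      e ∙ (x′ ∙ x ∙ (C′ ∙ C)) ≈⟨ ∙-congˡ (assoc _ _ _) ⟩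
      e ∙ (x′ ∙ (x ∙ (C′ ∙ C))) ≈⟨ ∙-congˡ (∙-congˡ (assoc _ _ _)) ⟨
      e ∙ (x′ ∙ (x ∙ C′ ∙ C)) ≈⟨ ∙-congˡ (∙-congˡ (∙-congʳ
                                   (column-skip {f = λ i → f i P.* r} m ≤-refl m<k (df m ≤-refl) λ i i<m → D-* (df′ i i<m) dr))) ⟨
      e ∙ (x′ ∙ (C′ ∙ x ∙ C)) ≈⟨ ∙-congˡ (∙-congˡ (assoc _ _ _)) ⟩
      e ∙ (x′ ∙ (C′ ∙ (x ∙ C))) ≈⟨ ∙-congˡ (assoc _ _ _) ⟨
      e ∙ (x′ ∙ C′ ∙ (x ∙ C)) ∎
      where
      x = Ê m k (f m)
      x′ = Ê m (suc k) (f m P.* r)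
      C = column (λ i → Ê i k (f i)) m
      C′ = column (λ i → Ê i (suc k) (f i P.* r)) m
      df′ : ∀ i → i < m → D i k (f i)
      df′ i i<m = df i (m≤n⇒m≤1+n i<m)

    column-far : ∀ {f : ℕ → P.Carrier} {j} m → m ≤ j → j < k → (∀ i → i < m → D i j (f i)) →
                 column (λ i → Ê i j (f i)) m ∙ e ≈ e ∙ column (λ i → Ê i j (f i)) m
    column-far         zero    _   _   _  = pass-ε
    column-far {f = f} (suc m) m<j j<k df =
      pass (Ê-far m<j j<k k<n (df m ≤-refl) dr)
           (column-far {f = f} m (<⇒≤ m<j) j<k λ i i<m → df i (m≤n⇒m≤1+n i<m))

    triangle-far : ∀ {A : ℕ → ℕ → P.Carrier} j → j ≤ k → (∀ i j → i < j → j ≤ n → D i j (A i j)) →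
                   triangle (λ i j → Ê i j (A i j)) j ∙ e ≈ e ∙ triangle (λ i j → Ê i j (A i j)) j
    triangle-far         zero    _   _  = pass-ε
    triangle-far {A = A} (suc j) j<k dA =
      pass (column-far {f = λ i → A i j} j ≤-refl j<k λ i i<j → dA i j i<j (<⇒≤ (<-trans j<k k<n))) (triangle-far {A} j (<⇒≤ j<k) dA)

    column-commute : ∀ {f : ℕ → P.Carrier} {p m} m′ → m′ ≤ m → m < suc k → D m (suc k) p →
                     (∀ i → i < m′ → D i (suc k) (f i)) →
                     column (λ i → Ê i (suc k) (f i)) m′ ∙ Ê m (suc k) p ≈
                     Ê m (suc k) p ∙ column (λ i → Ê i (suc k) (f i)) m′
    column-commute         zero     _    _   _  _  = pass-ε
    column-commute {f = f} (suc m′) m′<m m<k dp df =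
      pass (Ê-column m′<m m<k k<n (df m′ ≤-refl) dp)
           (column-commute {f = f} m′ (<⇒≤ m′<m) m<k dp λ i i<m′ → df i (m≤n⇒m≤1+n i<m′))

    private
      merge : ∀ {x C y C′ z B} → C ∙ y ≈ y ∙ C → x ∙ y ≈ z → C ∙ C′ ≈ B → x ∙ C ∙ (y ∙ C′) ≈ z ∙ B
      merge {x} {C} {y} {C′} {z} {B} p q s = begin
        x ∙ C ∙ (y ∙ C′)     ≈⟨ assoc _ _ _ ⟩
        x ∙ (C ∙ (y ∙ C′))   ≈⟨ ∙-congˡ (assoc _ _ _) ⟨
        x ∙ (C ∙ y ∙ C′)     ≈⟨ ∙-congˡ (∙-congʳ p) ⟩
        x ∙ (y ∙ C ∙ C′)     ≈⟨ ∙-congˡ (assoc _ _ _) ⟩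
        x ∙ (y ∙ (C ∙ C′))   ≈⟨ assoc _ _ _ ⟨
        x ∙ y ∙ (C ∙ C′)     ≈⟨ ∙-cong q s ⟩
        z ∙ B                ∎

    column-add : ∀ {f g h : ℕ → P.Carrier} m → m ≤ suc k → (∀ i → i < m → D i (suc k) (f i)) →
                 (∀ i → i < m → D i (suc k) (g i)) → (∀ i → i < m → h i P.≈ f i P.+ g i) →
                 column (λ i → Ê i (suc k) (f i)) m ∙ column (λ i → Ê i (suc k) (g i)) m ≈
                 column (λ i → Ê i (suc k) (h i)) m
    column-add                         zero    _   _  _  _ = identityˡ ε
    column-add {f = f} {g = g} {h = h} (suc m) m<k df dg h≈ =
      merge (column-commute {f = f} m ≤-refl m<k (dg m ≤-refl) λ i i<m → df i (m≤n⇒m≤1+n i<m))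
            (trans (Ê-add m<k k<n (df m ≤-refl) (dg m ≤-refl))
                   (Ê-cong m<k k<n (D-+ (df m ≤-refl) (dg m ≤-refl)) (P.sym (h≈ m ≤-refl))))
            (column-add {f = f} {g = g} {h = h} m (<⇒≤ m<k) (λ i i<m → df i (m≤n⇒m≤1+n i<m))
               (λ i i<m → dg i (m≤n⇒m≤1+n i<m)) (λ i i<m → h≈ i (m≤n⇒m≤1+n i<m)))

    -- B is the matrix product of A with the elementary matrix e_{k,k+1}(r).
    module _ {A B : ℕ → ℕ → P.Carrier} (dA : ∀ i j → i < j → j ≤ n → D i j (A i j))
             (same : ∀ i j → i < j → j ≤ n → j ≢ suc k → B i j P.≈ A i j)
             (above : ∀ i → i < k → B i (suc k) P.≈ A i (suc k) P.+ A i k P.* r)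
             (diag : B k (suc k) P.≈ A k (suc k) P.+ r) where

      private
        T : (ℕ → ℕ → P.Carrier) → ℕ → Carrier
        T A = triangle (λ i j → Ê i j (A i j))
        C : (ℕ → ℕ → P.Carrier) → ℕ → ℕ → Carrier
        C A j = column (λ i → Ê i j (A i j))

        C-same : ∀ {j} m → m ≤ j → j ≤ n → j ≢ suc k → C A j m ≈ C B j m
        C-same {j} m m≤j j≤n j≢ = column-rel rawMonoid rawMonoid _≈_ refl ∙-cong m λ i i<m →
          Ê-cong (<-≤-trans i<m m≤j) j≤n (dA i j (<-≤-trans i<m m≤j) j≤n)
            (P.sym (same i j (<-≤-trans i<m m≤j) j≤n j≢))

        T-same : ∀ m → m ≤ suc k → T A m ≈ T B m
        T-same m m≤ = triangle-rel rawMonoid rawMonoid _≈_ refl ∙-cong m λ i j i<j j<m →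
          Ê-cong i<j (≤-trans (≤-pred (<-≤-trans j<m m≤)) (<⇒≤ k<n)) (dA i j i<j (≤-trans (≤-pred (<-≤-trans j<m m≤)) (<⇒≤ k<n)))
            (P.sym (same i j i<j (≤-trans (≤-pred (<-≤-trans j<m m≤)) (<⇒≤ k<n))
              λ { ≡.refl → <-irrefl ≡.refl (<-≤-trans j<m m≤) }))

        base : T A (suc (suc k)) ∙ e ≈ T B (suc (suc k))
        base = begin
          C A (suc k) (suc k) ∙ (C A k k ∙ T A k) ∙ e
            ≈⟨ assoc _ _ _ ⟩
          C A (suc k) (suc k) ∙ (C A k k ∙ T A k ∙ e)
            ≈⟨ ∙-congˡ (trans (assoc _ _ _) (trans (∙-congˡ (triangle-far {A} k ≤-refl dA)) (sym (assoc _ _ _)))) ⟩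
          C A (suc k) (suc k) ∙ (C A k k ∙ e ∙ T A k)
            ≈⟨ ∙-congˡ (∙-congʳ (column-mul {f = λ i → A i k} k ≤-refl λ i i<k → dA i k i<k (<⇒≤ k<n))) ⟩
          C A (suc k) (suc k) ∙ (e ∙ (Ar ∙ C A k k) ∙ T A k)
            ≈⟨ ∙-congˡ (trans (∙-congʳ (sym (assoc _ _ _))) (assoc _ _ _)) ⟩
          C A (suc k) (suc k) ∙ (e ∙ Ar ∙ T A (suc k))
            ≈⟨ assoc _ _ _ ⟨
          C A (suc k) (suc k) ∙ (e ∙ Ar) ∙ T A (suc k)
            -- The row `k` factor of column `k + 1` absorbs `e`, which gives the entry in `diag`;
            -- the rows above it are merged with the created column `Ar`, which gives the entries in
            -- `above`.
            ≈⟨ ∙-cong (merge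
                 (column-commute {f = λ i → A i (suc k)} k ≤-refl ≤-refl dr λ i i<k → dA i (suc k) (m≤n⇒m≤1+n i<k) k<n)
                 (trans (Ê-add ≤-refl k<n (dA k (suc k) ≤-refl k<n) dr)
                   (Ê-cong ≤-refl k<n (D-+ (dA k (suc k) ≤-refl k<n) dr) (P.sym diag)))
                 (column-add {f = λ i → A i (suc k)} {g = λ i → A i k P.* r} {h = λ i → B i (suc k)} k (n≤1+n _)
                   (λ i i<k → dA i (suc k) (m≤n⇒m≤1+n i<k) k<n)
                   (λ i i<k → D-* (dA i k i<k (<⇒≤ k<n)) dr) above))
                 (T-same (suc k) ≤-refl) ⟩
          T B (suc (suc k)) ∎
          where Ar = column (λ i → Ê i (suc k) (A i k P.* r)) k

        extend : ∀ m → suc (suc k) ≤ m → m ≤ suc n → T A m ∙ e ≈ T B m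
        extend m k<m m≤n with m≤n⇒m<n∨m≡n k<m
        ... | inj₂ ≡.refl = base
        extend (suc m) _ m<n | inj₁ k<m = trans (assoc _ _ _)
          (∙-cong (C-same m ≤-refl (≤-pred m<n) λ { ≡.refl → <-irrefl ≡.refl (≤-pred k<m) })
                  (extend m (≤-pred k<m) (<⇒≤ m<n)))

      σ-step : σ A ∙ Ê k (suc k) r ≈ σ B
      σ-step = extend (suc n) (s≤s k<n) ≤-refl

-- The collection relations with the corner included.

module CornerCollection {c ℓ c′ ℓ′ d} {𝔾 : Group c ℓ} {P : FilteredRing c′ ℓ′ d} (L : ℕ)
  (rels : ElementaryRelations 𝔾 P (suc (suc (suc L))))
  (key : HallWitt.Key L rels) where

  open Group 𝔾
  open Commuting 𝔾
  open ElementaryRelations rels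
  open FilteredRing P using (D)
  open Corner L rels key
  open ElementaryProperties rels
  open Central
  private
    module P = FilteredRing P
    N n : ℕ
    N = suc (suc L)
    n = suc N

  Ê : ℕ → ℕ → P.Carrier → Carrier
  Ê zero    j p with j ℕ.≟ n
  ... | yes _ = corner p
  ... | no _  = E zero j p
  Ê (suc i) j p = E (suc i) j p

  data CornerOrPosition : ℕ → ℕ → Set where
    isCorner   : CornerOrPosition 0 n
    isPosition : ∀ {a i j} → Position n a i j → CornerOrPosition i j

  classify : ∀ {i j} → i < j → j ≤ n → CornerOrPosition i j
  classify {zero} {j} i<j j≤n with m≤n⇒m<n∨m≡n j≤n
  ... | inj₁ j<n    = isPosition (upper i<j (≤-pred j<n))
  ... | inj₂ ≡.refl = isCorner
  classify {suc i} i<j j≤n = isPosition (lower (s≤s z≤n) i<j j≤n)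

  private
    Ê-corner : ∀ {p} → Ê 0 n p ≈ corner p
    Ê-corner with n ℕ.≟ n
    ... | yes _  = refl
    ... | no n≢n = contradiction ≡.refl n≢n

  Ê-position : ∀ {a i j p} → Position n a i j → Ê i j p ≈ E i j p
  Ê-position {i = suc i} pos = refl
  Ê-position {i = zero} {j} (position a<n _ _ (inj₂ j≤a)) with j ℕ.≟ n
  ... | no _       = refl
  ... | yes ≡.refl = contradiction (<-≤-trans a<n j≤a) (<-irrefl ≡.refl)

  private
    ∙-cong₃ : ∀ {a b c d a′ b′ c′ d′} → a ≈ a′ → b ≈ b′ → c ≈ c′ → d ≈ d′ →
              a ∙ b ≈ c ∙ d → a′ ∙ b′ ≈ c′ ∙ d′
    ∙-cong₃ p q r s e = trans (∙-cong (sym p) (sym q)) (trans e (∙-cong r s))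

    ⇄-via : ∀ {a b x y} → a ≈ x → b ≈ y → x ⇄ y → a ⇄ b
    ⇄-via p q = ⇄-cong (sym p) (sym q)

    column-⇄ : ∀ {i m j p r} → i < m → m < j → j ≤ n → D i j p → D m j r → Ê i j p ⇄ Ê m j r
    column-⇄ {zero} {suc m} {j} i<m m<j j≤n dp dr with classify {0} (<-trans i<m m<j) j≤n
    ... | isCorner = ⇄-via Ê-corner refl (Central-corner dp .with-in i<m m<j dr)
    ... | isPosition (position a<n i<j _ (inj₂ j≤a)) = ⇄-via (Ê-position pos) refl
      (E-comm pos (position a<n m<j j≤n (inj₂ j≤a)) (>⇒≢ m<j) (<⇒≢ (<-trans i<m m<j)) dp dr)
      where pos = position a<n i<j j≤n (inj₂ j≤a)
    column-⇄ {suc i} {suc m} i<m m<j j≤n =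
      E-comm (lower (s≤s z≤n) (<-trans i<m m<j) j≤n) (lower (s≤s z≤n) m<j j≤n)
        (>⇒≢ m<j) (<⇒≢ (<-trans i<m m<j))

    skip-⇄ : ∀ {i m k p r} → i < m → m < k → k < n → D m k p → D i (suc k) r → Ê m k p ⇄ Ê i (suc k) r
    skip-⇄ {zero} {suc m} {k} i<m m<k k<n dp dr with m≤n⇒m<n∨m≡n (≤-pred k<n)
    ... | inj₂ ≡.refl = ⇄-via refl Ê-corner (⇄-sym (Central-corner dr .with-iN i<m m<k dp))
    ... | inj₁ k<N = ⇄-via refl (Ê-position pos)
      (E-comm (upper m<k (<⇒≤ k<N)) pos
        (>⇒≢ (<-trans i<m m<k)) (<⇒≢ (m≤n⇒m≤1+n m<k)) dp dr)
      where pos = upper {0} (s≤s z≤n) k<N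
    skip-⇄ {suc i} {suc m} i<m m<k k<n =
      E-comm (lower (s≤s z≤n) m<k (<⇒≤ k<n)) (lower (s≤s z≤n) (m≤n⇒m≤1+n (<-trans i<m m<k)) k<n)
        (>⇒≢ (<-trans i<m m<k)) (<⇒≢ (m≤n⇒m≤1+n m<k))

    far-⇄ : ∀ {i j k p r} → i < j → j < k → k < n → D i j p → D k (suc k) r → Ê i j p ⇄ Ê k (suc k) r
    far-⇄ {i} {j} {k} i<j j<k k<n dp dr = ⇄-via (Ê-position pos) (Ê-position pos′)
      (E-comm pos pos′ (<⇒≢ j<k) (<⇒≢ (m≤n⇒m≤1+n (<-trans i<j j<k))) dp dr)
      where
      j<n = <-trans j<k k<n
      pos : Position n j i j
      -- `K_j` contains both factors: `j` is the last index of its first block, and `k > j` lies in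
      -- the second.
      pos = position j<n i<j (<⇒≤ j<n) (inj₂ ≤-refl)
      pos′ : Position n j k (suc k)
      pos′ = position j<n ≤-refl k<n (inj₁ j<k)

    mul′ : ∀ {i k p r} → i < k → k < n → D i k p → D k (suc k) r →
           Ê i k p ∙ Ê k (suc k) r ≈ Ê i (suc k) (p P.* r) ∙ (Ê k (suc k) r ∙ Ê i k p)
    mul′ {zero} {suc k} i<k k<n dp dr with m≤n⇒m<n∨m≡n (≤-pred k<n)
    ... | inj₂ ≡.refl = ∙-cong₃ (sym e₀) refl (sym Ê-corner) (∙-congˡ (sym e₀)) (E-mul-corner dp dr)
      where e₀ = Ê-position (upper {0} {N} (s≤s z≤n) ≤-refl)
    ... | inj₁ k<N = ∙-cong₃ (sym e₀) refl (sym e₁) (∙-congˡ (sym e₀))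
      (E-mul (upper (s≤s z≤n) (<⇒≤ k<N)) (upper ≤-refl k<N) dp dr)
      where
      e₀ = Ê-position (upper {0} {suc k} (s≤s z≤n) (<⇒≤ k<N))
      e₁ = Ê-position (upper {0} {suc (suc k)} (s≤s z≤n) k<N)
    mul′ {suc i} {suc k} i<k k<n =
      E-mul (lower (s≤s z≤n) i<k (<⇒≤ k<n)) (lower (s≤s z≤n) ≤-refl k<n)

  collection : CollectionRelations monoid P n
  collection = record
    { Ê        = Ê
    ; Ê-cong   = cong′
    ; Ê-0#     = zero′
    ; Ê-add    = add′
    ; Ê-column = column-⇄
    ; Ê-skip   = skip-⇄
    ; Ê-far    = far-⇄
    ; Ê-mul    = λ i<k k<n dp dr → trans (mul′ i<k k<n dp dr) (trans (sym (assoc _ _ _))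
        (trans (∙-congʳ (column-⇄ i<k ≤-refl k<n (P.D-* dp dr) dr)) (assoc _ _ _)))
    }
    where
    cong′ : ∀ {i j p r} → i < j → j ≤ n → D i j p → p P.≈ r → Ê i j p ≈ Ê i j r
    cong′ i<j j≤n dp e with classify i<j j≤n
    ... | isCorner       = trans Ê-corner (trans (corner-cong dp e) (sym Ê-corner))
    ... | isPosition pos = trans (Ê-position pos) (trans (E-cong pos dp e) (sym (Ê-position pos)))

    zero′ : ∀ {i j} → i < j → j ≤ n → Ê i j P.0# ≈ ε
    zero′ i<j j≤n with classify i<j j≤n
    ... | isCorner       = trans Ê-corner (corner-0# P.D-0# P.refl)
    ... | isPosition pos = trans (Ê-position pos) (E-0# pos)

    add′ : ∀ {i j p r} → i < j → j ≤ n → D i j p → D i j r → Ê i j p ∙ Ê i j r ≈ Ê i j (p P.+ r)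
    add′ i<j j≤n dp dr with classify i<j j≤n
    ... | isCorner       = trans (∙-cong Ê-corner Ê-corner) (trans (corner-+ dp dr) (sym Ê-corner))
    ... | isPosition pos = trans (∙-cong (Ê-position pos) (Ê-position pos))
                             (trans (E-add pos dp dr) (sym (Ê-position pos)))

-- The polynomial ring as a filtered ring.

-- Equality in polynomial and matrix rings is a function type, from which Agda cannot
-- recover the two sides; as a record type it determines them.
record Wrapped {a r} {A : Set a} (_~_ : A → A → Set r) (x y : A) : Set r where
  constructor wrap
  field unwrap : x ~ y

open Wrapped public

module _ {c ℓ} (R : CommutativeRing c ℓ) where
  private module R = CommutativeRing R

  -- The identity map is a monomorphism from the wrapped structure to the original one, and the ring
  -- axioms are transported along it.
  wrappedRing : CommutativeRing c ℓ
  wrappedRing = record { isCommutativeRing = isCommutativeRing R.isCommutativeRing }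
    where
    wrappedRawRing : RawRing c ℓ
    wrappedRawRing = record { RawRing R.rawRing; _≈_ = Wrapped R._≈_ }
    unwrap-monomorphism : IsRingMonomorphism wrappedRawRing R.rawRing (λ x → x)
    unwrap-monomorphism = record
      { isRingHomomorphism = record
        { isSemiringHomomorphism = record
          { isNearSemiringHomomorphism = record
            { +-isMonoidHomomorphism = record
              { isMagmaHomomorphism = record
                { isRelHomomorphism = record { cong = unwrap } ; homo = λ _ _ → R.refl }
              ; ε-homo = R.refl
              }
            ; *-homo = λ _ _ → R.refl
            }
          ; 1#-homo = R.refl
          }
        ; -‿homo = λ _ → R.refl
        }
      ; injective = wrap
      }
    open import Algebra.Morphism.RingMonomorphism unwrap-monomorphism using (isCommutativeRing)

module PolynomialProperties (R : CommutativeRing 0ℓ 0ℓ) where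
  private
    module R = CommutativeRing R
    open R using () renaming (-_ to neg)
  open Polynomial R using (Poly; coeff; _≈_; _+_; _*_; rawSemiring)
  open import Algebra.Properties.Ring R.ring using (-0#≈0#)
  open import Algebra.Properties.CommutativeSemigroup R.+-commutativeSemigroup using (interchange)
  open import Algebra.Properties.CommutativeSemigroup R.*-commutativeSemigroup using (x∙yz≈y∙xz)

  private
    Seq : Set
    Seq = ℕ → R.Carrier

    infix 4 _≐_
    _≐_ : Seq → Seq → Set
    f ≐ g = ∀ k → f k R.≈ g k

    shift : Seq → Seq
    shift f zero    = R.0#
    shift f (suc k) = f k

    shift-cong : ∀ {f g} → f ≐ g → shift f ≐ shift g
    shift-cong f≐g zero    = R.refl
    shift-cong f≐g (suc k) = f≐g k

    shift-+ : ∀ f g → shift (λ k → f k R.+ g k) ≐ λ k → shift f k R.+ shift g k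
    shift-+ f g zero    = R.sym (R.+-identityˡ _)
    shift-+ f g (suc k) = R.refl

    shift-scale : ∀ a f → shift (λ k → a R.* f k) ≐ λ k → a R.* shift f k
    shift-scale a f zero    = R.sym (R.zeroʳ _)
    shift-scale a f (suc k) = R.refl

    shift-0 : shift (λ _ → R.0#) ≐ λ _ → R.0#
    shift-0 zero    = R.refl
    shift-0 (suc k) = R.refl

    -- Multiplication by `p` as a linear operator on arbitrary coefficient sequences. The ring laws
    -- become properties of these operators; associativity, for instance, says that the operator of
    -- a product is a composite.
    conv : Poly → Seq → Seq
    conv []      g k = R.0#
    conv (a ∷ p) g k = a R.* g k R.+ shift (conv p g) k

  coeff-+ : ∀ p q k → coeff (p + q) k R.≈ coeff p k R.+ coeff q k
  coeff-+ []      q       k       = R.sym (R.+-identityˡ _)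
  coeff-+ (a ∷ p) []      k       = R.sym (R.+-identityʳ _)
  coeff-+ (a ∷ p) (b ∷ q) zero    = R.refl
  coeff-+ (a ∷ p) (b ∷ q) (suc k) = coeff-+ p q k

  private
    coeff-scale : ∀ a q k → coeff (map (a R.*_) q) k R.≈ a R.* coeff q k
    coeff-scale a []      k       = R.sym (R.zeroʳ a)
    coeff-scale a (b ∷ q) zero    = R.refl
    coeff-scale a (b ∷ q) (suc k) = coeff-scale a q k

    coeff-0∷ : ∀ p → coeff (R.0# ∷ p) ≐ shift (coeff p)
    coeff-0∷ p zero    = R.refl
    coeff-0∷ p (suc k) = R.refl

    coeff-* : ∀ p q → coeff (p * q) ≐ conv p (coeff q)
    coeff-* []      q k = R.refl
    coeff-* (a ∷ p) q k = R.trans (coeff-+ (map (a R.*_) q) (R.0# ∷ p * q) k)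
      (R.+-cong (coeff-scale a q k) (R.trans (coeff-0∷ (p * q) k) (shift-cong (coeff-* p q) k)))

    conv-cong : ∀ p {f g} → f ≐ g → conv p f ≐ conv p g
    conv-cong []      f≐g k = R.refl
    conv-cong (a ∷ p) f≐g k = R.+-cong (R.*-congˡ (f≐g k)) (shift-cong (conv-cong p f≐g) k)

    conv-0 : ∀ p → conv p (λ _ → R.0#) ≐ λ _ → R.0#
    conv-0 []      k = R.refl
    conv-0 (a ∷ p) k = R.trans
      (R.+-cong (R.zeroʳ a) (R.trans (shift-cong (conv-0 p) k) (shift-0 k))) (R.+-identityˡ _)

    conv-+ʳ : ∀ p f g → conv p (λ k → f k R.+ g k) ≐ λ k → conv p f k R.+ conv p g k
    conv-+ʳ []      f g k = R.sym (R.+-identityˡ _)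
    conv-+ʳ (a ∷ p) f g k = R.trans
      (R.+-cong (R.distribˡ a _ _) (R.trans (shift-cong (conv-+ʳ p f g) k) (shift-+ (conv p f) (conv p g) k)))
      (interchange _ _ _ _)

    conv-+ˡ : ∀ p q g → conv (p + q) g ≐ λ k → conv p g k R.+ conv q g k
    conv-+ˡ []      q       g k = R.sym (R.+-identityˡ _)
    conv-+ˡ (a ∷ p) []      g k = R.sym (R.+-identityʳ _)
    conv-+ˡ (a ∷ p) (b ∷ q) g k = R.trans
      (R.+-cong (R.distribʳ _ a b) (R.trans (shift-cong (conv-+ˡ p q g) k) (shift-+ (conv p g) (conv q g) k)))
      (interchange _ _ _ _)

    conv-scaleʳ : ∀ p a g → conv p (λ k → a R.* g k) ≐ λ k → a R.* conv p g k
    conv-scaleʳ []      a g k = R.sym (R.zeroʳ a)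
    conv-scaleʳ (b ∷ p) a g k = R.trans
      (R.+-cong (x∙yz≈y∙xz b a _)
                (R.trans (shift-cong (conv-scaleʳ p a g) k) (shift-scale a (conv p g) k)))
      (R.sym (R.distribˡ a _ _))

    conv-scaleˡ : ∀ a p g → conv (map (a R.*_) p) g ≐ λ k → a R.* conv p g k
    conv-scaleˡ a []      g k = R.sym (R.zeroʳ a)
    conv-scaleˡ a (b ∷ p) g k = R.trans
      (R.+-cong (R.*-assoc a b _)
                (R.trans (shift-cong (conv-scaleˡ a p g) k) (shift-scale a (conv p g) k)))
      (R.sym (R.distribˡ a _ _))

    conv-shift : ∀ p g → conv p (shift g) ≐ shift (conv p g)
    conv-shift []      g zero    = R.refl
    conv-shift []      g (suc k) = R.refl
    conv-shift (a ∷ p) g zero    = R.trans (R.+-identityʳ _) (R.zeroʳ a)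
    conv-shift (a ∷ p) g (suc k) = R.+-congˡ (conv-shift p g k)

    conv-1 : ∀ p → conv p (coeff (R.1# ∷ [])) ≐ coeff p
    conv-1 []      k       = R.refl
    conv-1 (a ∷ p) zero    = R.trans (R.+-identityʳ _) (R.*-identityʳ a)
    conv-1 (a ∷ p) (suc k) = R.trans (R.+-cong (R.zeroʳ a) (conv-1 p k)) (R.+-identityˡ _)

    coeff-∷ : ∀ a p → coeff (a ∷ p) ≐ λ k → a R.* coeff (R.1# ∷ []) k R.+ shift (coeff p) k
    coeff-∷ a p zero    = R.sym (R.trans (R.+-identityʳ _) (R.*-identityʳ a))
    coeff-∷ a p (suc k) = R.sym (R.trans (R.+-congʳ (R.zeroʳ a)) (R.+-identityˡ _))

    -- `conv q` is linear and commutes with `shift`, so on the coefficients of `a + t p` it yields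
    -- `a q` plus the shift of the product of `q` and `p`, which is the recursion that defines the
    -- other side.
    conv-comm : ∀ p q → conv p (coeff q) ≐ conv q (coeff p)
    conv-comm []      q k = R.sym (conv-0 q k)
    conv-comm (a ∷ p) q k = R.sym (R.trans (conv-cong q (coeff-∷ a p) k)
      (R.trans (conv-+ʳ q _ _ k)
        (R.+-cong (R.trans (conv-scaleʳ q a _ k) (R.*-congˡ (conv-1 q k)))
                  (R.trans (conv-shift q (coeff p) k) (shift-cong (λ k → R.sym (conv-comm p q k)) k)))))

    conv-assoc : ∀ p q g → conv (p * q) g ≐ conv p (conv q g)
    conv-assoc []      q g k = R.refl
    conv-assoc (a ∷ p) q g k = R.trans (conv-+ˡ (map (a R.*_) q) (R.0# ∷ p * q) g k)
      (R.+-cong (conv-scaleˡ a q g k)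
        (R.trans (R.+-congʳ (R.zeroˡ _)) (R.trans (R.+-identityˡ _) (shift-cong (conv-assoc p q g) k))))

    *-congˡ : ∀ p {q r} → q ≈ r → p * q ≈ p * r
    *-congˡ p {q} {r} q≈r k =
      R.trans (coeff-* p q k) (R.trans (conv-cong p q≈r k) (R.sym (coeff-* p r k)))

    *-comm : ∀ p q → p * q ≈ q * p
    *-comm p q k = R.trans (coeff-* p q k) (R.trans (conv-comm p q k) (R.sym (coeff-* q p k)))

  -_ : Poly → Poly
  -_ = map neg

  coeff-neg : ∀ p k → coeff (- p) k R.≈ neg (coeff p k)
  coeff-neg []      k       = R.sym -0#≈0#
  coeff-neg (a ∷ p) zero    = R.refl
  coeff-neg (a ∷ p) (suc k) = coeff-neg p k

  private
    +-cong : ∀ {p p′ q q′} → p ≈ p′ → q ≈ q′ → p + q ≈ p′ + q′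
    +-cong {p} {p′} {q} {q′} e f k =
      R.trans (coeff-+ p q k) (R.trans (R.+-cong (e k) (f k)) (R.sym (coeff-+ p′ q′ k)))

    *-cong : ∀ {p p′ q q′} → p ≈ p′ → q ≈ q′ → p * q ≈ p′ * q′
    -- The recursion on the left list does not respect trailing zeros by itself, so congruence in
    -- that argument is obtained through commutativity.
    *-cong {p} {p′} {q} {q′} e f k = R.trans (*-congˡ p f k) (R.trans (*-comm p q′ k)
      (R.trans (*-congˡ q′ e k) (*-comm q′ p′ k)))

    +-comm : ∀ p q → p + q ≈ q + p
    +-comm p q k = R.trans (coeff-+ p q k) (R.trans (R.+-comm _ _) (R.sym (coeff-+ q p k)))

    +-identityˡ : ∀ p → [] + p ≈ p
    +-identityˡ p k = R.refl

    +-assoc : ∀ p q r → p + q + r ≈ p + (q + r)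
    +-assoc p q r k = R.trans (coeff-+ (p + q) r k) (R.trans (R.+-congʳ (coeff-+ p q k))
      (R.trans (R.+-assoc _ _ _) (R.sym (R.trans (coeff-+ p (q + r) k) (R.+-congˡ (coeff-+ q r k))))))

    inverseˡ : ∀ p → - p + p ≈ []
    inverseˡ p k = R.trans (coeff-+ (- p) p k) (R.trans (R.+-congʳ (coeff-neg p k)) (R.-‿inverseˡ _))

    *-assoc : ∀ p q r → p * q * r ≈ p * (q * r)
    *-assoc p q r k = R.trans (coeff-* (p * q) r k) (R.trans (conv-assoc p q (coeff r) k)
      (R.sym (R.trans (coeff-* p (q * r) k) (conv-cong p (coeff-* q r) k))))

    *-identityʳ : ∀ p → p * (R.1# ∷ []) ≈ p
    *-identityʳ p k = R.trans (coeff-* p (R.1# ∷ []) k) (conv-1 p k)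

    distribˡ : ∀ p q r → p * (q + r) ≈ p * q + p * r
    distribˡ p q r k = R.trans (coeff-* p (q + r) k) (R.trans (conv-cong p (coeff-+ q r) k)
      (R.trans (conv-+ʳ p (coeff q) (coeff r) k)
        (R.sym (R.trans (coeff-+ (p * q) (p * r) k) (R.+-cong (coeff-* p q k) (coeff-* p r k))))))

    distribʳ : ∀ r p q → (p + q) * r ≈ p * r + q * r
    distribʳ r p q k = R.trans (coeff-* (p + q) r k) (R.trans (conv-+ˡ p q (coeff r) k)
      (R.sym (R.trans (coeff-+ (p * r) (q * r) k) (R.+-cong (coeff-* p r k) (coeff-* q r k)))))

  commutativeRing : CommutativeRing 0ℓ 0ℓ
  commutativeRing = record
    { Carrier = Poly ; _≈_ = _≈_ ; _+_ = _+_ ; _*_ = _*_ ; -_ = -_ ; 0# = [] ; 1# = R.1# ∷ []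
    ; isCommutativeRing = record
      { isRing = record
        { +-isAbelianGroup = record
          { isGroup = record
            { isMonoid = record
              { isSemigroup = record
                { isMagma = record
                  { isEquivalence = record
                    { refl  = λ k → R.refl
                    ; sym   = λ e k → R.sym (e k)
                    ; trans = λ e f k → R.trans (e k) (f k)
                    }
                  ; ∙-cong = λ {p} {p′} {q} {q′} → +-cong {p} {p′} {q} {q′}
                  }
                ; assoc = +-assoc
                }
              ; identity = +-identityˡ , λ p k → R.trans (+-comm p [] k) (+-identityˡ p k)
              }
            ; inverse = inverseˡ , λ p k → R.trans (+-comm p (- p) k) (inverseˡ p k)
            ; ⁻¹-cong = λ {p} {q} e k →
                R.trans (coeff-neg p k) (R.trans (R.-‿cong (e k)) (R.sym (coeff-neg q k)))
            }
          ; comm = +-comm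
          }
        ; *-cong = λ {p} {p′} {q} {q′} → *-cong {p} {p′} {q} {q′}
        ; *-assoc = *-assoc
        ; *-identity = (λ p k → R.trans (*-comm (R.1# ∷ []) p k) (*-identityʳ p k)) , *-identityʳ
        ; distrib = distribˡ , distribʳ
        }
      ; *-comm = *-comm
      }
    }

  -- The bound is written additively to avoid truncated subtraction: for `j < i` it includes
  -- `m = 0`, so that all coefficients vanish.
  record D (i j : ℕ) (p : Poly) : Set where
    constructor bounded
    field coeff≈0 : ∀ m → j < i ℕ.+ m → coeff p m R.≈ R.0#

  open D public

  t : Poly
  t = R.0# ∷ R.1# ∷ []

  hd tl : Poly → Poly
  hd p = coeff p 0 ∷ []
  tl = drop 1

  private
    coeff-tl : ∀ p k → coeff (tl p) k R.≈ coeff p (suc k)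
    coeff-tl []      k = R.refl
    coeff-tl (a ∷ p) k = R.refl

    coeff-t* : ∀ p → coeff (t * p) ≐ shift (coeff p)
    coeff-t* p k = R.trans (coeff-* t p k) (R.trans (R.+-congʳ (R.zeroˡ _)) (R.trans (R.+-identityˡ _)
      (shift-cong (λ k → R.trans (R.+-cong (R.*-identityˡ _) (shift-0 k)) (R.+-identityʳ _)) k)))

    -- For the leading summand either `i ≤ j`, and then `k < i + m ≤ j + m` makes `g m` vanish, or
    -- `j < i`, and then the constant term `a` vanishes. The tail of `p` satisfies the bound with
    -- `i` raised by one, which compensates the shift.
    D-conv : ∀ i j {k} p {g} → (∀ m → j < i ℕ.+ m → coeff p m R.≈ R.0#) → (∀ m → k < j ℕ.+ m → g m R.≈ R.0#) →
             ∀ m → k < i ℕ.+ m → conv p g m R.≈ R.0#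
    D-conv i j {k} []      dp dg m k<i+m = R.refl
    D-conv i j {k} (a ∷ p) {g} dp dg m k<i+m = R.trans (R.+-cong head (tail m k<i+m)) (R.+-identityˡ _)
      where
      head : a R.* g m R.≈ R.0#
      head with ≤-<-connex i j
      ... | inj₁ i≤j = R.trans (R.*-congˡ (dg m (<-≤-trans k<i+m (ℕ.+-monoˡ-≤ m i≤j)))) (R.zeroʳ a)
      ... | inj₂ j<i =
        R.trans (R.*-congʳ (dp 0 (≡.subst (j <_) (≡.sym (ℕ.+-identityʳ i)) j<i))) (R.zeroˡ _)
      tail : ∀ m → k < i ℕ.+ m → shift (conv p g) m R.≈ R.0#
      tail zero    _ = R.refl
      tail (suc m) l = D-conv (suc i) j p (λ m′ l → dp (suc m′) (≡.subst (j <_) (≡.sym (ℕ.+-suc i m′)) l))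
                         dg m (≡.subst (k <_) (ℕ.+-suc i m) l)

    split : ∀ p → p ≈ hd p + t * tl p
    split p k = R.sym (R.trans (coeff-+ (hd p) (t * tl p) k) (R.trans (R.+-congˡ (coeff-t* (tl p) k)) (eq k)))
      where
      eq : ∀ k → coeff (hd p) k R.+ shift (coeff (tl p)) k R.≈ coeff p k
      eq zero    = R.+-identityʳ _
      eq (suc k) = R.trans (R.+-identityˡ _) (coeff-tl p k)

  filteredRing : FilteredRing 0ℓ 0ℓ 0ℓ
  filteredRing = record
    { commutativeRing = wrappedRing commutativeRing
    ; D         = D
    ; D-resp    = λ e dp → bounded λ m l → R.trans (R.sym (unwrap e m)) (coeff≈0 dp m l)
    ; D-weaken  = λ i′≤i j≤j′ dp → bounded λ m l →
                    coeff≈0 dp m (≤-<-trans j≤j′ (<-≤-trans l (ℕ.+-monoˡ-≤ m i′≤i)))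
    ; D-shift   = λ dp → bounded λ m l → coeff≈0 dp m (≤-pred l)
    ; D-unshift = λ dp → bounded λ m l → coeff≈0 dp m (s≤s l)
    ; D-0#      = bounded λ m l → R.refl
    ; D⇒≈0#     = λ {i} j<i dp → wrap λ m → coeff≈0 dp m (<-≤-trans j<i (ℕ.m≤m+n i m))
    ; D-1#      = λ {i} → bounded
                    λ { zero l → contradiction (≡.subst (i <_) (ℕ.+-identityʳ i) l) (<-irrefl ≡.refl)
                      ; (suc m) l → R.refl }
    ; D-+       = λ {i} {j} {p} {r} dp dr → bounded λ m l →
                    R.trans (coeff-+ p r m) (R.trans (R.+-cong (coeff≈0 dp m l) (coeff≈0 dr m l)) (R.+-identityˡ _))
    ; D-neg     = λ {i} {j} {p} dp → bounded λ m l →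
                    R.trans (coeff-neg p m) (R.trans (R.-‿cong (coeff≈0 dp m l)) -0#≈0#)
    ; D-*       = λ {i} {j} {k} {p} {r} dp dr → bounded λ m l →
                    R.trans (coeff-* p r m) (D-conv i j p (coeff≈0 dp) (coeff≈0 dr) m l)
    ; t         = t
    ; D-t       = λ {i} → bounded
                    λ { zero l → R.refl
                      ; (suc zero) l → contradiction (≡.subst (suc i <_) (ℕ.+-comm i 1) l) (<-irrefl ≡.refl)
                      ; (suc (suc m)) l → R.refl }
    ; hd        = hd
    ; tl        = tl
    ; hd-tl     = λ p → wrap (split p)
    ; D-hd      = λ {i} → bounded
                    λ { zero l → contradiction (≡.subst (i <_) (ℕ.+-identityʳ i) l) (<-irrefl ≡.refl)
                      ; (suc m) l → R.refl }
    ; D-tl      = λ {i} {j} {p} dp → bounded λ m l →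
                    R.trans (coeff-tl p m) (coeff≈0 dp (suc m) (≡.subst (suc j <_) (≡.sym (ℕ.+-suc i m)) (s≤s l)))
    ; hd-cong   = λ e → wrap λ { zero → unwrap e 0 ; (suc k) → R.refl }
    ; tl-cong   = λ {p} {r} e → wrap λ k → R.trans (coeff-tl p k) (R.trans (unwrap e (suc k)) (R.sym (coeff-tl r k)))
    ; hd-+      = λ p r → wrap λ { zero → coeff-+ p r 0 ; (suc k) → R.refl }
    ; tl-+      = λ p r → wrap λ k → R.trans (coeff-tl (p + r) k) (R.trans (coeff-+ p r (suc k))
                    (R.sym (R.trans (coeff-+ (tl p) (tl r) k) (R.+-cong (coeff-tl p k) (coeff-tl r k)))))
    ; hd-t*     = λ p → wrap λ { zero → coeff-t* p 0 ; (suc k) → R.refl }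
    ; tl-t*     = λ p → wrap λ k → R.trans (coeff-tl (t * p) k) (coeff-t* p (suc k))
    }

  module _ (_≟_ : ∀ a b → Dec (a R.≈ b)) where

    _≈?_ : ∀ p q → Dec (p ≈ q)
    []      ≈? []      = yes λ _ → R.refl
    []      ≈? (b ∷ q) with R.0# ≟ b | [] ≈? q
    ... | yes e | yes f = yes λ { zero → e ; (suc k) → f k }
    ... | no ¬e | _     = no λ h → ¬e (h 0)
    ... | _     | no ¬f = no λ h → ¬f (λ k → h (suc k))
    (a ∷ p) ≈? []      with a ≟ R.0# | p ≈? []
    ... | yes e | yes f = yes λ { zero → e ; (suc k) → f k }
    ... | no ¬e | _     = no λ h → ¬e (h 0)
    ... | _     | no ¬f = no λ h → ¬f (λ k → h (suc k))
    (a ∷ p) ≈? (b ∷ q) with a ≟ b | p ≈? q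
    ... | yes e | yes f = yes λ { zero → e ; (suc k) → f k }
    ... | no ¬e | _     = no λ h → ¬e (h 0)
    ... | _     | no ¬f = no λ h → ¬f (λ k → h (suc k))

    D? : ∀ i j p → Dec (D i j p)
    D? i j []      = yes (bounded λ _ _ → R.refl)
    D? i j (a ∷ p) with D? (suc i) j p | a ≟ R.0# | i ℕ.≤? j
    ... | no ¬d | _     | _      = no λ d → ¬d (bounded λ m l →
                                     coeff≈0 d (suc m) (≡.subst (j <_) (≡.sym (ℕ.+-suc i m)) l))
    ... | yes d | yes e | _      = yes (bounded λ
      { zero l → e
      ; (suc m) l → coeff≈0 d m (≡.subst (j <_) (ℕ.+-suc i m) l) })
    ... | yes d | no ¬e | no i≰j = no λ d → ¬e (coeff≈0 d 0
                                     (≡.subst (j <_) (≡.sym (ℕ.+-identityʳ i)) (≰⇒> i≰j)))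
    ... | yes d | no ¬e | yes i≤j = yes (bounded λ
      { zero l → contradiction (≡.subst (j <_) (ℕ.+-identityʳ i) l) (≤⇒≯ i≤j)
      ; (suc m) l → coeff≈0 d m (≡.subst (j <_) (ℕ.+-suc i m) l) })

-- Unitriangular matrices and column operations.

-- Bridges the arithmetic on natural indices to the finite indices of matrices; values beyond `n`
-- are sent to the last index.
clamp : ∀ n → ℕ → Fin (suc n)
clamp n       zero    = zero
clamp zero    (suc i) = zero
clamp (suc n) (suc i) = suc (clamp n i)

toℕ-clamp : ∀ {n i} → i ≤ n → toℕ (clamp n i) ≡ i
toℕ-clamp z≤n     = ≡.refl
toℕ-clamp (s≤s l) = ≡.cong suc (toℕ-clamp l)

clamp-toℕ : ∀ {n} (i : Fin (suc n)) → clamp n (toℕ i) ≡ i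
clamp-toℕ         zero    = ≡.refl
clamp-toℕ {suc n} (suc i) = ≡.cong suc (clamp-toℕ i)

clamp-injective : ∀ {n i j} → i ≤ n → j ≤ n → clamp n i ≡ clamp n j → i ≡ j
clamp-injective i≤n j≤n e = ≡.trans (≡.sym (toℕ-clamp i≤n)) (≡.trans (≡.cong toℕ e) (toℕ-clamp j≤n))

module MatrixProperties {c ℓ d} (P : FilteredRing c ℓ d) (n : ℕ) where
  private
    module P = FilteredRing P
  open P using (Carrier; _+_; 0#; 1#; D)
  open Matrix (CommutativeSemiring.rawSemiring P.commutativeSemiring) (suc n)
    using (Mat; _*_; 1ᴹ; e)

  infix 4 _≈_

  record _≈_ (A B : Mat) : Set ℓ where
    constructor pointwise
    field entry : ∀ i j → A i j P.≈ B i j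

  open _≈_ public

  open import Algebra.Properties.Semiring.Sum P.semiring
    using (sum; sum-cong-≋; ∑-distrib-+; ∑-comm; *-distribˡ-sum; *-distribʳ-sum; sum-replicate-zero)
  open SetoidReasoning P.setoid

  sum-δ : ∀ {m} (f : Fin m → Carrier) k → sum (λ i → if does (i ≟ᶠ k) then f i else 0#) P.≈ f k
  sum-δ {suc m} f zero    = P.trans (P.+-congˡ (sum-replicate-zero m)) (P.+-identityʳ _)
  sum-δ {suc m} f (suc k) = P.trans (P.+-identityˡ _) (sum-δ (λ i → f (suc i)) k)

  private
    sum-δʳ : ∀ (f : Fin (suc n) → Carrier) s → sum (λ i → f i P.* 1ᴹ i s) P.≈ f s
    sum-δʳ f s = P.trans (sum-cong-≋ term) (sum-δ f s)
      where
      term : ∀ i → f i P.* 1ᴹ i s P.≈ (if does (i ≟ᶠ s) then f i else 0#)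
      term i with does (i ≟ᶠ s)
      ... | true  = P.*-identityʳ _
      ... | false = P.zeroʳ _

    sum-δˡ : ∀ (f : Fin (suc n) → Carrier) r → sum (λ i → 1ᴹ r i P.* f i) P.≈ f r
    sum-δˡ f r = P.trans (sum-cong-≋ term) (sum-δ f r)
      where
      term : ∀ i → 1ᴹ r i P.* f i P.≈ (if does (i ≟ᶠ r) then f i else 0#)
      term i with r ≟ᶠ i | i ≟ᶠ r
      ... | yes _      | yes _  = P.*-identityˡ _
      ... | no _       | no _   = P.zeroˡ _
      ... | yes ≡.refl | no i≢i = contradiction ≡.refl i≢i
      ... | no r≢r     | yes ≡.refl = contradiction ≡.refl r≢r

    *-assoc : ∀ A B C → (A * B) * C ≈ A * (B * C)
    *-assoc A B C = pointwise λ i j → begin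
      sum (λ k → sum (λ l → A i l P.* B l k) P.* C k j)
        ≈⟨ sum-cong-≋ (λ k → *-distribʳ-sum (C k j) (λ l → A i l P.* B l k)) ⟩
      sum (λ k → sum (λ l → A i l P.* B l k P.* C k j))
        ≈⟨ ∑-comm (λ k l → A i l P.* B l k P.* C k j) ⟩
      sum (λ l → sum (λ k → A i l P.* B l k P.* C k j))
        ≈⟨ sum-cong-≋ (λ l → sum-cong-≋ (λ k → P.*-assoc (A i l) (B l k) (C k j))) ⟩
      sum (λ l → sum (λ k → A i l P.* (B l k P.* C k j)))
        ≈⟨ sum-cong-≋ (λ l → *-distribˡ-sum (A i l) (λ k → B l k P.* C k j)) ⟨
      sum (λ l → A i l P.* sum (λ k → B l k P.* C k j)) ∎

  *-monoid : Monoid c ℓ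
  *-monoid = record
    { Carrier = Mat ; _≈_ = _≈_ ; _∙_ = _*_ ; ε = 1ᴹ
    ; isMonoid = record
      { isSemigroup = record
        { isMagma = record
          { isEquivalence = record
            { refl  = pointwise λ i j → P.refl
            ; sym   = λ e → pointwise λ i j → P.sym (entry e i j)
            ; trans = λ e f → pointwise λ i j → P.trans (entry e i j) (entry f i j)
            }
          ; ∙-cong = λ e f → pointwise λ i j → sum-cong-≋ λ k → P.*-cong (entry e i k) (entry f k j)
          }
        ; assoc = *-assoc
        }
      ; identity = (λ A → pointwise λ r s → sum-δˡ (λ k → A k s) r) , (λ A → pointwise λ r s → sum-δʳ (A r) s)
      }
    }

  private module M = Monoid *-monoid

  infixl 8 _at_,_
  _at_,_ : Mat → ℕ → ℕ → Carrier
  A at i , j = A (clamp n i) (clamp n j)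

  elem : ℕ → ℕ → Carrier → Mat
  elem i j = e (clamp n i) (clamp n j)

  ≈-at : ∀ {A B} → (∀ i j → i ≤ n → j ≤ n → A at i , j P.≈ B at i , j) → A ≈ B
  ≈-at {A} {B} h = pointwise λ i j → ≡.subst₂ (λ i j → A i j P.≈ B i j) (clamp-toℕ i) (clamp-toℕ j)
    (h (toℕ i) (toℕ j) (≤-pred (toℕ<n i)) (≤-pred (toℕ<n j)))

  private
    -- The factor differs from the identity only at `(k , l)`, where the identity has `0` because
    -- `k` and `l` differ. Hence right multiplication is a column operation.
    *-e : ∀ A {k l} p → k ≢ l → ∀ r s →
          (A * e k l p) r s P.≈ A r s + (if does (s ≟ᶠ l) then A r k P.* p else 0#)
    *-e A {k} {l} p k≢l r s = begin
      sum (λ m → A r m P.* e k l p m s)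
        ≈⟨ sum-cong-≋ term ⟩
      sum (λ m → A r m P.* 1ᴹ m s + (if does (m ≟ᶠ k) then v m else 0#))
        ≈⟨ ∑-distrib-+ (λ m → A r m P.* 1ᴹ m s) (λ m → if does (m ≟ᶠ k) then v m else 0#) ⟩
      sum (λ m → A r m P.* 1ᴹ m s) + sum (λ m → if does (m ≟ᶠ k) then v m else 0#)
        ≈⟨ P.+-cong (sum-δʳ (A r) s) (sum-δ v k) ⟩
      A r s + v k ∎
      where
      v : Fin (suc n) → Carrier
      v m = if does (s ≟ᶠ l) then A r m P.* p else 0#
      term : ∀ m → A r m P.* e k l p m s P.≈ A r m P.* 1ᴹ m s + (if does (m ≟ᶠ k) then v m else 0#)
      term m with m ≟ᶠ k | s ≟ᶠ l
      ... | no _       | _          = P.sym (P.+-identityʳ _)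
      ... | yes _      | no _       = P.sym (P.+-identityʳ _)
      ... | yes ≡.refl | yes ≡.refl with m ≟ᶠ s
      ...   | yes m≡s = contradiction m≡s k≢l
      ...   | no _    = P.sym (P.trans (P.+-congʳ (P.zeroʳ _)) (P.+-identityˡ _))

  module _ {k l} (k<l : k < l) (l≤n : l ≤ n) where
    private
      k≤n = ≤-trans (<⇒≤ k<l) l≤n
      k≢l : clamp n k ≢ clamp n l
      k≢l e = <-irrefl (clamp-injective k≤n l≤n e) k<l

    *-elem-≡ : ∀ {A p} r → (A * elem k l p) at r , l P.≈ A at r , l + A at r , k P.* p
    *-elem-≡ {A} {p} r = P.trans (*-e A p k≢l (clamp n r) (clamp n l)) (P.+-congˡ eq)
      where
      eq : (if does (clamp n l ≟ᶠ clamp n l) then A at r , k P.* p else 0#) P.≈ A at r , k P.* p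
      eq with clamp n l ≟ᶠ clamp n l
      ... | yes _  = P.refl
      ... | no l≢l = contradiction ≡.refl l≢l

    *-elem-≢ : ∀ {A p} r {s} → s ≤ n → s ≢ l → (A * elem k l p) at r , s P.≈ A at r , s
    *-elem-≢ {A} {p} r {s} s≤n s≢l =
      P.trans (*-e A p k≢l (clamp n r) (clamp n s)) (P.trans (P.+-congˡ eq) (P.+-identityʳ _))
      where
      eq : (if does (clamp n s ≟ᶠ clamp n l) then A at r , k P.* p else 0#) P.≈ 0#
      eq with clamp n s ≟ᶠ clamp n l
      ... | yes e = contradiction (clamp-injective s≤n l≤n e) s≢l
      ... | no _  = P.refl

    *-elem-k : ∀ {A p} r → (A * elem k l p) at r , k P.≈ A at r , k
    *-elem-k {A} r = *-elem-≢ {A} r k≤n (<⇒≢ k<l)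

  private
    fromˡ : ∀ {A B} → (∀ C → C * A ≈ C * B) → A ≈ B
    fromˡ {A} {B} h = M.trans (M.sym (M.identityˡ A)) (M.trans (h 1ᴹ) (M.identityˡ B))

    -- With an arbitrary `X` in front, both sides become sequences of column operations on `X`,
    -- whose entries can be compared case by case; `X = 1` recovers the identity.
    fromˡ₂ : ∀ A B C → (∀ X → X * A * B ≈ X * C) → A * B ≈ C
    fromˡ₂ A B C h = fromˡ {A * B} {C} λ X → M.trans (M.sym (M.assoc X A B)) (h X)

  elem-cong : ∀ {i j p r} → p P.≈ r → elem i j p ≈ elem i j r
  elem-cong {i} {j} {p} {r} p≈r = pointwise eq
    where
    eq : ∀ k l → elem i j p k l P.≈ elem i j r k l
    eq k l with does (k ≟ᶠ clamp n i) ∧ does (l ≟ᶠ clamp n j)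
    ... | true  = p≈r
    ... | false = P.refl

  elem-injective : ∀ i j {p r} → elem i j p ≈ elem i j r → p P.≈ r
  elem-injective i j {p} {r} e =
    P.trans (P.sym (eq p)) (P.trans (entry e (clamp n i) (clamp n j)) (eq r))
    where
    eq : ∀ p → elem i j p at i , j P.≈ p
    eq p with clamp n i ≟ᶠ clamp n i | clamp n j ≟ᶠ clamp n j
    ... | yes _  | yes _  = P.refl
    ... | no i≢i | _      = contradiction ≡.refl i≢i
    ... | _      | no j≢j = contradiction ≡.refl j≢j

  elem-0# : ∀ {i j} → i < j → j ≤ n → elem i j 0# ≈ 1ᴹ
  elem-0# {i} {j} i<j j≤n = M.trans (M.sym (M.identityˡ _)) (≈-at λ r s _ s≤n → eq r s s≤n)
    where
    eq : ∀ r s → s ≤ n → (1ᴹ * elem i j 0#) at r , s P.≈ 1ᴹ at r , s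
    eq r s s≤n with s ℕ.≟ j
    ... | yes ≡.refl = P.trans (*-elem-≡ i<j j≤n {1ᴹ} r) (P.trans (P.+-congˡ (P.zeroʳ _)) (P.+-identityʳ _))
    ... | no s≢j     = *-elem-≢ i<j j≤n {1ᴹ} r s≤n s≢j

  elem-add : ∀ {i j p q} → i < j → j ≤ n → elem i j p * elem i j q ≈ elem i j (p + q)
  elem-add {i} {j} {p} {q} i<j j≤n =
    fromˡ₂ (elem i j p) (elem i j q) (elem i j (p + q)) λ X → ≈-at λ r s _ s≤n → eq X r s s≤n
    where
    eq : ∀ X r s → s ≤ n →
         (X * elem i j p * elem i j q) at r , s P.≈ (X * elem i j (p + q)) at r , s
    eq X r s s≤n with s ℕ.≟ j
    ... | no s≢j     = P.trans (*-elem-≢ i<j j≤n {X * elem i j p} r s≤n s≢j)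
                         (P.trans (*-elem-≢ i<j j≤n {X} r s≤n s≢j) (P.sym (*-elem-≢ i<j j≤n {X} r s≤n s≢j)))
    ... | yes ≡.refl = begin
      (X * elem i j p * elem i j q) at r , j
        ≈⟨ *-elem-≡ i<j j≤n {X * elem i j p} r ⟩
      (X * elem i j p) at r , j + (X * elem i j p) at r , i P.* q
        ≈⟨ P.+-cong (*-elem-≡ i<j j≤n {X} r) (P.*-congʳ (*-elem-k i<j j≤n {X} r)) ⟩
      X at r , j + X at r , i P.* p + X at r , i P.* q
        ≈⟨ P.trans (P.+-assoc _ _ _) (P.+-congˡ (P.sym (P.distribˡ _ p q))) ⟩
      X at r , j + X at r , i P.* (p + q)
        ≈⟨ *-elem-≡ i<j j≤n {X} r ⟨
      (X * elem i j (p + q)) at r , j ∎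

  elem-comm : ∀ {i j k l p q} → i < j → j ≤ n → k < l → l ≤ n → j ≢ k → i ≢ l →
              elem i j p * elem k l q ≈ elem k l q * elem i j p
  elem-comm {i} {j} {k} {l} {p} {q} i<j j≤n k<l l≤n j≢k i≢l =
    fromˡ₂ (elem i j p) (elem k l q) (elem k l q * elem i j p) λ X →
      M.trans (≈-at λ r s _ s≤n → eq X r s s≤n) (M.assoc X (elem k l q) (elem i j p))
    where
    i≤n = ≤-trans (<⇒≤ i<j) j≤n
    k≤n = ≤-trans (<⇒≤ k<l) l≤n
    eq : ∀ X r s → s ≤ n →
         (X * elem i j p * elem k l q) at r , s P.≈ (X * elem k l q * elem i j p) at r , s
    eq X r s s≤n with s ℕ.≟ j | s ℕ.≟ l
    ... | no s≢j | no s≢l = P.trans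
      (P.trans (*-elem-≢ k<l l≤n {X * elem i j p} r s≤n s≢l) (*-elem-≢ i<j j≤n {X} r s≤n s≢j))
      (P.sym (P.trans (*-elem-≢ i<j j≤n {X * elem k l q} r s≤n s≢j) (*-elem-≢ k<l l≤n {X} r s≤n s≢l)))
    ... | yes ≡.refl | no s≢l = P.trans
      (P.trans (*-elem-≢ k<l l≤n {X * elem i j p} r s≤n s≢l) (*-elem-≡ i<j j≤n {X} r))
      (P.sym (P.trans (*-elem-≡ i<j j≤n {X * elem k l q} r)
        (P.+-cong (*-elem-≢ k<l l≤n {X} r s≤n s≢l) (P.*-congʳ (*-elem-≢ k<l l≤n {X} r i≤n i≢l)))))
    ... | no s≢j | yes ≡.refl = P.trans
      (P.trans (*-elem-≡ k<l l≤n {X * elem i j p} r)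
        (P.+-cong (*-elem-≢ i<j j≤n {X} r s≤n s≢j) (P.*-congʳ (*-elem-≢ i<j j≤n {X} r k≤n (≡.≢-sym j≢k)))))
      (P.sym (P.trans (*-elem-≢ i<j j≤n {X * elem k l q} r s≤n s≢j) (*-elem-≡ k<l l≤n {X} r)))
    ... | yes ≡.refl | yes ≡.refl = P.trans
      (P.trans (*-elem-≡ k<l l≤n {X * elem i j p} r)
        (P.+-cong (*-elem-≡ i<j j≤n {X} r) (P.*-congʳ (*-elem-≢ i<j j≤n {X} r k≤n (≡.≢-sym j≢k)))))
      (P.trans (P.trans (P.+-assoc _ _ _) (P.trans (P.+-congˡ (P.+-comm _ _)) (P.sym (P.+-assoc _ _ _))))
        (P.sym (P.trans (*-elem-≡ i<j j≤n {X * elem k l q} r)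
          (P.+-cong (*-elem-≡ k<l l≤n {X} r) (P.*-congʳ (*-elem-≢ k<l l≤n {X} r i≤n i≢l))))))

  elem-mul : ∀ {i j k p q} → i < j → j < k → k ≤ n →
             elem i j p * elem j k q ≈ elem i k (p P.* q) * (elem j k q * elem i j p)
  elem-mul {i} {j} {k} {p} {q} i<j j<k k≤n =
    fromˡ₂ (elem i j p) (elem j k q) (elem i k (p P.* q) * (elem j k q * elem i j p)) λ X →
    M.trans (≈-at λ r s _ s≤n → eq X r s s≤n)
    (M.trans (M.assoc (X * elem i k (p P.* q)) (elem j k q) (elem i j p))
             (M.assoc X (elem i k (p P.* q)) (elem j k q * elem i j p)))
    where
    j≤n = ≤-trans (<⇒≤ j<k) k≤n
    i≤n = ≤-trans (<⇒≤ i<j) j≤n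
    i<k = <-trans i<j j<k
    eq : ∀ X r s → s ≤ n → (X * elem i j p * elem j k q) at r , s P.≈
         (X * elem i k (p P.* q) * elem j k q * elem i j p) at r , s
    eq X r s s≤n with s ℕ.≟ j | s ℕ.≟ k
    ... | no s≢j | no s≢k = P.trans
      (P.trans (*-elem-≢ j<k k≤n {X * elem i j p} r s≤n s≢k) (*-elem-≢ i<j j≤n {X} r s≤n s≢j))
      (P.sym (P.trans (*-elem-≢ i<j j≤n {X * elem i k (p P.* q) * elem j k q} r s≤n s≢j)
        (P.trans (*-elem-≢ j<k k≤n {X * elem i k (p P.* q)} r s≤n s≢k) (*-elem-≢ i<k k≤n {X} r s≤n s≢k))))
    ... | yes ≡.refl | yes ≡.refl = contradiction j<k (<-irrefl ≡.refl)
    ... | yes ≡.refl | no s≢k = P.trans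
      (P.trans (*-elem-≢ j<k k≤n {X * elem i j p} r s≤n s≢k) (*-elem-≡ i<j j≤n {X} r))
      (P.sym (P.trans (*-elem-≡ i<j j≤n {X * elem i k (p P.* q) * elem j k q} r)
        (P.+-cong (unchanged s≤n s≢k) (P.*-congʳ (unchanged i≤n (<⇒≢ i<k))))))
      where
      unchanged : ∀ {s} → s ≤ n → s ≢ k → (X * elem i k (p P.* q) * elem j k q) at r , s P.≈ X at r , s
      unchanged s≤n s≢k =
        P.trans (*-elem-≢ j<k k≤n {X * elem i k (p P.* q)} r s≤n s≢k) (*-elem-≢ i<k k≤n {X} r s≤n s≢k)
    ... | no s≢j | yes ≡.refl = begin
      (X * elem i j p * elem j k q) at r , k
        ≈⟨ *-elem-≡ j<k k≤n {X * elem i j p} r ⟩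
      (X * elem i j p) at r , k + (X * elem i j p) at r , j P.* q
        ≈⟨ P.+-cong (*-elem-≢ i<j j≤n {X} r s≤n s≢j) (P.*-congʳ (*-elem-≡ i<j j≤n {X} r)) ⟩
      X at r , k + (X at r , j + X at r , i P.* p) P.* q
        ≈⟨ P.+-congˡ (P.trans (P.distribʳ q _ _) (P.trans (P.+-comm _ _) (P.+-congʳ (P.*-assoc _ p q)))) ⟩
      X at r , k + (X at r , i P.* (p P.* q) + X at r , j P.* q)
        ≈⟨ P.+-assoc _ _ _ ⟨
      X at r , k + X at r , i P.* (p P.* q) + X at r , j P.* q
        ≈⟨ P.+-cong (*-elem-≡ i<k k≤n {X} r) (P.*-congʳ (*-elem-≢ i<k k≤n {X} r j≤n (<⇒≢ j<k))) ⟨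
      (X * elem i k (p P.* q)) at r , k + (X * elem i k (p P.* q)) at r , j P.* q
        ≈⟨ *-elem-≡ j<k k≤n {X * elem i k (p P.* q)} r ⟨
      (X * elem i k (p P.* q) * elem j k q) at r , k
        ≈⟨ *-elem-≢ i<j j≤n {X * elem i k (p P.* q) * elem j k q} r s≤n s≢j ⟨
      (X * elem i k (p P.* q) * elem j k q * elem i j p) at r , k ∎

  elem-inverse : ∀ {i j p q} → i < j → j ≤ n → p + q P.≈ 0# → elem i j p * elem i j q ≈ 1ᴹ
  elem-inverse i<j j≤n p+q≈0 = M.trans (elem-add i<j j≤n) (M.trans (elem-cong p+q≈0) (elem-0# i<j j≤n))

  collection : CollectionRelations *-monoid P n
  collection = record
    { Ê        = elem
    ; Ê-cong   = λ _ _ _ → elem-cong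
    ; Ê-0#     = elem-0#
    ; Ê-add    = λ i<j j≤n _ _ → elem-add i<j j≤n
    ; Ê-column = λ i<m m<j j≤n _ _ → elem-comm (<-trans i<m m<j) j≤n m<j j≤n
                   (>⇒≢ m<j) (<⇒≢ (<-trans i<m m<j))
    ; Ê-skip   = λ i<m m<k k<n _ _ → elem-comm m<k (<⇒≤ k<n) (m≤n⇒m≤1+n (<-trans i<m m<k)) k<n
                   (>⇒≢ (<-trans i<m m<k)) (<⇒≢ (m≤n⇒m≤1+n m<k))
    ; Ê-far    = λ i<j j<k k<n _ _ → elem-comm i<j (<⇒≤ (<-trans j<k k<n)) ≤-refl k<n
                   (<⇒≢ j<k) (<⇒≢ (m≤n⇒m≤1+n (<-trans i<j j<k)))
    ; Ê-mul    = λ {i} {k} {p} {r} i<k k<n _ _ → M.trans (elem-mul i<k ≤-refl k<n)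
                   (M.trans (M.sym (M.assoc (elem i (suc k) (p P.* r)) (elem k (suc k) r) (elem i k p))) (M.trans
                     (M.∙-congʳ {x = elem i k p} (elem-comm (m≤n⇒m≤1+n i<k) k<n ≤-refl k<n
                       (>⇒≢ ≤-refl) (<⇒≢ (m≤n⇒m≤1+n i<k))))
                     (M.assoc (elem k (suc k) r) (elem i (suc k) (p P.* r)) (elem i k p))))
    }

  -- `Z` marks entries that are forced to vanish: the region outside the two blocks for `K_a`, and
  -- nothing for `G`.
  record Shape {z} (Z : Fin (suc n) → Fin (suc n) → Set z) (A : Mat) : Set (ℓ ⊔ d ⊔ z) where
    field
      degree   : ∀ i j → D (toℕ i) (toℕ j) (A i j)
      diagonal : ∀ i → A i i P.≈ 1#
      vanish   : ∀ {i j} → Z i j → A i j P.≈ 0#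

  open Shape public

  ShapeInvertible : ∀ {z} → (Fin (suc n) → Fin (suc n) → Set z) → Mat → Set (c ⊔ ℓ ⊔ d ⊔ z)
  ShapeInvertible Z A = Shape Z A × ∃[ B ] Shape Z B × A * B ≈ 1ᴹ × B * A ≈ 1ᴹ

  module _ {z} {Z : Fin (suc n) → Fin (suc n) → Set z}
           (Z-irrefl : ∀ {i} → ¬ Z i i) (Z-split : ∀ {i j} → Z i j → ∀ k → Z i k ⊎ Z k j) where

    Shape-resp : ∀ {A B} → A ≈ B → Shape Z A → Shape Z B
    Shape-resp A≈B a .degree i j   = P.D-resp (entry A≈B i j) (a .degree i j)
    Shape-resp A≈B a .diagonal i   = P.trans (P.sym (entry A≈B i i)) (a .diagonal i)
    Shape-resp A≈B a .vanish {i} {j} z = P.trans (P.sym (entry A≈B i j)) (a .vanish z)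

    Shape-1ᴹ : Shape Z 1ᴹ
    Shape-1ᴹ .degree i j with i ≟ᶠ j
    ... | yes ≡.refl = P.D-1#
    ... | no _       = P.D-0#
    Shape-1ᴹ .diagonal i with i ≟ᶠ i
    ... | yes _  = P.refl
    ... | no i≢i = contradiction ≡.refl i≢i
    Shape-1ᴹ .vanish {i} {j} z with i ≟ᶠ j
    ... | yes ≡.refl = contradiction z Z-irrefl
    ... | no _       = P.refl

    Shape-e : ∀ {i j p} → toℕ i < toℕ j → D (toℕ i) (toℕ j) p → ¬ Z i j → Shape Z (e i j p)
    Shape-e {i} {j} i<j dp ¬z .degree k l with k ≟ᶠ i | l ≟ᶠ j
    ... | yes ≡.refl | yes ≡.refl = dp
    ... | yes _      | no _       = Shape-1ᴹ .degree k l
    ... | no _       | _          = Shape-1ᴹ .degree k l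
    Shape-e {i} {j} i<j dp ¬z .diagonal k with k ≟ᶠ i | k ≟ᶠ j
    ... | yes ≡.refl | yes ≡.refl = contradiction i<j (<-irrefl ≡.refl)
    ... | yes _      | no _       = Shape-1ᴹ .diagonal k
    ... | no _       | _          = Shape-1ᴹ .diagonal k
    Shape-e {i} {j} i<j dp ¬z .vanish {k} {l} z with k ≟ᶠ i | l ≟ᶠ j
    ... | yes ≡.refl | yes ≡.refl = contradiction z ¬z
    ... | yes _      | no _       = Shape-1ᴹ .vanish z
    ... | no _       | _          = Shape-1ᴹ .vanish z

    private
      sum-D : ∀ {m i j} (f : Fin m → Carrier) → (∀ k → D i j (f k)) → D i j (sum f)
      sum-D {zero}  f h = P.D-0#
      sum-D {suc m} f h = P.D-+ (h zero) (sum-D (λ k → f (suc k)) λ k → h (suc k))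

      sum-0# : ∀ {m} (f : Fin m → Carrier) → (∀ k → f k P.≈ 0#) → sum f P.≈ 0#
      sum-0# {m} f h = P.trans (sum-cong-≋ h) (sum-replicate-zero m)

    -- If `Z i j` holds, `Z-split` supplies a zero factor in every summand. On the diagonal every
    -- summand with `k` different from `i` contains an entry below the diagonal, which its degree
    -- bound forces to be zero.
    Shape-* : ∀ {A B} → Shape Z A → Shape Z B → Shape Z (A * B)
    Shape-* a b .degree i j = sum-D _ λ k → P.D-* (a .degree i k) (b .degree k j)
    Shape-* {A} {B} a b .diagonal i = P.trans (sum-cong-≋ term) (sum-δ (λ _ → 1#) i)
      where
      term : ∀ k → A i k P.* B k i P.≈ (if does (k ≟ᶠ i) then 1# else 0#)
      term k with k ≟ᶠ i
      ... | yes ≡.refl = P.trans (P.*-cong (a .diagonal k) (b .diagonal k)) (P.*-identityˡ _)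
      ... | no k≢i with ℕ.<-cmp (toℕ k) (toℕ i)
      ...   | tri< k<i _ _ = P.trans (P.*-congʳ (P.D⇒≈0# k<i (a .degree i k))) (P.zeroˡ _)
      ...   | tri≈ _ e _   = contradiction (toℕ-injective e) k≢i
      ...   | tri> _ _ i<k = P.trans (P.*-congˡ (P.D⇒≈0# i<k (b .degree k i))) (P.zeroʳ _)
    Shape-* {A} {B} a b .vanish {i} {j} z = sum-0# _ λ k → term k (Z-split z k)
      where
      term : ∀ k → Z i k ⊎ Z k j → A i k P.* B k j P.≈ 0#
      term k (inj₁ zik) = P.trans (P.*-congʳ (a .vanish zik)) (P.zeroˡ _)
      term k (inj₂ zkj) = P.trans (P.*-congˡ (b .vanish zkj)) (P.zeroʳ _)

-- Free groups and area.

module FreeGroupProperties {c ℓ} (S : Setoid c ℓ) where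
  open FreeGroup S
  private module S = Setoid S

  private
    ≋-setoid = EqClosure.setoid _↝_

    ↝-++ˡ : ∀ a {u v} → u ↝ v → a ++ u ↝ a ++ v
    ↝-++ˡ a (cancel u {x} {y} v xy) =
      ≡.subst₂ _↝_ (++-assoc a u (x ∷ y ∷ v)) (++-assoc a u v) (cancel (a ++ u) v xy)

    ↝-++ʳ : ∀ a {u v} → u ↝ v → u ++ a ↝ v ++ a
    ↝-++ʳ a (cancel u {x} {y} v xy) =
      ≡.subst₂ _↝_ (≡.sym (++-assoc u (x ∷ y ∷ v) a)) (≡.sym (++-assoc u v a)) (cancel u (v ++ a) xy)

  open Setoid ≋-setoid public using () renaming (refl to ≋-refl; sym to ≋-sym; trans to ≋-trans; reflexive to ≡⇒≋)

  ++-cong : ∀ {u u′ v v′} → u ≋ u′ → v ≋ v′ → u ++ v ≋ u′ ++ v′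
  ++-cong {u′ = u′} {v = v} p q =
    ≋-trans (EqClosure.gmap (_++ v) (↝-++ʳ v) p) (EqClosure.gmap (u′ ++_) (↝-++ˡ u′) q)

  private
    opposite-involutive : ∀ s → opposite (opposite s) ≡ s
    opposite-involutive Sign.+ = ≡.refl
    opposite-involutive Sign.- = ≡.refl

    ⁻¹-∷ : ∀ x w → (x ∷ w) ⁻¹ ≡ w ⁻¹ ++ flip x ∷ []
    ⁻¹-∷ x w = unfold-reverse (flip x) (map flip w)

    inverseʳ : ∀ w → w ++ w ⁻¹ ≋ []
    inverseʳ []      = ≋-refl
    inverseʳ (x ∷ w) = ≋-trans
      (≡⇒≋ (≡.cong (x ∷_) (≡.trans (≡.cong (w ++_) (⁻¹-∷ x w)) (≡.sym (++-assoc w (w ⁻¹) (flip x ∷ []))))))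
      (≋-trans (++-cong {x ∷ []} ≋-refl (++-cong (inverseʳ w) ≋-refl))
        (EqClosure.return (cancel [] [] (≡.refl , S.refl))))

    inverseˡ : ∀ w → w ⁻¹ ++ w ≋ []
    inverseˡ []      = ≋-refl
    inverseˡ (x ∷ w) = ≋-trans
      (≡⇒≋ (≡.trans (≡.cong (_++ x ∷ w) (⁻¹-∷ x w)) (++-assoc (w ⁻¹) (flip x ∷ []) (x ∷ w))))
      (≋-trans (++-cong {w ⁻¹} ≋-refl
        (EqClosure.return (cancel [] w (≡.sym (opposite-involutive (proj₁ x)) , S.refl)))) (inverseˡ w))

    -- Uniqueness of inverses gives this without reversing a sequence of cancellations.
    ⁻¹-cong : ∀ {u v} → u ≋ v → u ⁻¹ ≋ v ⁻¹
    ⁻¹-cong {u} {v} p = ≋-trans (≡⇒≋ (≡.sym (++-identityʳ (u ⁻¹))))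
      (≋-trans (++-cong {u ⁻¹} ≋-refl (≋-trans (≋-sym (inverseʳ v)) (++-cong (≋-sym p) ≋-refl)))
        (≋-trans (≡⇒≋ (≡.sym (++-assoc (u ⁻¹) u (v ⁻¹)))) (++-cong (inverseˡ u) ≋-refl)))

  freeGroup : Group c (c ⊔ ℓ)
  freeGroup = record
    { Carrier = Word ; _≈_ = _≋_ ; _∙_ = _++_ ; ε = [] ; _⁻¹ = _⁻¹
    ; isGroup = record
      { isMonoid = record
        { isSemigroup = record
          { isMagma = record { isEquivalence = Setoid.isEquivalence ≋-setoid ; ∙-cong = ++-cong }
          ; assoc = λ u v w → ≡⇒≋ (++-assoc u v w)
          }
        ; identity = (λ w → ≋-refl) , λ w → ≡⇒≋ (++-identityʳ w)
        }
      ; inverse = inverseˡ , inverseʳ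
      ; ⁻¹-cong = ⁻¹-cong
      }
    }

module FillingProperties {c ℓ r t} (S : Setoid c ℓ)
  (R : Pred (FreeGroup.Word S) r) (Trivial : Pred (FreeGroup.Word S) t) where
  open FreeGroup S
  open FreeGroupProperties S public
  open Filling S R Trivial
  open Conjugate
  open GroupSolver freeGroup
  private module Free = Group freeGroup

  product : List Conjugate → Word
  product cs = concat (map word cs)

  infix 4 _∼⟨_⟩_

  -- A quantitative equality in the presented group: the quotient of `u` by `v` has area at most
  -- `b`. Bounds add under transitivity and products and are kept by symmetry and inversion.
  _∼⟨_⟩_ : Word → ℕ → Word → Set (c ⊔ ℓ ⊔ r)
  u ∼⟨ b ⟩ v = Σ[ cs ∈ List Conjugate ] length cs ≤ b × u ≋ product cs ++ v

  private
    product-++ : ∀ cs ds → product (cs ++ ds) ≋ product cs ++ product ds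
    product-++ []       ds = ≋-refl
    product-++ (c ∷ cs) ds = ≋-trans (Free.∙-congˡ {word c} (product-++ cs ds)) (Free.sym (Free.assoc (word c) _ _))

    invert : Conjugate → Conjugate
    invert c = record { conjugator = conjugator c ; sign = opposite (sign c)
                      ; relator = relator c ; relator∈R = relator∈R c }

    word-invert : ∀ c → word (invert c) ≋ word c ⁻¹
    word-invert c with sign c
    ... | Sign.+ = solve 2 (λ g w → g ⊙ (w ⁻ ⊙ g ⁻) ⊜ (g ⊙ (w ⊙ g ⁻)) ⁻) ≋-refl (conjugator c) (relator c)
    ... | Sign.- = solve 2 (λ g w → g ⊙ (w ⊙ g ⁻) ⊜ (g ⊙ (w ⁻ ⊙ g ⁻)) ⁻) ≋-refl (conjugator c) (relator c)

    inverts : List Conjugate → List Conjugate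
    inverts []       = []
    inverts (c ∷ cs) = inverts cs ++ invert c ∷ []

    product-inverts : ∀ cs → product (inverts cs) ≋ product cs ⁻¹
    product-inverts []       = ≋-refl
    product-inverts (c ∷ cs) = ≋-trans (product-++ (inverts cs) (invert c ∷ []))
      (≋-trans (++-cong (product-inverts cs) (≋-trans (Free.identityʳ _) (word-invert c)))
        (solve 2 (λ x y → y ⁻ ⊙ x ⁻ ⊜ (x ⊙ y) ⁻) ≋-refl (word c) (product cs)))

    length-inverts : ∀ cs → length (inverts cs) ≡ length cs
    length-inverts []       = ≡.refl
    length-inverts (c ∷ cs) = ≡.trans (length-++ (inverts cs))
      (≡.trans (ℕ.+-comm (length (inverts cs)) 1) (≡.cong suc (length-inverts cs)))

    conjugate : Word → Conjugate → Conjugate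
    conjugate g c = record { conjugator = g ++ conjugator c ; sign = sign c
                           ; relator = relator c ; relator∈R = relator∈R c }

    word-conjugate : ∀ g c → word (conjugate g c) ≋ g ++ word c ++ g ⁻¹
    word-conjugate g c with sign c
    ... | Sign.+ = solve 3 (λ g h w → g ⊙ h ⊙ (w ⊙ (g ⊙ h) ⁻) ⊜ g ⊙ (h ⊙ (w ⊙ h ⁻) ⊙ g ⁻)) ≋-refl
                     g (conjugator c) (relator c)
    ... | Sign.- = solve 3 (λ g h w → g ⊙ h ⊙ (w ⊙ (g ⊙ h) ⁻) ⊜ g ⊙ (h ⊙ (w ⊙ h ⁻) ⊙ g ⁻)) ≋-refl
                     g (conjugator c) (relator c ⁻¹)

    product-conjugate : ∀ g cs → product (map (conjugate g) cs) ≋ g ++ product cs ++ g ⁻¹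
    product-conjugate g []       = ≋-sym (Free.inverseʳ g)
    product-conjugate g (c ∷ cs) = ≋-trans (++-cong (word-conjugate g c) (product-conjugate g cs))
      (solve 3 (λ g x y → g ⊙ (x ⊙ g ⁻) ⊙ (g ⊙ (y ⊙ g ⁻)) ⊜ g ⊙ (x ⊙ y ⊙ g ⁻)) ≋-refl
        g (word c) (product cs))

  ≋⇒∼ : ∀ {u v} → u ≋ v → u ∼⟨ 0 ⟩ v
  ≋⇒∼ p = [] , z≤n , p

  ∼-weaken : ∀ {u v b b′} → b ≤ b′ → u ∼⟨ b ⟩ v → u ∼⟨ b′ ⟩ v
  ∼-weaken b≤b′ (cs , l , p) = cs , ≤-trans l b≤b′ , p

  ∼-sym : ∀ {u v b} → u ∼⟨ b ⟩ v → v ∼⟨ b ⟩ u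
  ∼-sym {u} {v} (cs , l , p) = inverts cs , ≡.subst (_≤ _) (≡.sym (length-inverts cs)) l ,
    ≋-trans (solve 2 (λ x v → v ⊜ x ⁻ ⊙ (x ⊙ v)) ≋-refl (product cs) v)
      (++-cong (≋-sym (product-inverts cs)) (≋-sym p))

  ∼-trans : ∀ {u v w b b′} → u ∼⟨ b ⟩ v → v ∼⟨ b′ ⟩ w → u ∼⟨ b ℕ.+ b′ ⟩ w
  ∼-trans {w = w} (cs , l , p) (ds , l′ , p′) = cs ++ ds ,
    ≡.subst (_≤ _) (≡.sym (length-++ cs)) (ℕ.+-mono-≤ l l′) ,
    ≋-trans p (≋-trans (Free.∙-congˡ {product cs} p′)
      (≋-trans (Free.sym (Free.assoc (product cs) (product ds) w)) (++-cong (≋-sym (product-++ cs ds)) ≋-refl)))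

  -- The conjugates that fill the second factor are moved to the left across `u′`; this conjugates
  -- them once more but does not change their number.
  ∼-++ : ∀ {u u′ v v′ b b′} → u ∼⟨ b ⟩ u′ → v ∼⟨ b′ ⟩ v′ → u ++ v ∼⟨ b ℕ.+ b′ ⟩ u′ ++ v′
  ∼-++ {u} {u′} {v} {v′} (cs , l , p) (ds , l′ , p′) = cs ++ map (conjugate u′) ds ,
    ≡.subst (_≤ _) (≡.sym (≡.trans (length-++ cs) (≡.cong (length cs ℕ.+_) (length-map (conjugate u′) ds))))
      (ℕ.+-mono-≤ l l′) ,
    ≋-trans (++-cong p p′)
      (≋-trans (solve 4 (λ c u d v → c ⊙ u ⊙ (d ⊙ v) ⊜ c ⊙ (u ⊙ (d ⊙ u ⁻)) ⊙ (u ⊙ v)) ≋-refl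
          (product cs) u′ (product ds) v′)
        (++-cong (≋-sym (≋-trans (product-++ cs (map (conjugate u′) ds))
          (Free.∙-congˡ {product cs} (product-conjugate u′ ds)))) (≋-refl {u′ ++ v′})))

  ∼-⁻¹ : ∀ {u v b} → u ∼⟨ b ⟩ v → u ⁻¹ ∼⟨ b ⟩ v ⁻¹
  ∼-⁻¹ {u} {v} {b} p = ∼-weaken (≤-reflexive (ℕ.+-identityʳ b))
    (∼-trans {b = 0} (≋⇒∼ (solve 2 (λ u v → u ⁻ ⊜ u ⁻ ⊙ v ⊙ v ⁻) ≋-refl u v))
      (∼-trans {b′ = 0} (∼-weaken (≤-reflexive (ℕ.+-identityʳ b))
          (∼-++ {b′ = 0} (∼-++ {b = 0} (≋⇒∼ (≋-refl {u ⁻¹})) (∼-sym p)) (≋⇒∼ (≋-refl {v ⁻¹}))))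
        (≋⇒∼ (solve 2 (λ u v → u ⁻ ⊙ u ⊙ v ⁻ ⊜ v ⁻) ≋-refl u v))))

  ∼-relator : ∀ {w} → R w → w ∼⟨ 1 ⟩ []
  ∼-relator {w} r = κ ∷ [] , ≤-refl ,
    solve 1 (λ w → w ⊜ one ⊙ (w ⊙ one ⁻) ⊙ one ⊙ one) ≋-refl w
    where
    κ : Conjugate
    κ = record { conjugator = [] ; sign = Sign.+ ; relator = w ; relator∈R = r }

  ∼⇒Area≤ : ∀ {w b} → w ∼⟨ b ⟩ [] → Area≤ w b
  ∼⇒Area≤ {w} (cs , l , p) = length cs , l , Vec.fromList cs ,
    ≋-trans p (≡⇒≋ (≡.trans (++-identityʳ (product cs)) (≡.cong concat (≡.sym eq))))
    where
    eq : Vec.toList (Vec.map word (Vec.fromList cs)) ≡ map word cs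
    eq = ≡.trans (toList-map word (Vec.fromList cs)) (≡.cong (map word) (toList∘fromList cs))

-- Finite fields of odd order.

module FiniteFieldProperties {q} (F : FiniteField q) where
  open FiniteField F
  open Inverse enumeration using (to; from; to-cong; from-cong; strictlyInverseˡ; strictlyInverseʳ)
  open import Algebra.Properties.CommutativeMonoid.Sum +-commutativeMonoid
    using (sum; sum-cong-≋; sum-permute; ∑-distrib-+)
  open import Algebra.Properties.Monoid.Mult +-monoid using () renaming (_×_ to _·_)
  open import Algebra.Properties.Group +-group using (identityʳ-unique)
  open SetoidReasoning setoid

  _≟_ : ∀ x y → Dec (x ≈ y)
  x ≟ y with to x ≟ᶠ to y
  ... | yes e = yes (trans (sym (strictlyInverseʳ x)) (trans (from-cong e) (strictlyInverseʳ y)))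
  ... | no ¬e = no λ e → ¬e (to-cong e)

  -- Translation by 1 permutes F, so summing over F gives q · 1 = 0.
  q·1≈0 : q · 1# ≈ 0#
  q·1≈0 = identityʳ-unique (sum from) (q · 1#) (begin
    sum from + q · 1#               ≈⟨ +-congˡ (sum-const q) ⟨
    sum from + sum {q} (λ _ → 1#)   ≈⟨ ∑-distrib-+ from (λ _ → 1#) ⟨
    sum (λ i → from i + 1#)         ≈⟨ sum-cong-≋ (λ i → strictlyInverseʳ (from i + 1#)) ⟨
    sum (λ i → from (translate i))  ≈⟨ sum-permute from translation ⟨
    sum from                        ∎)
    where
    sum-const : ∀ m → sum {m} (λ _ → 1#) ≈ m · 1#
    sum-const zero    = refl
    sum-const (suc m) = +-congˡ (sum-const m)

    translate translate⁻¹ : Fin q → Fin q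
    translate   i = to (from i + 1#)
    translate⁻¹ i = to (from i + - 1#)

    inverse′ : ∀ {a b} → a + b ≈ 0# → ∀ i → to (from (to (from i + b)) + a) ≡ i
    inverse′ {a} {b} a+b≈0 i = ≡.trans (to-cong (begin
      from (to (from i + b)) + a   ≈⟨ +-congʳ (strictlyInverseʳ _) ⟩
      from i + b + a               ≈⟨ trans (+-assoc _ _ _) (+-congˡ (trans (+-comm b a) a+b≈0)) ⟩
      from i + 0#                  ≈⟨ +-identityʳ _ ⟩
      from i                       ∎)) (strictlyInverseˡ i)

    translation : Permutation q q
    translation = permutation translate translate⁻¹ (inverse′ (-‿inverseʳ 1#)) (inverse′ (-‿inverseˡ 1#))

  -- If `2 = 0`, a multiple of `1` depends only on the parity of the multiplier, so an odd `q` would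
  -- turn `q · 1 = 0` into `1 = 0`.
  2≉0 : ¬ (2 ∣ q) → ¬ (1# + 1# ≈ 0#)
  2≉0 2∤q 2≈0 = odd q 2∤q q·1≈0
    where
    odd : ∀ m → ¬ (2 ∣ m) → ¬ (m · 1# ≈ 0#)
    odd zero          2∤m _ = 2∤m (divides 0 ≡.refl)
    odd (suc zero)    2∤m e = 1≉0 (trans (sym (+-identityʳ 1#)) e)
    odd (suc (suc m)) 2∤m e = odd m (λ { (divides k m≡k2) → 2∤m (divides (suc k) (≡.cong (2 ℕ.+_) m≡k2)) })
      (trans (sym (+-identityˡ _)) (trans (+-congʳ (sym 2≈0)) (trans (+-assoc _ _ _) e)))

  half : ¬ (2 ∣ q) → ∃[ h ] h + h ≈ 1#
  half 2∤q with invertible (1# + 1#) (2≉0 2∤q)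
  ... | h , h*2≈1 , _ = h , trans (sym (+-cong (*-identityʳ h) (*-identityʳ h)))
    (trans (sym (distribˡ h 1# 1#)) h*2≈1)

-- The groups `G` and `K_a` as groups of matrices.

module UnipotentProperties (m : ℕ) {q} (F : FiniteField q) where
  private
    n : ℕ
    n = suc (suc m)
    module F = FiniteField F
  open UnipotentGroup n F hiding (_*_; _≈_)
  open PolynomialProperties F.commutativeRing using (bounded; coeff≈0; filteredRing; _≈?_; D?)
  open MatrixProperties filteredRing n
  open FiniteFieldProperties F using (_≟_)
  private module P = FilteredRing filteredRing
  open P using (Carrier; D; _+_; _*_; -_; 0#; 1#; t; hd; tl)
  private module M = Monoid *-monoid
  open M using (_∙_)
  open Generator

  private
    infix 4 _≈ᵁ_
    _≈ᵁ_ = UnipotentGroup._≈_ n F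

  ≈ᵁ⇒≈ : ∀ {A B} → A ≈ᵁ B → A M.≈ B
  ≈ᵁ⇒≈ e = pointwise λ i j → wrap (e i j)

  ≈⇒≈ᵁ : ∀ {A B} → A M.≈ B → A ≈ᵁ B
  ≈⇒≈ᵁ e i j = unwrap (entry e i j)

  resp′ : ∀ {x} {X : Pred Mat x} {A B} → A M.≈ B → ⟨ X ⟩ A → ⟨ X ⟩ B
  resp′ e = resp (≈⇒≈ᵁ e)

  inv′ : ∀ {x} {X : Pred Mat x} {A B} → ⟨ X ⟩ A → A ∙ B M.≈ 1ᴹ → B ∙ A M.≈ 1ᴹ → ⟨ X ⟩ B
  inv′ g AB BA = inv g (≈⇒≈ᵁ AB) (≈⇒≈ᵁ BA)

  D-linear : ∀ {i} a b → D i (suc i) (a ∷ b ∷ [])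
  D-linear {i} a b = bounded λ
    { zero          l → contradiction (<-trans (≡.subst (suc i <_) (ℕ.+-identityʳ i) l) ≤-refl)
                          (<-irrefl ≡.refl)
    ; (suc zero)    l → contradiction (≡.subst (suc i <_) (ℕ.+-comm i 1) l) (<-irrefl ≡.refl)
    ; (suc (suc k)) l → F.refl }

  D⇒linear : ∀ {i p} → D i (suc i) p → p P.≈ Polynomial.coeff F.commutativeRing p 0 ∷
                                         Polynomial.coeff F.commutativeRing p 1 ∷ []
  D⇒linear {i} dp = wrap λ
    { zero          → F.refl
    ; (suc zero)    → F.refl
    ; (suc (suc k)) → coeff≈0 dp (suc (suc k))
        (≡.subst (suc i <_) (≡.sym (≡.trans (ℕ.+-suc i (suc k)) (≡.cong suc (ℕ.+-suc i k))))
          (s≤s (s≤s (ℕ.m≤m+n i k)))) }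

  superdiagonal≡elem : ∀ j a b → superdiagonal j a b ≡ elem (toℕ j) (suc (toℕ j)) (a ∷ b ∷ [])
  superdiagonal≡elem j a b = ≡.cong₂ (λ k l → e k l (a ∷ b ∷ []))
    (≡.trans (≡.sym (clamp-toℕ (inject₁ j))) (≡.cong (clamp n) (toℕ-inject₁ j)))
    (≡.sym (clamp-toℕ (suc j)))

  -- The rectangle to the right of the first block and above the second. An upper triangular matrix
  -- that vanishes on it is block diagonal.
  Block : Fin n → Fin (suc n) → Fin (suc n) → Set
  Block a i j = toℕ i ≤ toℕ a × toℕ a < toℕ j

  Block-irrefl : ∀ {a i} → ¬ Block a i i
  Block-irrefl (i≤a , a<i) = <-irrefl ≡.refl (≤-<-trans i≤a a<i)

  Block-split : ∀ {a i j} → Block a i j → ∀ k → Block a i k ⊎ Block a k j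
  Block-split {a} (i≤a , a<j) k with ≤-<-connex (toℕ k) (toℕ a)
  ... | inj₁ k≤a = inj₂ (k≤a , a<j)
  ... | inj₂ a<k = inj₁ (i≤a , a<k)

  -- The constructor inv of ⟨_⟩ only provides some two-sided inverse; it is identified with the
  -- inverse built from the generators by uniqueness.
  module _ {z} {Z : Fin (suc n) → Fin (suc n) → Set z}
           (Z-irrefl : ∀ {i} → ¬ Z i i) (Z-split : ∀ {i j} → Z i j → ∀ k → Z i k ⊎ Z k j) where

    ⟨⟩-invertible : ∀ {x} {X : Pred Mat x} → (∀ {A} → X A → ShapeInvertible Z A) →
                    ∀ {A} → ⟨ X ⟩ A → ShapeInvertible Z A
    ⟨⟩-invertible X⇒ (gen x) = X⇒ x
    ⟨⟩-invertible X⇒ one     = Shape-1ᴹ Z-irrefl Z-split , 1ᴹ , Shape-1ᴹ Z-irrefl Z-split , M.identityˡ 1ᴹ , M.identityˡ 1ᴹ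
    ⟨⟩-invertible X⇒ (mul {A} {B} p q)
      with ⟨⟩-invertible X⇒ p | ⟨⟩-invertible X⇒ q
    ... | a , A′ , a′ , AA′ , A′A | b , B′ , b′ , BB′ , B′B =
      Shape-* Z-irrefl Z-split a b , B′ ∙ A′ , Shape-* Z-irrefl Z-split b′ a′ , inverse-∙ {A} {A′} {B} {B′} BB′ AA′ ,
      inverse-∙ {B′} {B} {A′} {A} A′A B′B
      where
      inverse-∙ : ∀ {A A′ B B′} → B ∙ B′ M.≈ 1ᴹ → A ∙ A′ M.≈ 1ᴹ → (A ∙ B) ∙ (B′ ∙ A′) M.≈ 1ᴹ
      inverse-∙ {A} {A′} {B} {B′} e f = M.trans (M.assoc A B (B′ ∙ A′))
        (M.trans (M.∙-congˡ {x = A} (M.trans (M.sym (M.assoc B B′ A′))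
          (M.trans (M.∙-congʳ {x = A′} e) (M.identityˡ A′)))) f)
    ⟨⟩-invertible X⇒ (inv {A} {B} p ABᵁ BAᵁ) with ⟨⟩-invertible X⇒ p
    ... | a , A′ , a′ , AA′ , A′A =
      Shape-resp Z-irrefl Z-split A′≈B a′ , A , a , BA , AB
      where
      AB = ≈ᵁ⇒≈ ABᵁ
      BA = ≈ᵁ⇒≈ BAᵁ
      A′≈B : A′ M.≈ B
      A′≈B = M.trans (M.sym (M.identityʳ A′)) (M.trans (M.∙-congˡ {x = A′} (M.sym AB))
        (M.trans (M.sym (M.assoc A′ A B)) (M.trans (M.∙-congʳ {x = B} A′A) (M.identityˡ B))))
    ⟨⟩-invertible X⇒ (resp {A} {B} A≈ᵁB p) with ⟨⟩-invertible X⇒ p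
    ... | a , A′ , a′ , AA′ , A′A = Shape-resp Z-irrefl Z-split A≈B a , A′ , a′ ,
      M.trans (M.∙-congʳ {x = A′} (M.sym A≈B)) AA′ , M.trans (M.∙-congˡ {x = A′} (M.sym A≈B)) A′A
      where A≈B = ≈ᵁ⇒≈ A≈ᵁB

  private
    superdiagonal-inverse : ∀ j {a b a′ b′} → a F.+ a′ F.≈ F.0# → b F.+ b′ F.≈ F.0# →
                            superdiagonal j a b ∙ superdiagonal j a′ b′ M.≈ 1ᴹ
    superdiagonal-inverse j {a} {b} {a′} {b′} ea eb =
      ≡.subst₂ (λ A B → A ∙ B M.≈ 1ᴹ)
        (≡.sym (superdiagonal≡elem j a b)) (≡.sym (superdiagonal≡elem j a′ b′))
        (elem-inverse ≤-refl (toℕ<n j) (wrap λ { zero → ea ; (suc zero) → eb ; (suc (suc k)) → F.refl }))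

    superdiagonal-shape : ∀ {z} (Z : Fin (suc n) → Fin (suc n) → Set z) → (∀ {i} → ¬ Z i i) →
      (∀ {i j} → Z i j → ∀ k → Z i k ⊎ Z k j) →
      ∀ {A} → ∃[ j ] ¬ Z (inject₁ j) (suc j) × ∃[ a ] ∃[ b ] A M.≈ superdiagonal j a b →
      ShapeInvertible Z A
    superdiagonal-shape Z irr split (j , ¬z , a , b , A≈) =
      Shape-resp irr split (M.sym A≈) (shape a b) ,
      superdiagonal j (F.- a) (F.- b) , shape (F.- a) (F.- b) ,
      M.trans (M.∙-congʳ {x = superdiagonal j (F.- a) (F.- b)} A≈)
        (superdiagonal-inverse j (F.-‿inverseʳ a) (F.-‿inverseʳ b)) ,
      M.trans (M.∙-congˡ {x = superdiagonal j (F.- a) (F.- b)} A≈)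
        (superdiagonal-inverse j (F.-‿inverseˡ a) (F.-‿inverseˡ b))
      where
      shape : ∀ a b → Shape Z (superdiagonal j a b)
      shape a b = Shape-e irr split (≡.subst (ℕ._< suc (toℕ j)) (≡.sym (toℕ-inject₁ j)) ≤-refl)
        (≡.subst (λ i → D i (suc (toℕ j)) (a ∷ b ∷ [])) (≡.sym (toℕ-inject₁ j)) (D-linear a b)) ¬z

  K-shape : ∀ {a A} → K a A → ShapeInvertible (Block a) A
  K-shape {a} = ⟨⟩-invertible Block-irrefl Block-split λ { (j , j≢a , x , y , A≈) →
    superdiagonal-shape (Block a) Block-irrefl Block-split (j , outside j≢a , x , y , ≈ᵁ⇒≈ A≈) }
    where
    outside : ∀ {j} → j ≢ a → ¬ Block a (inject₁ j) (suc j)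
    outside {j} j≢a (j≤a , a≤j) = j≢a (toℕ-injective
      (ℕ.≤-antisym (≡.subst (_≤ toℕ a) (toℕ-inject₁ j) j≤a) (≤-pred a≤j)))

  G-shape : ∀ {A} → G A → ShapeInvertible (λ _ _ → ⊥) A
  G-shape = ⟨⟩-invertible (λ ()) (λ ()) λ { (j , x , y , A≈) →
    superdiagonal-shape (λ _ _ → ⊥) (λ ()) (λ ()) (j , (λ ()) , x , y , ≈ᵁ⇒≈ A≈) }

  K⊆G : ∀ {a A} → K a A → G A
  K⊆G (gen (j , _ , x , y , A≈)) = gen (j , x , y , A≈)
  K⊆G one                        = one
  K⊆G (mul k k′)                 = mul (K⊆G k) (K⊆G k′)
  K⊆G (inv {A} {B} k p p′)       = inv {A = A} {B = B} (K⊆G k) p p′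
  K⊆G (resp {A} {B} p k)         = resp {A = A} {B = B} p (K⊆G k)

  _≈ᴹ?_ : ∀ A B → Dec (A M.≈ B)
  A ≈ᴹ? B = map′ ≈ᵁ⇒≈ ≈⇒≈ᵁ (all? λ i → all? λ j → _≈?_ _≟_ (A i j) (B i j))

  private
    elem-product : ∀ {a i j k p r} → i < j → j < k → k ≤ n →
                   (∀ p → D i j p → K a (elem i j p)) → (∀ p → D j k p → K a (elem j k p)) →
                   D i j p → D j k r → K a (elem i k (p * r))
    elem-product {i = i} {j} {k} {p} {r} i<j j<k k≤n kp kr dp dr =
      resp′ eq (mul (mul (kp p dp) (kr r dr)) (mul (kp (- p) (P.D-neg dp)) (kr (- r) (P.D-neg dr))))
      where
      x = elem i j p
      y = elem j k r
      x′ = elem i j (- p)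
      y′ = elem j k (- r)
      z = elem i k (p * r)
      yx-inverse : (y ∙ x) ∙ (x′ ∙ y′) M.≈ 1ᴹ
      yx-inverse = M.trans (M.assoc y x (x′ ∙ y′)) (M.trans
        (M.∙-congˡ {x = y} (M.trans (M.sym (M.assoc x x′ y′)) (M.trans
          (M.∙-congʳ {x = y′} (elem-inverse i<j (≤-trans (<⇒≤ j<k) k≤n) (P.-‿inverseʳ p))) (M.identityˡ y′))))
        (elem-inverse j<k k≤n (P.-‿inverseʳ r)))
      eq : (x ∙ y) ∙ (x′ ∙ y′) M.≈ z
      eq = M.trans (M.∙-congʳ {x = x′ ∙ y′} (elem-mul i<j j<k k≤n)) (M.trans (M.assoc z (y ∙ x) (x′ ∙ y′))
        (M.trans (M.∙-congˡ {x = z} yx-inverse) (M.identityʳ z)))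

  superdiagonal-K : ∀ {a} j {p} → j ≢ a → D (toℕ j) (suc (toℕ j)) p → K a (elem (toℕ j) (suc (toℕ j)) p)
  superdiagonal-K j {p} j≢a dp = gen (j , j≢a , _ , _ ,
    ≈⇒≈ᵁ (M.trans (elem-cong (D⇒linear dp)) (M.reflexive (≡.sym (superdiagonal≡elem j _ _)))))

  private
    K-superdiagonal : ∀ {a i p} → Position n (toℕ a) i (suc i) → D i (suc i) p → K a (elem i (suc i) p)
    K-superdiagonal {a} {i} {p} (position a<n i<j j<n avoid) dp =
      ≡.subst (λ k → D k (suc k) p → K a (elem k (suc k) p)) (toℕ-fromℕ< j<n)
        (superdiagonal-K (fromℕ< j<n) i≢a) dp
      where
      i≢a : fromℕ< j<n ≢ a
      i≢a e = [ (λ a<i → <-irrefl a≡i a<i)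
              , (λ i<a → <-irrefl (≡.sym a≡i) i<a) ]′ avoid
        where
        a≡i : toℕ a ≡ i
        a≡i = ≡.trans (≡.cong toℕ (≡.sym e)) (toℕ-fromℕ< j<n)

  K-elem : ∀ {a i j p} → Position n (toℕ a) i j → D i j p → K a (elem i j p)
  K-elem {a} {i} {suc j} {p} pos@(position a<n i<j j<n avoid) dp with m≤n⇒m<n∨m≡n (≤-pred i<j)
  ... | inj₂ ≡.refl = K-superdiagonal pos dp
  ... | inj₁ i<j′ =
    resp′ (M.trans (elem-add i<j j<n) (elem-cong
           (P.trans (P.+-cong (P.*-identityʳ (hd p)) (P.*-comm (tl p) t)) (P.sym (P.hd-tl p)))))
      (mul (elem-product i<j′ ≤-refl j<n kₗ kᵣ
             (P.D-weaken ≤-refl (<⇒≤ i<j′) (P.D-hd {p = p})) (P.D-weaken ≤-refl (n≤1+n _) P.D-1#))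
           (elem-product i<j′ ≤-refl j<n kₗ kᵣ (P.D-tl {p = p} dp) P.D-t))
    where
    kₗ : ∀ p → D i j p → K a (elem i j p)
    kₗ p = K-elem (position a<n i<j′ (<⇒≤ j<n)
      ([ inj₁ , (λ j<a → inj₂ (<⇒≤ j<a)) ]′ avoid))
    kᵣ : ∀ p → D j (suc j) p → K a (elem j (suc j) p)
    kᵣ p = K-superdiagonal (position a<n ≤-refl j<n ([ (λ a<i → inj₁ (<-trans a<i i<j′)) , inj₂ ]′ avoid))

  private module Collected = Collect collection

  -- σᴹ is abstract because comparing its unfolded matrix products entrywise is very slow.
  abstract
    σᴹ : (ℕ → ℕ → Carrier) → Mat
    σᴹ = Collected.σ

    σᴹ-triangle : ∀ A → σᴹ A ≡ OrderedProduct.triangle M.rawMonoid (λ i j → elem i j (A i j)) (suc n)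
    σᴹ-triangle A = ≡.refl

    σᴹ-cong : ∀ {A B} → (∀ i j → i < j → j ≤ n → D i j (A i j)) →
              (∀ i j → i < j → j ≤ n → A i j P.≈ B i j) → σᴹ A M.≈ σᴹ B
    σᴹ-cong = Collected.σ-cong

    σᴹ-0# : ∀ {A} → (∀ i j → i < j → j ≤ n → A i j P.≈ 0#) → σᴹ A M.≈ 1ᴹ
    σᴹ-0# = Collected.σ-0#

    σᴹ-step : ∀ {k r} → k < n → D k (suc k) r → ∀ {A B} → (∀ i j → i < j → j ≤ n → D i j (A i j)) →
              (∀ i j → i < j → j ≤ n → j ≢ suc k → B i j P.≈ A i j) →
              (∀ i → i < k → B i (suc k) P.≈ A i (suc k) + A i k * r) →
              B k (suc k) P.≈ A k (suc k) + r → σᴹ A ∙ elem k (suc k) r M.≈ σᴹ B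
    σᴹ-step k<n dr = Collected.σ-step k<n dr

  entries : Mat → ℕ → ℕ → Carrier
  entries A i j = A at i , j

  entries-D : ∀ {A} → G A → ∀ i j → i < j → j ≤ n → D i j (entries A i j)
  entries-D {A} g i j i<j j≤n = ≡.subst₂ (λ k l → D k l (entries A i j))
    (toℕ-clamp (≤-trans (<⇒≤ i<j) j≤n)) (toℕ-clamp j≤n)
    (proj₁ (G-shape g) .degree (clamp n i) (clamp n j))

  entries-diagonal : ∀ {A} → G A → ∀ i → entries A i i P.≈ 1#
  entries-diagonal g i = proj₁ (G-shape g) .diagonal (clamp n i)

  1ᴹ-entries : ∀ i j → i < j → j ≤ n → entries 1ᴹ i j P.≈ 0#
  1ᴹ-entries i j i<j j≤n with clamp n i ≟ᶠ clamp n j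
  ... | yes e = contradiction (clamp-injective (≤-trans (<⇒≤ i<j) j≤n) j≤n e) (<⇒≢ i<j)
  ... | no _  = P.refl

  σᴹ-entries-cong : ∀ A B → G A → A M.≈ B → σᴹ (entries A) M.≈ σᴹ (entries B)
  σᴹ-entries-cong A B g A≈B =
    σᴹ-cong {entries A} {entries B} (entries-D {A} g) λ i j _ _ → entry A≈B (clamp n i) (clamp n j)

  private
    -- Induction on the derivation of `G A` with `B` arbitrary. For an inverse, the hypothesis is
    -- used at `B ∙ A′` and read backwards.
    absorb : ∀ {A} → G A → ∀ B → G B → σᴹ (entries B) ∙ A M.≈ σᴹ (entries (B ∙ A))
    absorb (gen {A} (k , a , b , A≈)) B gB =
      M.trans (M.∙-congˡ {x = σᴹ (entries B)} A≈elem)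
        (σᴹ-step (toℕ<n k) (D-linear a b) {entries B} {entries (B ∙ A)} (entries-D {B} gB)
          (λ i j i<j j≤n j≢k → P.trans (A≈elem′ i j) (*-elem-≢ ≤-refl (toℕ<n k) {B} i j≤n j≢k))
          (λ i _ → P.trans (A≈elem′ i _) (*-elem-≡ ≤-refl (toℕ<n k) {B} i))
          (P.trans (A≈elem′ (toℕ k) _) (P.trans (*-elem-≡ ≤-refl (toℕ<n k) {B} (toℕ k))
            (P.+-congˡ {entries B (toℕ k) (suc (toℕ k))}
              (P.trans (P.*-congʳ {a ∷ b ∷ []} (entries-diagonal {B} gB (toℕ k))) (P.*-identityˡ _))))))
      where
      A≈elem : A M.≈ elem (toℕ k) (suc (toℕ k)) (a ∷ b ∷ [])
      A≈elem = M.trans (≈ᵁ⇒≈ A≈) (M.reflexive (superdiagonal≡elem k a b))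
      A≈elem′ : ∀ i j → entries (B ∙ A) i j P.≈ entries (B ∙ elem (toℕ k) (suc (toℕ k)) (a ∷ b ∷ [])) i j
      A≈elem′ i j = entry (M.∙-congˡ {x = B} A≈elem) (clamp n i) (clamp n j)
    absorb one B gB = M.trans (M.identityʳ (σᴹ (entries B)))
      (σᴹ-entries-cong B (B ∙ 1ᴹ) gB (M.sym (M.identityʳ B)))
    absorb (mul {A} {A′} g g′) B gB = M.trans (M.sym (M.assoc (σᴹ (entries B)) A A′))
      (M.trans (M.∙-congʳ {x = A′} (absorb g B gB)) (M.trans (absorb g′ (B ∙ A) (mul gB g))
        (σᴹ-entries-cong ((B ∙ A) ∙ A′) (B ∙ (A ∙ A′)) (mul (mul gB g) g′) (M.assoc B A A′))))
    absorb (inv {A} {A′} g AA′ᵁ A′Aᵁ) B gB =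
      M.trans (M.∙-congʳ {x = A′} (M.trans
          (σᴹ-entries-cong B ((B ∙ A′) ∙ A) gB (M.sym BA′A≈B))
          (M.sym (absorb g (B ∙ A′) gBA′))))
        (M.trans (M.assoc (σᴹ (entries (B ∙ A′))) A A′)
          (M.trans (M.∙-congˡ {x = σᴹ (entries (B ∙ A′))} AA′) (M.identityʳ (σᴹ (entries (B ∙ A′))))))
      where
      AA′ : A ∙ A′ M.≈ 1ᴹ
      AA′ = ≈ᵁ⇒≈ AA′ᵁ
      A′A : A′ ∙ A M.≈ 1ᴹ
      A′A = ≈ᵁ⇒≈ A′Aᵁ
      gBA′ : G (B ∙ A′)
      gBA′ = mul gB (inv {A = A} {B = A′} g AA′ᵁ A′Aᵁ)
      BA′A≈B : (B ∙ A′) ∙ A M.≈ B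
      BA′A≈B = M.trans (M.assoc B A′ A) (M.trans (M.∙-congˡ {x = B} A′A) (M.identityʳ B))
    absorb (resp {A} {A′} A≈ᵁA′ g) B gB = M.trans (M.∙-congˡ {x = σᴹ (entries B)} (M.sym A≈A′))
      (M.trans (absorb g B gB)
        (σᴹ-entries-cong (B ∙ A) (B ∙ A′) (mul gB g) (M.∙-congˡ {x = B} A≈A′)))
      where
      A≈A′ : A M.≈ A′
      A≈A′ = ≈ᵁ⇒≈ A≈ᵁA′

  -- Absorbing `A` into the empty ordered product, that of the identity, produces the ordered
  -- product of the entries of `A`.
  σᴹ-entries : ∀ A → G A → A M.≈ σᴹ (entries A)
  σᴹ-entries A gA = M.trans (M.sym (M.identityˡ A)) (M.trans
    (M.∙-congʳ {x = A} (M.sym (σᴹ-0# {entries 1ᴹ} 1ᴹ-entries)))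
    (M.trans (absorb gA 1ᴹ one) (σᴹ-entries-cong (1ᴹ ∙ A) A (mul one gA) (M.identityˡ A))))

-- Words over a single `K_a`.

module UnipotentWords (m : ℕ) {q} (F : FiniteField q) where
  private
    n : ℕ
    n = suc (suc m)
    module F = FiniteField F
  open UnipotentGroup n F hiding (_*_; _≈_)
  open PolynomialProperties F.commutativeRing using (filteredRing; D?)
  open MatrixProperties filteredRing n
  open FiniteFieldProperties F using (_≟_)
  private module P = FilteredRing filteredRing
  open P using (Carrier; D; 0#; 1#; t)
  private module M = Monoid *-monoid
  open M using (_∙_)
  open UnipotentProperties m F
  open FillingProperties S R Trivial public
  open Generator

  eval-++ : ∀ u v → eval (u ++ v) M.≈ eval u ∙ eval v
  eval-++ []      v = M.sym (M.identityˡ (eval v))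
  eval-++ (x ∷ u) v = M.trans (M.∙-congˡ {x = ⟦ x ⟧} (eval-++ u v)) (M.sym (M.assoc ⟦ x ⟧ (eval u) (eval v)))

  eval-letter : ∀ x → eval (x ∷ []) M.≈ ⟦ x ⟧
  eval-letter x = M.identityʳ ⟦ x ⟧

  ⟦⟧-inverseʳ : ∀ x → ⟦ x ⟧ ∙ ⟦ flip x ⟧ M.≈ 1ᴹ
  ⟦⟧-inverseʳ (Sign.+ , g) = ≈ᵁ⇒≈ (inverseʳ g)
  ⟦⟧-inverseʳ (Sign.- , g) = ≈ᵁ⇒≈ (inverseˡ g)

  ⟦⟧-inverseˡ : ∀ x → ⟦ flip x ⟧ ∙ ⟦ x ⟧ M.≈ 1ᴹ
  ⟦⟧-inverseˡ (Sign.+ , g) = ≈ᵁ⇒≈ (inverseˡ g)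
  ⟦⟧-inverseˡ (Sign.- , g) = ≈ᵁ⇒≈ (inverseʳ g)

  M-inverse-unique : ∀ {A B C} → A ∙ B M.≈ 1ᴹ → C ∙ A M.≈ 1ᴹ → C M.≈ B
  M-inverse-unique {A} {B} {C} AB CA = M.trans (M.sym (M.identityʳ C))
    (M.trans (M.∙-congˡ {x = C} (M.sym AB)) (M.trans (M.sym (M.assoc C A B))
      (M.trans (M.∙-congʳ {x = B} CA) (M.identityˡ B))))

  letter≉1 : ∀ x → ¬ (⟦ x ⟧ M.≈ 1ᴹ)
  letter≉1 (Sign.+ , g) e = matrix≉1 g (≈⇒≈ᵁ e)
  letter≉1 (Sign.- , g) e = matrix≉1 g (≈⇒≈ᵁ
    (M-inverse-unique {A = inverse g} {B = 1ᴹ} {C = matrix g}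
      (M.trans (M.identityʳ (inverse g)) e) (≈ᵁ⇒≈ (inverseʳ g))))

  Cancels-inverse : ∀ {x y} → Cancels x y → ⟦ x ⟧ ∙ ⟦ y ⟧ M.≈ 1ᴹ
  Cancels-inverse {Sign.+ , g} {_ , h} (≡.refl , e) =
    M.trans (M.∙-congʳ {x = inverse h} (≈ᵁ⇒≈ {matrix g} {matrix h} e)) (≈ᵁ⇒≈ (inverseʳ h))
  Cancels-inverse {Sign.- , g} {_ , h} (≡.refl , e) =
    M.trans (M.∙-congˡ {x = inverse g} (M.sym (≈ᵁ⇒≈ {matrix g} {matrix h} e))) (≈ᵁ⇒≈ (inverseˡ g))

  eval-≋ : ∀ {u v} → u ≋ v → eval u M.≈ eval v
  eval-≋ = EqClosure.gfold M.isEquivalence eval eval-↝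
    where
    eval-↝ : ∀ {u v} → u ↝ v → eval u M.≈ eval v
    eval-↝ (cancel u {x} {y} v xy) = M.trans (eval-++ u (x ∷ y ∷ v)) (M.trans
      (M.∙-congˡ {x = eval u} (M.trans (M.sym (M.assoc ⟦ x ⟧ ⟦ y ⟧ (eval v)))
        (M.trans (M.∙-congʳ {x = eval v} (Cancels-inverse xy)) (M.identityˡ (eval v)))))
      (M.sym (eval-++ u v)))

  eval-⁻¹ : ∀ w → eval w ∙ eval (w ⁻¹) M.≈ 1ᴹ
  eval-⁻¹ w = M.trans (M.sym (eval-++ w (w ⁻¹))) (eval-≋ (Group.inverseʳ freeGroup w))

  eval-product : ∀ cs → eval (product cs) M.≈ 1ᴹ
  eval-product []       = M.refl
  eval-product (κ ∷ cs) = M.trans (eval-++ (Conjugate.word κ) (product cs))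
    (M.trans (M.∙-cong (conjugate-trivial κ) (eval-product cs)) (M.identityˡ 1ᴹ))
    where
    signed-trivial : ∀ κ s → eval (Conjugate.signed κ s) M.≈ 1ᴹ
    signed-trivial κ Sign.+ with Conjugate.relator∈R κ
    ... | _ , _ , _ , _ , _ , _ , trivial = ≈ᵁ⇒≈ {eval (Conjugate.relator κ)} {1ᴹ} trivial
    signed-trivial κ Sign.- = M.trans (M.sym (M.identityˡ (eval (Conjugate.relator κ ⁻¹))))
      (M.trans (M.∙-congʳ {x = eval (Conjugate.relator κ ⁻¹)} (M.sym (signed-trivial κ Sign.+)))
        (eval-⁻¹ (Conjugate.relator κ)))
    conjugate-trivial : ∀ κ → eval (Conjugate.word κ) M.≈ 1ᴹ
    conjugate-trivial κ = M.trans (eval-++ g (s ++ g ⁻¹))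
      (M.trans (M.∙-congˡ {x = eval g} (M.trans (eval-++ s (g ⁻¹))
        (M.trans (M.∙-congʳ {x = eval (g ⁻¹)} (signed-trivial κ (Conjugate.sign κ))) (M.identityˡ (eval (g ⁻¹))))))
      (eval-⁻¹ g))
      where
      g = Conjugate.conjugator κ
      s = Conjugate.signed κ (Conjugate.sign κ)

  eval-∼ : ∀ {u v b} → u ∼⟨ b ⟩ v → eval u M.≈ eval v
  eval-∼ {v = v} (cs , _ , p) = M.trans (eval-≋ p) (M.trans (eval-++ (product cs) v)
    (M.trans (M.∙-congʳ {x = eval v} (eval-product cs)) (M.identityˡ (eval v))))

  letter-G : ∀ x → G ⟦ x ⟧
  letter-G (Sign.+ , g) = K⊆G (proj₂ (matrix∈K g))
  letter-G (Sign.- , g) = inv {A = matrix g} {B = inverse g} (K⊆G (proj₂ (matrix∈K g))) (inverseʳ g) (inverseˡ g)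

  eval-G : ∀ w → G (eval w)
  eval-G []      = one
  eval-G (x ∷ w) = mul (letter-G x) (eval-G w)

  letter-K : ∀ x → ∃[ a ] K a ⟦ x ⟧
  letter-K (Sign.+ , g) = matrix∈K g
  letter-K (Sign.- , g) = proj₁ (matrix∈K g) , inv {A = matrix g} {B = inverse g} (proj₂ (matrix∈K g)) (inverseʳ g) (inverseˡ g)

  flip-K : ∀ {a} x → K a ⟦ x ⟧ → K a ⟦ flip x ⟧
  flip-K x k = inv′ {A = ⟦ x ⟧} {B = ⟦ flip x ⟧} k (⟦⟧-inverseʳ x) (⟦⟧-inverseˡ x)

  generator : ∀ {a A} → K a A → ¬ (A M.≈ 1ᴹ) → Generator
  generator {a} {A} k A≉1 with K-shape k
  ... | _ , A′ , _ , AA′ , A′A = record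
    { matrix = A ; inverse = A′ ; inverseʳ = ≈⇒≈ᵁ AA′ ; inverseˡ = ≈⇒≈ᵁ A′A
    ; matrix∈K = a , k ; matrix≉1 = λ e → A≉1 (≈ᵁ⇒≈ e) }

  letter : ∀ {a A} → K a A → ¬ (A M.≈ 1ᴹ) → Letter
  letter k A≉1 = Sign.+ , generator k A≉1

  ⟦letter⟧ : ∀ {a A} (k : K a A) (A≉1 : ¬ (A M.≈ 1ᴹ)) → ⟦ letter k A≉1 ⟧ ≡ A
  ⟦letter⟧ k A≉1 with K-shape k
  ... | _ , _ , _ , _ , _ = ≡.refl

  open GroupSolver freeGroup

  InK : Fin n → Word → Set
  InK a = All λ x → K a ⟦ x ⟧

  triangle-∼ : ∀ {a} x y z → K a ⟦ x ⟧ → K a ⟦ y ⟧ → K a ⟦ z ⟧ → ⟦ x ⟧ ∙ ⟦ y ⟧ M.≈ ⟦ z ⟧ →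
               x ∷ y ∷ [] ∼⟨ 1 ⟩ z ∷ []
  triangle-∼ {a} x y z kx ky kz e = ∼-trans {b = 0}
    (≋⇒∼ (solve 2 (λ w z → w ⊜ w ⊙ z ⁻ ⊙ z) ≋-refl (x ∷ y ∷ []) (z ∷ [])))
    (∼-++ {b = 1} {b′ = 0} (∼-relator (a , x , y , flip z , ≡.refl , kx ∷ ky ∷ flip-K z kz ∷ [] ,
      ≈⇒≈ᵁ (M.trans (M.sym (M.assoc ⟦ x ⟧ ⟦ y ⟧ (eval (flip z ∷ []))))
        (M.trans (M.∙-cong e (eval-letter (flip z))) (⟦⟧-inverseʳ z)))))
      (≋⇒∼ ≋-refl))

  -- Of two different nontrivial elements of K_a, at least one is not A⁻¹.
  separating : ∀ a A → ∃[ B ] K a B × ¬ (B M.≈ 1ᴹ) × ¬ (A ∙ B M.≈ 1ᴹ)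
  separating a A = choose
    where
    other : ∀ a → ∃[ j ] j ≢ a
    other zero    = suc zero , λ ()
    other (suc a) = zero , λ ()
    k = toℕ (proj₁ (other a))
    k<n = toℕ<n (proj₁ (other a))
    u v : Mat
    u = elem k (suc k) 1#
    v = elem k (suc k) t
    u≉1 : ¬ (u M.≈ 1ᴹ)
    u≉1 e = F.1≉0 (unwrap (elem-injective k (suc k) (M.trans e (M.sym (elem-0# ≤-refl k<n)))) 0)
    v≉1 : ¬ (v M.≈ 1ᴹ)
    v≉1 e = F.1≉0 (unwrap (elem-injective k (suc k) (M.trans e (M.sym (elem-0# ≤-refl k<n)))) 1)
    ku : K a u
    ku = superdiagonal-K (proj₁ (other a)) (proj₂ (other a)) (P.D-weaken ≤-refl (n≤1+n k) P.D-1#)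
    kv : K a v
    kv = superdiagonal-K (proj₁ (other a)) (proj₂ (other a)) P.D-t
    u≉v : ¬ (u M.≈ v)
    u≉v e = F.1≉0 (unwrap (elem-injective k (suc k) e) 0)
    choose : ∃[ B ] K a B × ¬ (B M.≈ 1ᴹ) × ¬ (A ∙ B M.≈ 1ᴹ)
    choose with (A ∙ u) ≈ᴹ? 1ᴹ
    ... | no Au≉1 = u , ku , u≉1 , Au≉1
    ... | yes Au≈1 = v , kv , v≉1 , λ Av≈1 → u≉v (unique Au≈1 Av≈1)
      where
      u-inverse = proj₂ (K-shape ku)
      unique : A ∙ u M.≈ 1ᴹ → A ∙ v M.≈ 1ᴹ → u M.≈ v
      unique Au Av = M.trans (M.sym (M.identityʳ u)) (M.trans (M.∙-congˡ {x = u} (M.sym Av))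
        (M.trans (M.sym (M.assoc u A v)) (M.trans (M.∙-congʳ {x = v} uA) (M.identityˡ v))))
        where
        u′ = proj₁ u-inverse
        A≈u′ : A M.≈ u′
        A≈u′ = M-inverse-unique {A = u} {B = u′} {C = A} (proj₁ (proj₂ (proj₂ u-inverse))) Au
        uA : u ∙ A M.≈ 1ᴹ
        uA = M.trans (M.∙-congˡ {x = u} A≈u′) (proj₁ (proj₂ (proj₂ u-inverse)))

  -- For v = x z = y z, the relators x z v⁻¹ and y z v⁻¹ identify the two spellings x and y.
  letter-∼ : ∀ {a} x y → K a ⟦ x ⟧ → K a ⟦ y ⟧ → ⟦ x ⟧ M.≈ ⟦ y ⟧ → x ∷ [] ∼⟨ 2 ⟩ y ∷ []
  letter-∼ {a} x y kx ky x≈y with separating a ⟦ x ⟧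
  ... | B , kB , B≉1 , xB≉1 =
    ∼-trans {b = 0} (≋⇒∼ (solve 2 (λ x z → x ⊜ x ⊙ z ⊙ z ⁻) ≋-refl (x ∷ []) (z ∷ [])))
      (∼-trans {b = 2} {b′ = 0}
        (∼-++ {b = 2} {b′ = 0}
          (∼-trans {b = 1} {b′ = 1}
            (triangle-∼ x z v kx kz kv (M.trans (M.∙-congˡ {x = ⟦ x ⟧} z≈B) (M.sym v≈xB)))
            (∼-sym (triangle-∼ y z v ky kz kv (M.trans (M.∙-cong (M.sym x≈y) z≈B) (M.sym v≈xB)))))
          (≋⇒∼ ≋-refl))
        (≋⇒∼ (solve 2 (λ y z → y ⊙ z ⊙ z ⁻ ⊜ y) ≋-refl (y ∷ []) (z ∷ []))))
    where
    kxB = mul kx kB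
    z = letter kB B≉1
    v = letter kxB xB≉1
    z≈B : ⟦ z ⟧ M.≈ B
    z≈B = M.reflexive (⟦letter⟧ kB B≉1)
    v≈xB : ⟦ v ⟧ M.≈ ⟦ x ⟧ ∙ B
    v≈xB = M.reflexive (⟦letter⟧ kxB xB≉1)
    kz : K a ⟦ z ⟧
    kz = resp′ (M.sym z≈B) kB
    kv : K a ⟦ v ⟧
    kv = resp′ (M.sym v≈xB) kxB

  private
    data Reduced (a : Fin n) (w : Word) : Set where
      trivial : eval w M.≈ 1ᴹ → w ∼⟨ 2 ℕ.* length w ⟩ [] → Reduced a w
      single  : ∀ y → K a ⟦ y ⟧ → eval w M.≈ ⟦ y ⟧ → w ∼⟨ 2 ℕ.* length w ⟩ y ∷ [] → Reduced a w

    -- The product of two letters of `K_a` is trivial or again a letter. Consuming one letter costs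
    -- at most 2 relators: one triangle if the product is a letter, or one change of spelling
    -- followed by a free cancellation if it is trivial.
    reduce : ∀ {a} w → InK a w → Reduced a w
    reduce     []      []       = trivial M.refl (≋⇒∼ ≋-refl)
    reduce {a} (x ∷ w) (kx ∷ kw) with reduce w kw
    ... | trivial e w∼ = single x kx (M.trans (M.∙-congˡ {x = ⟦ x ⟧} e) (M.identityʳ ⟦ x ⟧))
      (∼-weaken (ℕ.*-monoʳ-≤ 2 (n≤1+n (length w))) (∼-++ {b = 0} (≋⇒∼ (≋-refl {x ∷ []})) w∼))
    ... | single y ky e w∼ with (⟦ x ⟧ ∙ ⟦ y ⟧) ≈ᴹ? 1ᴹ
    ...   | yes xy≈1 = trivial (M.trans (M.∙-congˡ {x = ⟦ x ⟧} e) xy≈1)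
      (∼-weaken bound (∼-trans {b = 2 ℕ.* length w} {b′ = 2} (∼-++ {b = 0} (≋⇒∼ (≋-refl {x ∷ []})) w∼)
        (∼-trans {b = 2} {b′ = 0}
          (∼-++ {b = 0} {b′ = 2} (≋⇒∼ (≋-refl {x ∷ []})) (letter-∼ y (flip x) ky (flip-K x kx) y≈x⁻¹))
          (≋⇒∼ (Group.inverseʳ freeGroup (x ∷ []))))))
      where
      bound : 2 ℕ.* length w ℕ.+ 2 ≤ 2 ℕ.* suc (length w)
      bound = ≤-reflexive (≡.trans (ℕ.+-comm _ 2) (≡.sym (ℕ.*-suc 2 (length w))))
      y≈x⁻¹ : ⟦ y ⟧ M.≈ ⟦ flip x ⟧
      y≈x⁻¹ = M.sym (M-inverse-unique {A = ⟦ x ⟧} {B = ⟦ y ⟧} {C = ⟦ flip x ⟧} xy≈1 (⟦⟧-inverseˡ x))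
    ...   | no xy≉1 = single v kv (M.trans (M.∙-congˡ {x = ⟦ x ⟧} e) (M.sym v≈xy))
      (∼-weaken bound (∼-trans {b = 2 ℕ.* length w} {b′ = 1} (∼-++ {b = 0} (≋⇒∼ (≋-refl {x ∷ []})) w∼)
        (triangle-∼ x y v kx ky kv (M.sym v≈xy))))
      where
      v = letter (mul kx ky) xy≉1
      v≈xy : ⟦ v ⟧ M.≈ ⟦ x ⟧ ∙ ⟦ y ⟧
      v≈xy = M.reflexive (⟦letter⟧ (mul kx ky) xy≉1)
      kv : K a ⟦ v ⟧
      kv = resp′ (M.sym v≈xy) (mul kx ky)
      bound : 2 ℕ.* length w ℕ.+ 1 ≤ 2 ℕ.* suc (length w)
      bound = ≤-trans (ℕ.+-monoʳ-≤ (2 ℕ.* length w) (n≤1+n 1))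
        (≤-reflexive (≡.trans (ℕ.+-comm _ 2) (≡.sym (ℕ.*-suc 2 (length w)))))

  -- The source of uniformity: the bound does not mention `q`. Both words are reduced at 2 per
  -- letter, and the summand 2 identifies the two remaining letters.
  InK-∼ : ∀ {a} u v → InK a u → InK a v → eval u M.≈ eval v →
          u ∼⟨ 2 ℕ.* length u ℕ.+ (2 ℕ.+ 2 ℕ.* length v) ⟩ v
  InK-∼ u v ku kv e with reduce u ku | reduce v kv
  ... | trivial _ u∼ | trivial _ v∼ = ∼-trans u∼ (∼-weaken (ℕ.m≤n+m _ 2) (∼-sym v∼))
  ... | trivial e₁ _ | single y _ e₂ _ = contradiction (M.trans (M.sym e₂) (M.trans (M.sym e) e₁)) (letter≉1 y)
  ... | single y _ e₁ _ | trivial e₂ _ = contradiction (M.trans (M.sym e₁) (M.trans e e₂)) (letter≉1 y)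
  ... | single x kx e₁ u∼ | single y ky e₂ v∼ =
    ∼-trans u∼ (∼-trans {b = 2} (letter-∼ x y kx ky (M.trans (M.sym e₁) (M.trans e e₂))) (∼-sym v∼))

  record Represents (a : Fin n) (ℓ : ℕ) (A : Mat) (w : Word) : Set where
    constructor represents
    field
      letters : InK a w
      value   : eval w M.≈ A
      size    : length w ≤ ℓ

  Represents-++ : ∀ {a ℓ ℓ′ A B u v} → Represents a ℓ A u → Represents a ℓ′ B v →
                  Represents a (ℓ ℕ.+ ℓ′) (A ∙ B) (u ++ v)
  Represents-++ {u = u} {v} (represents ku eu lu) (represents kv ev lv) = represents
    (All-++⁺ ku kv) (M.trans (eval-++ u v) (M.∙-cong eu ev))
    (≡.subst (_≤ _) (≡.sym (length-++ u)) (ℕ.+-mono-≤ lu lv))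

  Represents-∼ : ∀ {a ℓ ℓ′ A B u v} → Represents a ℓ A u → Represents a ℓ′ B v → A M.≈ B →
                 u ∼⟨ 2 ℕ.* ℓ ℕ.+ (2 ℕ.+ 2 ℕ.* ℓ′) ⟩ v
  Represents-∼ {u = u} {v} (represents ku eu lu) (represents kv ev lv) A≈B =
    ∼-weaken (ℕ.+-mono-≤ (ℕ.*-monoʳ-≤ 2 lu) (ℕ.+-monoʳ-≤ 2 (ℕ.*-monoʳ-≤ 2 lv)))
      (InK-∼ u v ku kv (M.trans eu (M.trans A≈B (M.sym ev))))

  private
    canonical : ∀ {a A} → K a A → Dec (A M.≈ 1ᴹ) → Word
    canonical k (yes _)  = []
    canonical k (no A≉1) = letter k A≉1 ∷ []

    elementWord′ : ∀ {i j p} → Dec (∃[ a ] Position n (toℕ a) i j × D i j p) → Word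
    elementWord′             (no _)              = []
    elementWord′ {i} {j} {p} (yes (a , pos , d)) = canonical (K-elem pos d) (elem i j p ≈ᴹ? 1ᴹ)

    position? : ∀ a i j → a < n → Dec (Position n a i j)
    position? a i j a<n with i ℕ.<? j | j ℕ.≤? n | a ℕ.<? i ⊎-dec j ℕ.≤? a
    ... | yes p | yes r | yes s = yes (position a<n p r s)
    ... | no ¬p | _     | _     = no λ pos → ¬p (Position.i<j pos)
    ... | _     | no ¬r | _     = no λ pos → ¬r (Position.j≤n pos)
    ... | _     | _     | no ¬s = no λ pos → ¬s (Position.avoid pos)

  -- The empty word unless e_{i,j}(p) lies in some K_a ∖ {1}.
  elementWord : ℕ → ℕ → Carrier → Word
  elementWord i j p = elementWord′ {i} {j} {p} (any? λ a → position? (toℕ a) i j (toℕ<n a) ×-dec D? _≟_ i j p)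

  -- The search may return an index `b` other than `a`, but the matrix of the letter is `e_{i,j}(p)`
  -- itself, which lies in `K_a` too. So one word serves for all subgroups that contain the element.
  elementWord-represents : ∀ {a i j p} → Position n (toℕ a) i j → D i j p →
                           Represents a 1 (elem i j p) (elementWord i j p)
  elementWord-represents {a} {i} {j} {p} pos d
    with any? (λ a → position? (toℕ a) i j (toℕ<n a) ×-dec D? _≟_ i j p)
  ... | no ¬∃ = contradiction (a , pos , d) ¬∃
  ... | yes (b , pos′ , d′) with elem i j p ≈ᴹ? 1ᴹ
  ...   | yes e = represents [] (M.sym e) z≤n
  ...   | no A≉1 = represents (resp′ (M.sym eq) (K-elem pos d) ∷ [])
    (M.trans (eval-letter (letter (K-elem pos′ d′) A≉1)) eq) (s≤s z≤n)
    where
    eq : ⟦ letter (K-elem pos′ d′) A≉1 ⟧ M.≈ elem i j p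
    eq = M.reflexive (⟦letter⟧ (K-elem pos′ d′) A≉1)

  elementWord-0# : ∀ {i j p} → i < j → j ≤ n → p P.≈ 0# → elementWord i j p ≡ []
  elementWord-0# {i} {j} {p} i<j j≤n p≈0
    with any? (λ a → position? (toℕ a) i j (toℕ<n a) ×-dec D? _≟_ i j p)
  ... | no _ = ≡.refl
  ... | yes (b , pos , d) with elem i j p ≈ᴹ? 1ᴹ
  ...   | yes _ = ≡.refl
  ...   | no A≉1 = contradiction (M.trans (elem-cong p≈0) (elem-0# i<j j≤n)) A≉1

  elementWord-corner : ∀ {p} → elementWord 0 n p ≡ []
  elementWord-corner {p} with any? (λ a → position? (toℕ a) 0 n (toℕ<n a) ×-dec D? _≟_ 0 n p)
  ... | no _ = ≡.refl
  ... | yes (b , position b<n _ _ (inj₂ n≤b) , _) = contradiction (<-≤-trans b<n n≤b) (<-irrefl ≡.refl)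

-- Absorption of words into the ordered product.

record Evaluation {c ℓ c′ ℓ′ d c″ ℓ″} {𝔾 : Group c ℓ} {P : FilteredRing c′ ℓ′ d} {n : ℕ}
  (rels : ElementaryRelations 𝔾 P n) (coll : CollectionRelations (Group.monoid 𝔾) P n)
  (M : Monoid c″ ℓ″) g : Set (c ⊔ ℓ ⊔ c′ ⊔ ℓ′ ⊔ d ⊔ c″ ⊔ ℓ″ ⊔ lsuc g) where
  private
    module H = Group 𝔾
    module P = FilteredRing P
    module M = Monoid M
  open H using (_∙_)
  open P using (D)
  open M using () renaming (_∙_ to _·_)
  open ElementaryRelations rels
  open CollectionRelations coll
  field
    Ê-superdiagonal  : ∀ {k} r → k < n → Ê k (suc k) r H.≈ E k (suc k) r
    entries          : M.Carrier → ℕ → ℕ → P.Carrier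
    𝒢                : Pred M.Carrier g
    eval             : H.Carrier → M.Carrier
    eval-cong        : ∀ {h k} → h H.≈ k → eval h M.≈ eval k
    eval-∙           : ∀ h k → eval (h ∙ k) M.≈ eval h · eval k
    eval-ε           : eval H.ε M.≈ M.ε
    𝒢-ε              : 𝒢 M.ε
    𝒢-eval           : ∀ {A} h → 𝒢 A → 𝒢 (A · eval h)
    entries-cong     : ∀ {A B} i j → A M.≈ B → entries A i j P.≈ entries B i j
    entries-D        : ∀ {A} → 𝒢 A → ∀ i j → i < j → j ≤ n → D i j (entries A i j)
    entries-same     : ∀ {A k r} → 𝒢 A → k < n → D k (suc k) r → ∀ i j → i < j → j ≤ n → j ≢ suc k →
                       entries (A · eval (E k (suc k) r)) i j P.≈ entries A i j
    entries-above    : ∀ {A k r} → 𝒢 A → k < n → D k (suc k) r → ∀ i → i < k →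
                       entries (A · eval (E k (suc k) r)) i (suc k) P.≈
                         entries A i (suc k) P.+ entries A i k P.* r
    entries-diagonal : ∀ {A k r} → 𝒢 A → k < n → D k (suc k) r →
                       entries (A · eval (E k (suc k) r)) k (suc k) P.≈ entries A k (suc k) P.+ r

-- σ A is the ordered product of the entries of A; a group element h is absorbed if
-- σ A ∙ h = σ (A · eval h) for all A, and then eval h = 1 forces h = 1.
module Absorption {c ℓ c′ ℓ′ d c″ ℓ″ g} {𝔾 : Group c ℓ} {P : FilteredRing c′ ℓ′ d} {n : ℕ}
  {rels : ElementaryRelations 𝔾 P n} {coll : CollectionRelations (Group.monoid 𝔾) P n}
  {M : Monoid c″ ℓ″} (evaluation : Evaluation rels coll M g) where

  open Group 𝔾
  open import Algebra.Properties.Group 𝔾 using (identityʳ-unique)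
  private module M = Monoid M
  open M using () renaming (Carrier to Mat; _∙_ to _·_; ε to 1ᴹ; _≈_ to _≈ᴹ_)
  open FilteredRing P using (D)
  open ElementaryRelations rels
  open Evaluation evaluation
  open Collect coll
  open ElementaryProperties rels
  open OrderedProduct rawMonoid

  private
    σ′ : Mat → Carrier
    σ′ A = σ (entries A)

    σ′-cong : ∀ {A B} → 𝒢 A → A ≈ᴹ B → σ′ A ≈ σ′ B
    σ′-cong gA A≈B = σ-cong (entries-D gA) λ i j _ _ → entries-cong i j A≈B

  record Absorbed (h : Carrier) : Set (ℓ ⊔ c″ ⊔ g) where
    constructor absorbed
    field absorb : ∀ {A} → 𝒢 A → σ′ A ∙ h ≈ σ′ (A · eval h)

  open Absorbed public

  Absorbed-cong : ∀ {h k} → h ≈ k → Absorbed h → Absorbed k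
  Absorbed-cong {h} h≈k a .absorb gA = trans (∙-congˡ (sym h≈k))
    (trans (a .absorb gA) (σ′-cong (𝒢-eval h gA) (M.∙-congˡ (eval-cong h≈k))))

  Absorbed-ε : Absorbed ε
  Absorbed-ε .absorb gA = trans (identityʳ _)
    (σ′-cong gA (M.sym (M.trans (M.∙-congˡ eval-ε) (M.identityʳ _))))

  Absorbed-∙ : ∀ {h k} → Absorbed h → Absorbed k → Absorbed (h ∙ k)
  Absorbed-∙ {h} {k} a b .absorb gA = trans (sym (assoc _ _ _)) (trans (∙-congʳ (a .absorb gA))
    (trans (b .absorb (𝒢-eval h gA)) (σ′-cong (𝒢-eval k (𝒢-eval h gA))
      (M.trans (M.assoc _ _ _) (M.∙-congˡ (M.sym (eval-∙ h k)))))))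

  Absorbed-⁻¹ : ∀ {h} → Absorbed h → Absorbed (h ⁻¹)
  Absorbed-⁻¹ {h} a .absorb {A} gA = trans
    (∙-congʳ (trans (σ′-cong gA (M.sym back)) (sym (a .absorb (𝒢-eval (h ⁻¹) gA)))))
    (trans (assoc _ _ _) (trans (∙-congˡ (inverseʳ h)) (identityʳ _)))
    where
    back : (A · eval (h ⁻¹)) · eval h ≈ᴹ A
    back = M.trans (M.assoc _ _ _) (M.trans (M.∙-congˡ (M.trans (M.sym (eval-∙ (h ⁻¹) h))
      (M.trans (eval-cong (inverseˡ h)) eval-ε))) (M.identityʳ A))

  private
    Absorbed-superdiagonal : ∀ {k r} → k < n → D k (suc k) r → Absorbed (E k (suc k) r)
    Absorbed-superdiagonal {k} {r} k<n dr .absorb gA =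
      trans (∙-congˡ (sym (Ê-superdiagonal r k<n)))
        (σ-step k<n dr (entries-D gA) (entries-same gA k<n dr) (entries-above gA k<n dr)
          (entries-diagonal gA k<n dr))

    Absorbed-⁅⁆ : ∀ {h k} → Absorbed h → Absorbed k → Absorbed (Commuting.⁅_,_⁆ 𝔾 h k)
    Absorbed-⁅⁆ a b = Absorbed-∙ (Absorbed-∙ (Absorbed-∙ a b) (Absorbed-⁻¹ a)) (Absorbed-⁻¹ b)

  Absorbed-E : ∀ {a i j p} → Position n a i j → D i j p → Absorbed (E i j p)
  Absorbed-E {a} {i} {suc j} pos@(position a<n i<j j≤n avoid) dp with m≤n⇒m<n∨m≡n (≤-pred i<j)
  ... | inj₂ ≡.refl = Absorbed-superdiagonal j≤n dp
  ... | inj₁ i<j′ = Absorbed-cong (sym (E-splitʳ left right dp))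
    (Absorbed-∙
      (Absorbed-⁅⁆ (Absorbed-E left (D-hd′ (<⇒≤ i<j′)))
                   (Absorbed-superdiagonal j≤n (P.D-weaken ≤-refl (n≤1+n j) P.D-1#)))
      (Absorbed-⁅⁆ (Absorbed-E left (P.D-tl dp)) (Absorbed-superdiagonal j≤n P.D-t)))
    where
    module P = FilteredRing P
    left : Position n a i j
    left = position a<n i<j′ (<⇒≤ j≤n) ([ inj₁ , (λ j<a → inj₂ (<⇒≤ j<a)) ]′ avoid)
    right : Position n a j (suc j)
    right = position a<n ≤-refl j≤n ([ (λ a<i → inj₁ (<-trans a<i i<j′)) , inj₂ ]′ avoid)

  Absorbed-triangle : ∀ {f} m → (∀ i j → i < j → j < m → Absorbed (f i j)) → Absorbed (triangle f m)
  Absorbed-triangle {f} = triangle-rel rawMonoid rawMonoid (λ h _ → Absorbed h) Absorbed-ε Absorbed-∙ {g = f}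

  -- Absorption at the identity matrix gives `σ 1 ∙ h = σ 1`, and `σ 1` cancels.
  Absorbed⇒≈ε : ∀ {h} → Absorbed h → eval h ≈ᴹ 1ᴹ → h ≈ ε
  Absorbed⇒≈ε {h} a e = identityʳ-unique _ _ (trans (a .absorb 𝒢-ε)
    (sym (σ′-cong 𝒢-ε (M.sym (M.trans (M.identityˡ _) e)))))

module EntryWords (m : ℕ) {q} (F : FiniteField q) where
  private
    n : ℕ
    n = suc (suc m)
  open UnipotentGroup n F hiding (_*_; _≈_)
  open PolynomialProperties (FiniteField.commutativeRing F) using (filteredRing)
  open MatrixProperties filteredRing n
  private
    module P = FilteredRing filteredRing
    module M = Monoid *-monoid
  open UnipotentProperties m F
  open UnipotentWords m F
  open OrderedProduct

  wordMonoid : RawMonoid 0ℓ 0ℓ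
  wordMonoid = Group.rawMonoid freeGroup

  -- The ordered product with `elementWord` for every factor, so the corner contributes the empty
  -- word. This loses nothing on `K_a`, whose corner entries vanish, and the length is at most the
  -- number of positions.
  entryWord : Mat → Word
  entryWord A = triangle wordMonoid (λ i j → elementWord i j (entries A i j)) (suc n)

  entryWord-size : ℕ
  entryWord-size = triangle ℕ.+-0-rawMonoid (λ _ _ → 1) (suc n)

  private
    factor-represents : ∀ {a A} → K a A → ∀ i j → i < j → j < suc n →
      Represents a 1 (elem i j (entries A i j)) (elementWord i j (entries A i j))
    factor-represents {a} {A} kA i j i<j j<n with toℕ a ℕ.<? i | j ℕ.≤? toℕ a
    ... | yes a<i | _ = elementWord-represents (position (toℕ<n a) i<j (≤-pred j<n) (inj₁ a<i))
                          (entries-D {A} (K⊆G kA) i j i<j (≤-pred j<n))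
    ... | no _ | yes j≤a = elementWord-represents (position (toℕ<n a) i<j (≤-pred j<n) (inj₂ j≤a))
                             (entries-D {A} (K⊆G kA) i j i<j (≤-pred j<n))
    -- Now `i ≤ a < j`, outside both blocks, so the entry is zero and its word empty; the corner
    -- always falls under this case.
    ... | no a≮i | no j≰a =
      ≡.subst (Represents a 1 (elem i j (entries A i j)))
        (≡.sym (elementWord-0# i<j (≤-pred j<n) zero-entry))
        (represents [] (M.sym (M.trans (elem-cong zero-entry) (elem-0# i<j (≤-pred j<n)))) z≤n)
      where
      zero-entry : entries A i j P.≈ P.0#
      zero-entry = proj₁ (K-shape kA) .vanish
        ( ≡.subst (_≤ toℕ a) (≡.sym (toℕ-clamp (≤-trans (<⇒≤ i<j) (≤-pred j<n)))) (≮⇒≥ a≮i)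
        , ≡.subst (toℕ a <_) (≡.sym (toℕ-clamp (≤-pred j<n))) (≰⇒> j≰a))

  entryWord-represents : ∀ {a} A → K a A → Represents a entryWord-size A (entryWord A)
  entryWord-represents {a} A kA = represents
    (triangle-rel wordMonoid wordMonoid (λ w _ → InK a w) [] All-++⁺
      {f = f} {g = f} (suc n) λ i j i<j j<n → Represents.letters (factor-represents {A = A} kA i j i<j j<n))
    (M.trans (triangle-rel wordMonoid M.rawMonoid (λ w B → eval w M.≈ B) M.refl
        (λ {u} {B} {v} {C} e e′ → M.trans (eval-++ u v) (M.∙-cong e e′))
        {f = f} {g = λ i j → elem i j (entries A i j)} (suc n)
        λ i j i<j j<n → Represents.value (factor-represents {A = A} kA i j i<j j<n))
      (M.trans (M.reflexive (≡.sym (σᴹ-triangle (entries A)))) (M.sym (σᴹ-entries A (K⊆G kA)))))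
    (triangle-rel wordMonoid ℕ.+-0-rawMonoid (λ w ℓ → length w ≤ ℓ) z≤n
      (λ {u} {_} {v} p p′ → ≡.subst (_≤ _) (≡.sym (length-++ u)) (ℕ.+-mono-≤ p p′))
      {f = f} {g = λ _ _ → 1} (suc n)
      λ i j i<j j<n → Represents.size (factor-represents {A = A} kA i j i<j j<n))
    where
    f : ℕ → ℕ → Word
    f i j = elementWord i j (entries A i j)

-- Families over all instances.

module _ {i c ℓ d} (I : Set i) (P : I → FilteredRing c ℓ d) where
  private module P ι = FilteredRing (P ι)

  -- A product of rings of polynomials: everything required of a filtered ring passes to products,
  -- whereas decidable equality and the absence of zero divisors would not.
  familyRing : FilteredRing (i ⊔ c) (i ⊔ ℓ) (i ⊔ d)
  familyRing = record
    { commutativeRing = record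
      { Carrier = ∀ ι → P.Carrier ι
      ; _≈_ = λ x y → ∀ ι → P._≈_ ι (x ι) (y ι)
      ; _+_ = λ x y ι → P._+_ ι (x ι) (y ι)
      ; _*_ = λ x y ι → P._*_ ι (x ι) (y ι)
      ; -_ = λ x ι → P.-_ ι (x ι)
      ; 0# = λ ι → P.0# ι
      ; 1# = λ ι → P.1# ι
      ; isCommutativeRing = record
        { isRing = record
          { +-isAbelianGroup = record
            { isGroup = record
              { isMonoid = record
                { isSemigroup = record
                  { isMagma = record
                    { isEquivalence = record
                      { refl  = λ ι → P.refl ι
                      ; sym   = λ e ι → P.sym ι (e ι)
                      ; trans = λ e f ι → P.trans ι (e ι) (f ι)
                      }
                    ; ∙-cong = λ e f ι → P.+-cong ι (e ι) (f ι)
                    }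
                  ; assoc = λ x y z ι → P.+-assoc ι (x ι) (y ι) (z ι)
                  }
                ; identity = (λ x ι → P.+-identityˡ ι (x ι)) , (λ x ι → P.+-identityʳ ι (x ι))
                }
              ; inverse = (λ x ι → P.-‿inverseˡ ι (x ι)) , (λ x ι → P.-‿inverseʳ ι (x ι))
              ; ⁻¹-cong = λ e ι → P.-‿cong ι (e ι)
              }
            ; comm = λ x y ι → P.+-comm ι (x ι) (y ι)
            }
          ; *-cong = λ e f ι → P.*-cong ι (e ι) (f ι)
          ; *-assoc = λ x y z ι → P.*-assoc ι (x ι) (y ι) (z ι)
          ; *-identity = (λ x ι → P.*-identityˡ ι (x ι)) , (λ x ι → P.*-identityʳ ι (x ι))
          ; distrib = (λ x y z ι → P.distribˡ ι (x ι) (y ι) (z ι)) , (λ x y z ι → P.distribʳ ι (x ι) (y ι) (z ι))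
          }
        ; *-comm = λ x y ι → P.*-comm ι (x ι) (y ι)
        }
      }
    ; D         = λ i j p → ∀ ι → P.D ι i j (p ι)
    ; D-resp    = λ e dp ι → P.D-resp ι (e ι) (dp ι)
    ; D-weaken  = λ i′≤i j≤j′ dp ι → P.D-weaken ι i′≤i j≤j′ (dp ι)
    ; D-shift   = λ dp ι → P.D-shift ι (dp ι)
    ; D-unshift = λ dp ι → P.D-unshift ι (dp ι)
    ; D-0#      = λ ι → P.D-0# ι
    ; D⇒≈0#     = λ j<i dp ι → P.D⇒≈0# ι j<i (dp ι)
    ; D-1#      = λ ι → P.D-1# ι
    ; D-+       = λ dp dr ι → P.D-+ ι (dp ι) (dr ι)
    ; D-neg     = λ dp ι → P.D-neg ι (dp ι)
    ; D-*       = λ dp dr ι → P.D-* ι (dp ι) (dr ι)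
    ; t         = λ ι → P.t ι
    ; D-t       = λ ι → P.D-t ι
    ; hd        = λ p ι → P.hd ι (p ι)
    ; tl        = λ p ι → P.tl ι (p ι)
    ; hd-tl     = λ p ι → P.hd-tl ι (p ι)
    ; D-hd      = λ ι → P.D-hd ι
    ; D-tl      = λ dp ι → P.D-tl ι (dp ι)
    ; hd-cong   = λ e ι → P.hd-cong ι (e ι)
    ; tl-cong   = λ e ι → P.tl-cong ι (e ι)
    ; hd-+      = λ p r ι → P.hd-+ ι (p ι) (r ι)
    ; tl-+      = λ p r ι → P.tl-+ ι (p ι) (r ι)
    ; hd-t*     = λ p ι → P.hd-t* ι (p ι)
    ; tl-t*     = λ p ι → P.tl-t* ι (p ι)
    }

-- Families of words, two of which are equal when their quotients have uniformly bounded area.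
-- A proof about this group for the family of all instances bounds the Dehn function uniformly.
module Families {i} (L : ℕ) (I : Set i) {q : I → ℕ} (F : ∀ ι → FiniteField (q ι)) where
  private
    N n : ℕ
    N = suc (suc L)
    n = suc N
    module U ι = UnipotentGroup n (F ι)
    module Pol ι = PolynomialProperties (FiniteField.commutativeRing (F ι))
    module Mat ι = MatrixProperties (Pol.filteredRing ι) n
    module M ι = Monoid (Mat.*-monoid ι)
    module G ι = UnipotentProperties (suc L) (F ι)
    module W ι = UnipotentWords (suc L) (F ι)
    module T ι = EntryWords (suc L) (F ι)
    module Free ι = Group (W.freeGroup ι)

  P : FilteredRing i i i
  P = familyRing I Pol.filteredRing

  private module P = FilteredRing P

  WordFamily : Set i
  WordFamily = ∀ ι → U.Word ι

  infix 4 _≈_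

  record _≈_ (u v : WordFamily) : Set i where
    constructor within
    field
      -- The bound is chosen before the instance; this order of quantifiers is the uniformity.
      bound : ℕ
      area  : ∀ ι → W._∼⟨_⟩_ ι (u ι) bound (v ι)

  pointwise-≋ : ∀ {u v} → (∀ ι → U._≋_ ι (u ι) (v ι)) → u ≈ v
  pointwise-≋ e = within 0 λ ι → W.≋⇒∼ ι (e ι)

  familyGroup : Group i i
  familyGroup = record
    { Carrier = WordFamily ; _≈_ = _≈_ ; _∙_ = λ u v ι → u ι ++ v ι ; ε = λ _ → []
    ; _⁻¹ = λ u ι → U._⁻¹ ι (u ι)
    ; isGroup = record
      { isMonoid = record
        { isSemigroup = record
          { isMagma = record
            { isEquivalence = record
              { refl  = pointwise-≋ λ ι → W.≋-refl ι
              ; sym   = λ { (within b e) → within b λ ι → W.∼-sym ι (e ι) }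
              ; trans = λ { (within b e) (within b′ e′) → within (b ℕ.+ b′) λ ι → W.∼-trans ι (e ι) (e′ ι) }
              }
            ; ∙-cong = λ { (within b e) (within b′ e′) → within (b ℕ.+ b′) λ ι → W.∼-++ ι (e ι) (e′ ι) }
            }
          ; assoc = λ u v w → pointwise-≋ λ ι → Free.assoc ι (u ι) (v ι) (w ι)
          }
        ; identity = (λ u → pointwise-≋ λ ι → Free.identityˡ ι (u ι))
                   , (λ u → pointwise-≋ λ ι → Free.identityʳ ι (u ι))
        }
      ; inverse = (λ u → pointwise-≋ λ ι → Free.inverseˡ ι (u ι))
                , (λ u → pointwise-≋ λ ι → Free.inverseʳ ι (u ι))
      ; ⁻¹-cong = λ { (within b e) → within b λ ι → W.∼-⁻¹ ι (e ι) }
      }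
    }

  private
    E : ℕ → ℕ → P.Carrier → WordFamily
    E i j p ι = W.elementWord ι i j (p ι)

    Reps : ℕ → ℕ → (∀ ι → M.Carrier ι) → WordFamily → Set i
    Reps a ℓ A u = ∀ ι → W.Represents ι (clamp N a) ℓ (A ι) (u ι)

    E-reps : ∀ {a i j p} → Position n a i j → P.D i j p → Reps a 1 (λ ι → Mat.elem ι i j (p ι)) (E i j p)
    E-reps {a} {i} {j} pos dp ι = W.elementWord-represents ι
      (≡.subst (λ a → Position n a i j) (≡.sym (toℕ-clamp (≤-pred (Position.a<n pos)))) pos) (dp ι)

    Reps-≈ : ∀ {a ℓ ℓ′ A B u v} → Reps a ℓ A u → Reps a ℓ′ B v → (∀ ι → M._≈_ ι (A ι) (B ι)) → u ≈ v
    Reps-≈ {ℓ = ℓ} {ℓ′} r s e = within (2 ℕ.* ℓ ℕ.+ (2 ℕ.+ 2 ℕ.* ℓ′)) λ ι → W.Represents-∼ ι (r ι) (s ι) (e ι)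

    Reps-∙ : ∀ {a ℓ ℓ′ A B u v} → Reps a ℓ A u → Reps a ℓ′ B v →
             Reps a (ℓ ℕ.+ ℓ′) (λ ι → M._∙_ ι (A ι) (B ι)) (λ ι → u ι ++ v ι)
    Reps-∙ r s ι = W.Represents-++ ι (r ι) (s ι)

  -- In every instance the two sides are words of at most 3 letters over the same `K_a` with equal
  -- matrices, so `InK-∼` bounds all the areas at once.
  relations : ElementaryRelations familyGroup P n
  relations = record
    { E      = E
    ; E-cong = λ {a} {i} {j} {p} {r} pos dp p≈r → Reps-≈ {A = mat i j p} {B = mat i j r}
                 (E-reps pos dp) (E-reps pos (P.D-resp {p = p} {r = r} p≈r dp)) λ ι → Mat.elem-cong ι (p≈r ι)
    ; E-add  = λ {a} {i} {j} {p} {r} pos dp dr →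
                 Reps-≈ {A = mat i j p ·ᶠ mat i j r} {B = mat i j (p P.+ r)}
                   (Reps-∙ {A = mat i j p} {B = mat i j r} (E-reps pos dp) (E-reps pos dr))
                   (E-reps pos (P.D-+ {p = p} {r = r} dp dr))
                   λ ι → Mat.elem-add ι (Position.i<j pos) (Position.j≤n pos)
    ; E-comm = λ {a} {i} {j} {k} {l} {p} {r} pos pos′ j≢k i≢l dp dr →
                 Reps-≈ {A = mat i j p ·ᶠ mat k l r} {B = mat k l r ·ᶠ mat i j p}
                   (Reps-∙ {A = mat i j p} {B = mat k l r} (E-reps pos dp) (E-reps pos′ dr))
                   (Reps-∙ {A = mat k l r} {B = mat i j p} (E-reps pos′ dr) (E-reps pos dp))
                   λ ι → Mat.elem-comm ι (Position.i<j pos) (Position.j≤n pos)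
                           (Position.i<j pos′) (Position.j≤n pos′) j≢k i≢l
    ; E-mul  = λ {a} {i} {j} {k} {p} {r} pos pos′ dp dr →
                 Reps-≈ {A = mat i j p ·ᶠ mat j k r} {B = mat i k (p P.* r) ·ᶠ (mat j k r ·ᶠ mat i j p)}
                   (Reps-∙ {A = mat i j p} {B = mat j k r} (E-reps pos dp) (E-reps pos′ dr))
                   (Reps-∙ {A = mat i k (p P.* r)} {B = mat j k r ·ᶠ mat i j p}
                     (E-reps (combine pos pos′) (P.D-* {p = p} {r = r} dp dr))
                     (Reps-∙ {A = mat j k r} {B = mat i j p} (E-reps pos′ dr) (E-reps pos dp)))
                   λ ι → Mat.elem-mul ι (Position.i<j pos) (Position.i<j pos′) (Position.j≤n pos′)
    }
    where
    mat : ℕ → ℕ → P.Carrier → ∀ ι → M.Carrier ι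
    mat i j p ι = Mat.elem ι i j (p ι)
    infixl 7 _·ᶠ_
    _·ᶠ_ : (∀ ι → M.Carrier ι) → (∀ ι → M.Carrier ι) → ∀ ι → M.Carrier ι
    (A ·ᶠ B) ι = M._∙_ ι (A ι) (B ι)

module FamilyAbsorption {i} (L : ℕ) (I : Set i) {q : I → ℕ} (F : ∀ ι → FiniteField (q ι))
  (key : HallWitt.Key L (Families.relations L I F)) where
  open Families L I F
  open ElementaryRelations relations
  open FilteredRing P using (D)
  private
    N n : ℕ
    N = suc (suc L)
    n = suc N
    module U ι = UnipotentGroup n (F ι)
    module Pol ι = PolynomialProperties (FiniteField.commutativeRing (F ι))
    module P′ ι = FilteredRing (Pol.filteredRing ι)
    module Mat ι = MatrixProperties (Pol.filteredRing ι) n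
    module M ι = Monoid (Mat.*-monoid ι)
    module G ι = UnipotentProperties (suc L) (F ι)
    module W ι = UnipotentWords (suc L) (F ι)
    module T ι = EntryWords (suc L) (F ι)
    module H = Group familyGroup

  open CornerCollection L relations key

  private
    matrixFamilies : Monoid i i
    matrixFamilies = record
      { Carrier = ∀ ι → M.Carrier ι
      ; _≈_ = λ A B → ∀ ι → M._≈_ ι (A ι) (B ι)
      ; _∙_ = λ A B ι → M._∙_ ι (A ι) (B ι)
      ; ε = λ ι → M.ε ι
      ; isMonoid = record
        { isSemigroup = record
          { isMagma = record
            { isEquivalence = record
              { refl  = λ ι → M.refl ι
              ; sym   = λ e ι → M.sym ι (e ι)
              ; trans = λ e f ι → M.trans ι (e ι) (f ι)
              }
            ; ∙-cong = λ e f ι → M.∙-cong ι (e ι) (f ι)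
            }
          ; assoc = λ A B C ι → M.assoc ι (A ι) (B ι) (C ι)
          }
        ; identity = (λ A ι → M.identityˡ ι (A ι)) , (λ A ι → M.identityʳ ι (A ι))
        }
      }

    entries : (∀ ι → M.Carrier ι) → ℕ → ℕ → ∀ ι → P′.Carrier ι
    entries A i j ι = G.entries ι (A ι) i j

    eval : WordFamily → ∀ ι → M.Carrier ι
    eval u ι = U.eval ι (u ι)

    superdiagonal : ∀ k → k < n → ∃[ a ] Position n a k (suc k)
    superdiagonal zero    _   = N , position ≤-refl ≤-refl (s≤s z≤n) (inj₂ (s≤s z≤n))
    superdiagonal (suc k) k<n = 0 , position (s≤s z≤n) ≤-refl k<n (inj₁ (s≤s z≤n))

    eval-superdiagonal : ∀ {k r} → k < n → D k (suc k) r → ∀ ι →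
                         M._≈_ ι (eval (E k (suc k) r) ι) (Mat.elem ι k (suc k) (r ι))
    eval-superdiagonal {k} k<n dr ι with superdiagonal k k<n
    ... | a , position a<n p p′ s = W.Represents.value (W.elementWord-represents ι
      (≡.subst (λ a → Position n a k (suc k)) (≡.sym (toℕ-clamp (≤-pred a<n))) (position a<n p p′ s)) (dr ι))

    entries-step : ∀ {A : ∀ ι → M.Carrier ι} {k r} → k < n → D k (suc k) r → ∀ i j ι →
      P′._≈_ ι (entries (λ ι → M._∙_ ι (A ι) (eval (E k (suc k) r) ι)) i j ι)
               (entries (λ ι → M._∙_ ι (A ι) (Mat.elem ι k (suc k) (r ι))) i j ι)
    entries-step {A} k<n dr i j ι =
      Mat.entry (M.∙-congˡ ι {x = A ι} (eval-superdiagonal k<n dr ι)) (clamp n i) (clamp n j)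

    evaluation : Evaluation relations collection matrixFamilies i
    evaluation = record
      { Ê-superdiagonal  = λ {k} r k<n → Ê-position (proj₂ (superdiagonal k k<n))
      ; entries          = entries
      ; 𝒢                = λ A → ∀ ι → U.G ι (A ι)
      ; eval             = eval
      ; eval-cong        = λ u≈v ι → W.eval-∼ ι (_≈_.area u≈v ι)
      ; eval-∙           = λ u v ι → W.eval-++ ι (u ι) (v ι)
      ; eval-ε           = λ ι → M.refl ι
      ; 𝒢-ε              = λ ι → U.one
      ; 𝒢-eval           = λ u gA ι → U.mul (gA ι) (W.eval-G ι (u ι))
      ; entries-cong     = λ i j A≈B ι → Mat.entry (A≈B ι) (clamp n i) (clamp n j)
      ; entries-D        = λ {A} gA i j i<j j≤n ι → G.entries-D ι {A ι} (gA ι) i j i<j j≤n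
      ; entries-same     = λ {A} gA k<n dr i j i<j j≤n j≢k ι →
          P′.trans ι (entries-step {A} k<n dr i j ι) (Mat.*-elem-≢ ι ≤-refl k<n {A ι} i j≤n j≢k)
      ; entries-above    = λ {A} {k} gA k<n dr i i<k ι →
          P′.trans ι (entries-step {A} k<n dr i (suc k) ι) (Mat.*-elem-≡ ι ≤-refl k<n {A ι} i)
      ; entries-diagonal = λ {A} {k} {r} gA k<n dr ι →
          P′.trans ι (entries-step {A} k<n dr k (suc k) ι) (P′.trans ι (Mat.*-elem-≡ ι ≤-refl k<n {A ι} k)
            (P′.+-congˡ ι (P′.trans ι (P′.*-congʳ ι (G.entries-diagonal ι {A ι} (gA ι) k))
              (P′.*-identityˡ ι (r ι)))))
      }

  open Absorption evaluation

  private
    open OrderedProduct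
    factors : (∀ ι → M.Carrier ι) → ℕ → ℕ → WordFamily
    factors A i j = E i j (entries A i j)

    entryFamily : (∀ ι → M.Carrier ι) → WordFamily
    entryFamily A = triangle H.rawMonoid (factors A) (suc n)

    Absorbed-entryFamily : ∀ {A} → (∀ ι → U.G ι (A ι)) → Absorbed (entryFamily A)
    Absorbed-entryFamily {A} gA = Absorbed-triangle {factors A} (suc n) λ i j i<j j<n →
      factor i<j (classify i<j (≤-pred j<n)) λ ι → G.entries-D ι {A ι} (gA ι) i j i<j (≤-pred j<n)
      where
      factor : ∀ {i j p} → i < j → CornerOrPosition i j → D i j p → Absorbed (E i j p)
      factor _ isCorner _ =
        Absorbed-cong (pointwise-≋ λ ι → W.≡⇒≋ ι (≡.sym (W.elementWord-corner ι))) Absorbed-ε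
      factor _ (isPosition pos) dp = Absorbed-E pos dp

    entryFamily-at : ∀ A ι → entryFamily A ι ≡ T.entryWord ι (A ι)
    entryFamily-at A ι = triangle-rel H.rawMonoid (T.wordMonoid ι) (λ u w → u ι ≡ w) ≡.refl (≡.cong₂ _++_)
      {factors A} {λ i j → W.elementWord ι i j (G.entries ι (A ι) i j)} (suc n) λ _ _ _ _ → ≡.refl

    short-InK : ∀ ι w → length w ≤ 1 → ∃[ a ] W.InK ι a w
    short-InK ι []      _ = zero , []
    short-InK ι (x ∷ []) _ = proj₁ (W.letter-K ι x) , proj₂ (W.letter-K ι x) ∷ []
    short-InK ι (_ ∷ _ ∷ _) (s≤s ())

    InK-K : ∀ ι {a} w → W.InK ι a w → U.K ι a (U.eval ι w)
    InK-K ι []      []       = U.one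
    InK-K ι (x ∷ w) (k ∷ kw) = U.mul k (InK-K ι w kw)

    -- A letter is an arbitrary element of some `K_a`, and inside `K_a` it equals the word of its
    -- entries at a cost that depends only on `n`. The index `a` may vary with the instance, since
    -- the cost does not depend on it.
    Absorbed-short : ∀ u → (∀ ι → length (u ι) ≤ 1) → Absorbed u
    Absorbed-short u short = Absorbed-cong (H.sym u≈) (Absorbed-entryFamily λ ι → W.eval-G ι (u ι))
      where
      size = triangle ℕ.+-0-rawMonoid (λ _ _ → 1) (suc n)
      u≈ : u ≈ entryFamily (eval u)
      u≈ = within (2 ℕ.* 1 ℕ.+ (2 ℕ.+ 2 ℕ.* size)) λ ι →
        ≡.subst (W._∼⟨_⟩_ ι (u ι) _) (≡.sym (entryFamily-at (eval u) ι))
          (letter-area ι (short-InK ι (u ι) (short ι)))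
        where
        letter-area : ∀ ι → ∃[ a ] W.InK ι a (u ι) →
          W._∼⟨_⟩_ ι (u ι) (2 ℕ.* 1 ℕ.+ (2 ℕ.+ 2 ℕ.* size)) (T.entryWord ι (eval u ι))
        letter-area ι (a , k) = W.Represents-∼ ι
          (W.represents {a = a} {A = eval u ι} {w = u ι} k (M.refl ι) (short ι))
          (T.entryWord-represents ι {a} (eval u ι) (InK-K ι (u ι) k)) (M.refl ι)

  -- The induction is on the common bound, because the lengths vary with the instance: `take 1` and
  -- `drop 1` split all words simultaneously, and a word that is already used up contributes empty
  -- pieces.
  Absorbed-bounded : ∀ m u → (∀ ι → length (u ι) ≤ m) → Absorbed u
  Absorbed-bounded zero u len = Absorbed-cong (pointwise-≋ λ ι → empty ι (u ι) (len ι)) Absorbed-ε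
    where
    empty : ∀ ι w → length w ≤ 0 → U._≋_ ι [] w
    empty ι [] _ = W.≋-refl ι
  Absorbed-bounded (suc m) u len = Absorbed-cong
    (pointwise-≋ λ ι → W.≡⇒≋ ι (take++drop≡id 1 (u ι)))
    (Absorbed-∙ (Absorbed-short (λ ι → take 1 (u ι)) λ ι → take-short (u ι))
                (Absorbed-bounded m (λ ι → drop 1 (u ι)) λ ι → drop-short (u ι) (len ι)))
    where
    take-short : ∀ {A : Set} (w : List A) → length (take 1 w) ≤ 1
    take-short []      = z≤n
    take-short (x ∷ w) = s≤s z≤n
    drop-short : ∀ {A : Set} (w : List A) → length w ≤ suc m → length (drop 1 w) ≤ m
    drop-short []      _       = z≤n
    drop-short (x ∷ w) (s≤s l) = l

  trivial-area : ∀ m u → (∀ ι → length (u ι) ≤ m) → (∀ ι → M._≈_ ι (U.eval ι (u ι)) (M.ε ι)) →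
                 u ≈ λ _ → []
  trivial-area m u len triv = Absorbed⇒≈ε (Absorbed-bounded m u len) triv

-- The uniform bound and the presentation.

-- The condition on `q` is a component because, for `n = 3`, the half must exist in all members of
-- the family at the same time.
record Instance (n m : ℕ) : Set₁ where
  field
    q         : ℕ
    condition : 4 ≤ n ⊎ ¬ (2 ∣ q)
    F         : FiniteField q
    word      : UnipotentGroup.Word n F
    short     : length word ≤ m
    trivial   : UnipotentGroup.Trivial n F word

open Instance

key-relation : ∀ L m → HallWitt.Key L (Families.relations L (Instance (suc (suc (suc L))) m) F)
key-relation (suc L) m {g} {r} =
  KeyLarge.key L (Families.relations (suc L) (Instance (suc (suc (suc (suc L)))) m) F) {g} {r}
key-relation zero m {g} {r} =
  -- The family of constant polynomials whose value is one half in each field; for `n = 3` the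
  -- condition can only mean that `q` is odd.
  KeyHalf.key (Families.relations zero (Instance 3 m) F) (λ ι → proj₁ (halves ι) ∷ [])
    (λ ι → PolynomialProperties.bounded (constant ι))
    (λ ι → wrap λ { zero → proj₂ (halves ι) ; (suc k) → FiniteField.refl (F ι) }) {g} {r}
  where
  halves : (ι : Instance 3 m) →
           ∃[ h ] FiniteField._≈_ (F ι) (FiniteField._+_ (F ι) h h) (FiniteField.1# (F ι))
  halves ι with condition ι
  ... | inj₁ (s≤s (s≤s (s≤s ())))
  ... | inj₂ 2∤q = FiniteFieldProperties.half (F ι) 2∤q
  constant : ∀ (ι : Instance 3 m) k → 0 < k → FiniteField._≈_ (F ι)
    (Polynomial.coeff (FiniteField.commutativeRing (F ι)) (proj₁ (halves ι) ∷ []) k) (FiniteField.0# (F ι))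
  constant ι (suc k) _ = FiniteField.refl (F ι)

module UniformArea (L m : ℕ) where
  private
    n : ℕ
    n = suc (suc (suc L))
    I = Instance n m

  uniform-area : Families._≈_ L I F word (λ _ → [])
  uniform-area = FamilyAbsorption.trivial-area L I F (λ {g} {r} → key-relation L m {g} {r}) m word short
    λ ι → UnipotentProperties.≈ᵁ⇒≈ (suc L) (F ι) (trivial ι)

  -- Read off from the derivation of `uniform-area`. It depends on `L` and `m` only, as the
  -- instances are quantified inside that equality.
  bound : ℕ
  bound = Families._≈_.bound uniform-area

  area-bounded : ∀ {q} → (4 ≤ n ⊎ ¬ (2 ∣ q)) → (F : FiniteField q) → ∀ w → length w ≤ m →
                 UnipotentGroup.Trivial n F w → UnipotentGroup.Area≤ n F w bound
  area-bounded {q} c F w len triv = UnipotentWords.∼⇒Area≤ (suc L) F (Families._≈_.area uniform-area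
    (record { q = q ; condition = c ; F = F ; word = w ; short = len ; trivial = triv }))

module Presentation (m : ℕ) {q} (F : FiniteField q) where
  private
    n : ℕ
    n = suc (suc m)
  open UnipotentGroup n F hiding (_*_; _≈_)
  open MatrixProperties (PolynomialProperties.filteredRing (FiniteField.commutativeRing F)) n
  private module M = Monoid *-monoid
  open UnipotentProperties m F
  open UnipotentWords m F

  private
    other : ∀ (j : Fin n) → ∃[ a ] j ≢ a
    other zero    = suc zero , λ ()
    other (suc j) = zero , λ ()

  G⇒word : ∀ {A} → G A → ∃[ w ] eval w M.≈ A
  G⇒word (gen {A} (j , x , y , A≈)) with A ≈ᴹ? 1ᴹ
  -- Letters are nontrivial, so a generator equal to the identity is spelled by the empty word.
  ... | yes A≈1 = [] , M.sym A≈1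
  ... | no A≉1 = letter kA A≉1 ∷ [] , M.trans (eval-letter (letter kA A≉1)) (M.reflexive (⟦letter⟧ kA A≉1))
    where
    kA : K (proj₁ (other j)) A
    kA = gen (j , proj₂ (other j) , x , y , A≈)
  G⇒word one = [] , M.refl
  G⇒word (mul g h) with G⇒word g | G⇒word h
  ... | u , u≈ | v , v≈ = u ++ v , M.trans (eval-++ u v) (M.∙-cong u≈ v≈)
  G⇒word (inv {A} {B} g AB BA) with G⇒word g
  ... | u , u≈ = u ⁻¹ , M.sym (M-inverse-unique {A = eval u} {B = eval (u ⁻¹)} {C = B} (eval-⁻¹ u)
    (M.trans (M.∙-congˡ {x = B} u≈) (≈ᵁ⇒≈ BA)))
  G⇒word (resp {A} {B} A≈B g) with G⇒word g
  ... | u , u≈ = u , M.trans u≈ (≈ᵁ⇒≈ {A} {B} A≈B)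

  word⇒G : ∀ {A} w → eval w M.≈ A → G A
  word⇒G w w≈A = resp′ w≈A (eval-G w)

  normalClosure-trivial : ∀ w → NormalClosure w → Trivial w
  normalClosure-trivial w (k , cs , w≋) = ≈⇒≈ᵁ (M.trans (eval-≋ w≋)
    (M.trans (M.reflexive (≡.cong (λ ws → eval (concat ws)) (toList-map Conjugate.word cs)))
      (eval-product (Vec.toList cs))))

  isPresentation : (∀ w → Trivial w → NormalClosure w) → IsPresentation
  isPresentation trivial-normalClosure = record
    { image  = λ A → mk⇔ (λ g → proj₁ (G⇒word g) , ≈⇒≈ᵁ (proj₂ (G⇒word g)))
                         (λ { (w , w≈A) → word⇒G w (≈ᵁ⇒≈ {eval w} {A} w≈A) })
    ; kernel = λ w → mk⇔ (trivial-normalClosure w) (normalClosure-trivial w)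
    }

theorem7p14 : ∀ (n : ℕ) → 3 ≤ n →
    Σ[ bound ∈ (ℕ → ℕ) ]
    (∀ (q : ℕ) → PrimePower q → (4 ≤ n ⊎ ¬ (2 ∣ q)) → (F : FiniteField q) →
    UnipotentGroup.IsPresentation n F
    × (∀ (m : ℕ) → UnipotentGroup.Dehn≤ n F m (bound m)))
theorem7p14 (suc (suc (suc L))) (s≤s (s≤s (s≤s _))) = UniformArea.bound L , λ q _ condition F →
  Presentation.isPresentation (suc L) F
    -- That a trivial word lies in the normal closure is the area bound for `m = length w`.
    (λ w triv → let k , _ , prod = UniformArea.area-bounded L (length w) condition F w ≤-refl triv in k , prod) ,
  λ m w _ len → UniformArea.area-bounded L m condition F w len
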